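{- Set $\mathcal V_s=L^2(X_s)_s$ for $0\le s\le\lfloor n/2\rfloor$ and let $T:\bigoplus_{s=0}^{\lfloor n/2\rfloor}\mathcal V_s^{\,n-2s+1}\to L^2(X)$ be the map $T\big((\mathrm v_s^r)_{0\le s\le\lfloor n/2\rfloor,\ s\le r\le n-s}\big)=\sum_{s=0}^{\lfloor n/2\rfloor}\sum_{r=s}^{n-s}\widetilde\Lambda_s^{s,r}(\mathrm v_s^r)$, which is a unitary $G$-equivariant isomorphism. Let $\mathrm F_X=T^{ -1}\circ\mathcal F_X\circ T$. Then $\mathrm F_X\big((\mathrm v_s^r)\big)=(\mathrm w_s^r)$, where for $0\le s_0\le\lfloor n/2\rfloor$ and $s_0\le r_0\le n-s_0$, $$\mathrm w_{s_0}^{r_0}=\sum_{r=s_0}^{n-s_0}k_{s_0}^{r,r_0}\,\mathrm v_{s_0}^r,\qquad k_s^{r_1,r_2}=(-2)^s\sqrt{\binom{n-2s}{r_2-s}\Big/\binom{n-2s}{r_1-s}}\;P_{r_1-s}(r_2-s,\,n-2s).$$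
   Context: Let $\Omega$ be a finite set with $|\Omega|=n\ge1$, $G=S(\Omega)$, $X=\mathcal P(\Omega)$, $X_r=\{x\in X:|x|=r\}$, $G$ acting on $L^2(X)$ (complex functions on $X$ with standard inner product; $L^2(X_r)$ = functions supported on $X_r$) by $(\rho(g)\psi)(x)=\psi(g^{ -1}x)$. For $0\le s\le\min(r,n-r)$, $L^2(X_r)_s$ is the unique irreducible $G$-subspace of $L^2(X_r)$ isomorphic to the irreducible representation associated with the partition $(n-s,s)$. For $0\le s\le\min(r_1,n-r_1,r_2,n-r_2)$, $\Lambda_s^{r_1,r_2}$ is a $G$-equivariant map $L^2(X)\to L^2(X)$ sending $L^2(X_{r_1})_s$ into $L^2(X_{r_2})_s$ and vanishing on its orthogonal complement, with kernel $\lambda$ defined on integers $\max(0,r_2-r_1)\le k\le\min(n-r_1,r_2)$ by $(\Lambda_s^{r_1,r_2}\psi)(x_2)=\sum_{x_1\in X_{r_1}}\lambda(|x_2\setminus x_1|)\psi(x_1)$; the kernel agrees on its domain with a unique polynomial of degree $s$, nonzero at $0$, and $\Lambda_s^{r_1,r_2}$ is normalized so that this polynomial is $1$ at $t=0$. Set $\widetilde\Lambda_s^{r_1,r_2}=\alpha_s^{r_1,r_2}\Lambda_s^{r_1,r_2}$ with $\alpha_s^{r_1,r_2}=\dfrac{[n-r_1]_s[r_2]_s}{\sqrt{\binom{n-2s}{r_1-s}\binom{n-2s}{r_2-s}}\,s!\,[n-s+1]_s}$, where $[\alpha]_k=\alpha(\alpha-1)\cdots(\alpha-k+1)$. The Fourier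 transform is $(\mathcal F_X\psi)(x)=\sum_{x'\in X}(-1)^{|x\cap x'|}\psi(x')$. Krawtchouk polynomials: $P_m(k,N)=\sum_{j=0}^m(-1)^j\binom{k}{j}\binom{N-k}{m-j}$. $\mathcal V_s^{\,m}$ denotes the direct sum of $m$ copies of $\mathcal V_s$, with components indexed by $r\in\{s,\dots,n-s\}$. -}

module Defs where

open import Algebra.Bundles using (CommutativeRing)
open import Algebra.Module.Bundles using (LeftModule)
open import Algebra.Module.Morphism.Structures
  using (IsLeftModuleHomomorphism; IsLeftModuleIsomorphism)
import Algebra.Properties.CommutativeSemigroup as CommutativeSemigroupProperties
import Algebra.Properties.Monoid.Mult as Mult
import Algebra.Properties.Monoid.Sum as Sum
import Algebra.Properties.Ring as RingProperties
import Algebra.Properties.Semiring.Exp as Exp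
open import Data.Bool using (if_then_else_)
import Data.Bool.Properties as Bool
open import Data.Fin using (Fin; toℕ; fromℕ; inject≤)
import Data.Fin as Fin
open import Data.Fin.Permutation as Perm using (Permutation′; _⟨$⟩ʳ_; _⟨$⟩ˡ_; _∘ₚ_)
open import Data.Fin.Properties using (any?)
open import Data.Fin.Subset using (Subset; inside; outside; ∣_∣; _∩_; _─_)
open import Data.Nat as ℕ using (ℕ; zero; suc; _∸_; _⊓_; ⌊_/2⌋; _!)
open import Data.Nat.Combinatorics using (_C_; _P_)
open import Data.Product using (Σ; ∃; _×_; _,_; proj₁; proj₂)
open import Data.Sum using (_⊎_; inj₁; inj₂)
open import Data.Vec using ([]; _∷_; lookup; tabulate)
open import Data.Vec.Properties
  using (≡-dec; lookup∘tabulate; tabulate∘lookup; tabulate-cong)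
open import Function using (_↔_; mk⇔; Inverse)
open import Function.Construct.Composition using (_↔-∘_)
open import Level using (0ℓ)
open import Relation.Binary using (IsStrictTotalOrder)
open import Relation.Binary.PropositionalEquality as ≡ using (_≡_; _≢_)
open import Relation.Nullary using (¬_; Dec; does)
open import Relation.Nullary.Decidable using (does-⇔)

-- The real numbers as a Dedekind-complete ordered field, in the classical
-- sense: the order is total.  The function _⁻¹ is total with an unspecified
-- value at 0, and √ is unspecified on negative numbers.  In a complete ordered
-- field √ exists and is determined on x ≥ 0 by the two laws below.

record RealNumbers : Set₁ where
  infix  4 _<_ _≤_
  infix  9 _⁻¹
  infixl 7 _/_
  field
    commutativeRing : CommutativeRing 0ℓ 0ℓ
  open CommutativeRing commutativeRing public
  field
    _<_                : Carrier → Carrier → Set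
    isStrictTotalOrder : IsStrictTotalOrder _≈_ _<_
    0<1                : 0# < 1#
    +-monoˡ-<          : ∀ x y z → x < y → x + z < y + z
    *-pos              : ∀ x y → 0# < x → 0# < y → 0# < x * y
    _⁻¹                : Carrier → Carrier
    ⁻¹-inverseʳ        : ∀ x → ¬ x ≈ 0# → x * x ⁻¹ ≈ 1#

  _≤_ : Carrier → Carrier → Set
  x ≤ y = x < y ⊎ x ≈ y

  _/_ : Carrier → Carrier → Carrier
  x / y = x * y ⁻¹

  IsUpperBound : (Carrier → Set) → Carrier → Set
  IsUpperBound S b = ∀ x → S x → x ≤ b

  field
    supremum : (S : Carrier → Set) → ∃ S → ∃ (IsUpperBound S) →
               ∃ λ b → IsUpperBound S b × (∀ c → IsUpperBound S c → b ≤ c)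
    √        : Carrier → Carrier
    √-nonneg : ∀ x → 0# ≤ x → 0# ≤ √ x
    √-square : ∀ x → 0# ≤ x → √ x * √ x ≈ x

  open Exp semiring public using (_^_)
  open Sum +-monoid public using (sum)

  ι : ℕ → Carrier
  ι m = Mult._×_ +-monoid m 1#

module Complex (ℝ : RealNumbers) where
  private
    module R = RealNumbers ℝ

  infix 5 _+i_
  record ℂ : Set where
    constructor _+i_
    field
      re im : R.Carrier
  open ℂ public

  module _ where
    private
      open R using (_+_; _*_; -_; 0#; 1#; _≈_)
      open RingProperties R.ring using (x[y-z]≈xy-xz; [y-z]x≈yx-zx; -0#≈0#; -‿+-comm)
      open CommutativeSemigroupProperties R.+-commutativeSemigroup using (interchange)
      open import Relation.Binary.Reasoning.Setoid R.setoid

      sub-interchange : ∀ p q r s → (p + q) + - (r + s) ≈ (p + - r) + (q + - s)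
      sub-interchange p q r s =
        R.trans (R.+-congˡ (R.sym (-‿+-comm r s))) (interchange p q (- r) (- s))

      *-assoc-re : ∀ a b c d e f →
        (a * c + - (b * d)) * e + - ((a * d + b * c) * f) ≈
        a * (c * e + - (d * f)) + - (b * (c * f + d * e))
      *-assoc-re a b c d e f = begin
        (a * c + - (b * d)) * e + - ((a * d + b * c) * f)
          ≈⟨ R.+-cong ([y-z]x≈yx-zx e (a * c) (b * d)) (R.-‿cong (R.distribʳ f (a * d) (b * c))) ⟩
        (a * c * e + - (b * d * e)) + - (a * d * f + b * c * f)
          ≈⟨ sub-interchange _ _ _ _ ⟩
        (a * c * e + - (a * d * f)) + (- (b * d * e) + - (b * c * f))
          ≈⟨ R.+-congˡ (R.trans (R.+-comm _ _) (-‿+-comm _ _)) ⟩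
        (a * c * e + - (a * d * f)) + - (b * c * f + b * d * e)
          ≈⟨ R.+-cong (R.+-cong (R.*-assoc a c e) (R.-‿cong (R.*-assoc a d f)))
                      (R.-‿cong (R.+-cong (R.*-assoc b c f) (R.*-assoc b d e))) ⟩
        (a * (c * e) + - (a * (d * f))) + - (b * (c * f) + b * (d * e))
          ≈⟨ R.+-cong (x[y-z]≈xy-xz a (c * e) (d * f)) (R.-‿cong (R.distribˡ b (c * f) (d * e))) ⟨
        a * (c * e + - (d * f)) + - (b * (c * f + d * e)) ∎

      *-assoc-im : ∀ a b c d e f →
        (a * c + - (b * d)) * f + (a * d + b * c) * e ≈
        a * (c * f + d * e) + b * (c * e + - (d * f))
      *-assoc-im a b c d e f = begin
        (a * c + - (b * d)) * f + (a * d + b * c) * e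
          ≈⟨ R.+-cong ([y-z]x≈yx-zx f (a * c) (b * d)) (R.distribʳ e (a * d) (b * c)) ⟩
        (a * c * f + - (b * d * f)) + (a * d * e + b * c * e)
          ≈⟨ interchange _ _ _ _ ⟩
        (a * c * f + a * d * e) + (- (b * d * f) + b * c * e)
          ≈⟨ R.+-cong (R.+-cong (R.*-assoc a c f) (R.*-assoc a d e))
                      (R.trans (R.+-comm _ _)
                        (R.+-cong (R.*-assoc b c e) (R.-‿cong (R.*-assoc b d f)))) ⟩
        (a * (c * f) + a * (d * e)) + (b * (c * e) + - (b * (d * f)))
          ≈⟨ R.+-cong (R.distribˡ a (c * f) (d * e)) (x[y-z]≈xy-xz b (c * e) (d * f)) ⟨
        a * (c * f + d * e) + b * (c * e + - (d * f)) ∎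

      x+-0y≈x : ∀ x y → x + - (0# * y) ≈ x
      x+-0y≈x x y = R.trans (R.+-congˡ (R.trans (R.-‿cong (R.zeroˡ y)) -0#≈0#)) (R.+-identityʳ x)

      x+-y0≈x : ∀ x y → x + - (y * 0#) ≈ x
      x+-y0≈x x y = R.trans (R.+-congˡ (R.-‿cong (R.*-comm y 0#))) (x+-0y≈x x y)

    ℂ-commutativeRing : CommutativeRing 0ℓ 0ℓ
    ℂ-commutativeRing = record
      { Carrier = ℂ
      ; _≈_ = λ z w → (re z ≈ re w) × (im z ≈ im w)
      ; _+_ = λ z w → re z + re w +i im z + im w
      ; _*_ = λ z w → re z * re w + - (im z * im w) +i re z * im w + im z * re w
      ; -_  = λ z → - re z +i - im z
      ; 0#  = 0# +i 0#
      ; 1#  = 1# +i 0#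
      ; isCommutativeRing = record
        { isRing = record
          { +-isAbelianGroup = record
            { isGroup = record
              { isMonoid = record
                { isSemigroup = record
                  { isMagma = record
                    { isEquivalence = record
                      { refl  = R.refl , R.refl
                      ; sym   = λ (p , q) → R.sym p , R.sym q
                      ; trans = λ (p , q) (p′ , q′) → R.trans p p′ , R.trans q q′
                      }
                    ; ∙-cong = λ (p , q) (p′ , q′) → R.+-cong p p′ , R.+-cong q q′
                    }
                  ; assoc = λ _ _ _ → R.+-assoc _ _ _ , R.+-assoc _ _ _
                  }
                ; identity = (λ _ → R.+-identityˡ _ , R.+-identityˡ _)
                           , (λ _ → R.+-identityʳ _ , R.+-identityʳ _)
                }
              ; inverse = (λ _ → R.-‿inverseˡ _ , R.-‿inverseˡ _)
                        , (λ _ → R.-‿inverseʳ _ , R.-‿inverseʳ _)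
              ; ⁻¹-cong = λ (p , q) → R.-‿cong p , R.-‿cong q
              }
            ; comm = λ _ _ → R.+-comm _ _ , R.+-comm _ _
            }
          ; *-cong = λ (p , q) (p′ , q′) →
                R.+-cong (R.*-cong p p′) (R.-‿cong (R.*-cong q q′))
              , R.+-cong (R.*-cong p q′) (R.*-cong q p′)
          ; *-assoc = λ (a +i b) (c +i d) (e +i f) →
              *-assoc-re a b c d e f , *-assoc-im a b c d e f
          ; *-identity =
                (λ (a +i b) → R.trans (x+-0y≈x _ b) (R.*-identityˡ a)
                            , R.trans (R.+-cong (R.*-identityˡ b) (R.zeroˡ a)) (R.+-identityʳ b))
              , (λ (a +i b) → R.trans (x+-y0≈x _ b) (R.*-identityʳ a)
                            , R.trans (R.+-cong (R.zeroʳ a) (R.*-identityʳ b)) (R.+-identityˡ b))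
          ; distrib =
                (λ (a +i b) (c +i d) (e +i f) →
                    R.trans (R.+-cong (R.distribˡ a c e) (R.-‿cong (R.distribˡ b d f)))
                            (sub-interchange _ _ _ _)
                  , R.trans (R.+-cong (R.distribˡ a d f) (R.distribˡ b c e))
                            (interchange _ _ _ _))
              , (λ (a +i b) (c +i d) (e +i f) →
                    R.trans (R.+-cong (R.distribʳ a c e) (R.-‿cong (R.distribʳ b d f)))
                            (sub-interchange _ _ _ _)
                  , R.trans (R.+-cong (R.distribʳ b c e) (R.distribʳ a d f))
                            (interchange _ _ _ _))
          }
        ; *-comm = λ (a +i b) (c +i d) →
              R.+-cong (R.*-comm a c) (R.-‿cong (R.*-comm b d))
            , R.trans (R.+-comm _ _) (R.+-cong (R.*-comm b c) (R.*-comm a d))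
        }
      }

  open CommutativeRing ℂ-commutativeRing public hiding (Carrier; zero)
  open Exp semiring public using (_^_)

  open Sum +-monoid public using (sum)

  conj : ℂ → ℂ
  conj (a +i b) = a +i R.- b

  fromReal : R.Carrier → ℂ
  fromReal a = a +i R.0#

  ι : ℕ → ℂ
  ι m = fromReal (R.ι m)

  VectorSpace : Set₁
  VectorSpace = LeftModule ring 0ℓ 0ℓ

  ∏ᵛ : {I : Set} → (I → VectorSpace) → VectorSpace
  ∏ᵛ {I} M = record
    { Carrierᴹ = ∀ i → M.Carrierᴹ i
    ; _≈ᴹ_ = λ u v → ∀ i → M._≈ᴹ_ i (u i) (v i)
    ; _+ᴹ_ = λ u v i → M._+ᴹ_ i (u i) (v i)
    ; _*ₗ_ = λ c v i → M._*ₗ_ i c (v i)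
    ; 0ᴹ   = λ i → M.0ᴹ i
    ; -ᴹ_  = λ v i → M.-ᴹ_ i (v i)
    ; isLeftModule = record
      { isLeftSemimodule = record
        { +ᴹ-isCommutativeMonoid = record
          { isMonoid = record
            { isSemigroup = record
              { isMagma = record
                { isEquivalence = record
                  { refl  = λ i → M.≈ᴹ-refl i
                  ; sym   = λ p i → M.≈ᴹ-sym i (p i)
                  ; trans = λ p q i → M.≈ᴹ-trans i (p i) (q i)
                  }
                ; ∙-cong = λ p q i → M.+ᴹ-cong i (p i) (q i)
                }
              ; assoc = λ _ _ _ i → M.+ᴹ-assoc i _ _ _
              }
            ; identity = (λ _ i → M.+ᴹ-identityˡ i _) , (λ _ i → M.+ᴹ-identityʳ i _)
            }
          ; comm = λ _ _ i → M.+ᴹ-comm i _ _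
          }
        ; isPreleftSemimodule = record
          { *ₗ-cong      = λ p q i → M.*ₗ-cong i p (q i)
          ; *ₗ-zeroˡ     = λ _ i → M.*ₗ-zeroˡ i _
          ; *ₗ-distribʳ  = λ _ _ _ i → M.*ₗ-distribʳ i _ _ _
          ; *ₗ-identityˡ = λ _ i → M.*ₗ-identityˡ i _
          ; *ₗ-assoc     = λ _ _ _ i → M.*ₗ-assoc i _ _ _
          ; *ₗ-zeroʳ     = λ _ i → M.*ₗ-zeroʳ i _
          ; *ₗ-distribˡ  = λ _ _ _ i → M.*ₗ-distribˡ i _ _ _
          }
        }
      ; -ᴹ‿cong    = λ p i → M.-ᴹ‿cong i (p i)
      ; -ᴹ‿inverse = (λ _ i → M.-ᴹ‿inverseˡ i _) , (λ _ i → M.-ᴹ‿inverseʳ i _)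
      }
    }
    where module M (i : I) = LeftModule (M i)

  sumᵛ : (M : VectorSpace) {m : ℕ} →
         (Fin m → LeftModule.Carrierᴹ M) → LeftModule.Carrierᴹ M
  sumᵛ M = Sum.sum (LeftModule.+ᴹ-monoid M)

  IsLinear : (M N : VectorSpace) →
             (LeftModule.Carrierᴹ M → LeftModule.Carrierᴹ N) → Set
  IsLinear M N =
    IsLeftModuleHomomorphism (LeftModule.rawLeftModule M) (LeftModule.rawLeftModule N)

  IsLinearIso : (M N : VectorSpace) →
                (LeftModule.Carrierᴹ M → LeftModule.Carrierᴹ N) → Set
  IsLinearIso M N =
    IsLeftModuleIsomorphism (LeftModule.rawLeftModule M) (LeftModule.rawLeftModule N)

module PowerSet (ℝ : RealNumbers) (n : ℕ) where
  open Complex ℝ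
  private
    module R = RealNumbers ℝ

  -- The set Ω is Fin n.
  G : Set
  G = Permutation′ n

  X : Set
  X = Subset n

  infixr 8 _•_
  _•_ : G → X → X
  g • x = tabulate λ ω → lookup x (g ⟨$⟩ˡ ω)

  record Representation : Set₁ where
    field
      space : VectorSpace
    open LeftModule space public
    field
      act        : G → Carrierᴹ → Carrierᴹ
      act-linear : ∀ g → IsLinear space space (act g)
      act-cong   : ∀ g h → g Perm.≈ h → ∀ v → act g v ≈ᴹ act h v
      act-id     : ∀ v → act Perm.id v ≈ᴹ v
      -- h ∘ₚ g is g after h.
      act-∘      : ∀ g h v → act (h ∘ₚ g) v ≈ᴹ act g (act h v)

  Vector : Representation → Set
  Vector = Representation.Carrierᴹ

  IsEquivariant : (V W : Representation) → (Vector V → Vector W) → Set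
  IsEquivariant V W f = ∀ g v → f (V.act g v) W.≈ᴹ W.act g (f v)
    where
    module V = Representation V
    module W = Representation W

  record IsIntertwiner (V W : Representation) (f : Vector V → Vector W) : Set where
    field
      linear      : IsLinear (Representation.space V) (Representation.space W) f
      equivariant : IsEquivariant V W f

  record IsRepIso (V W : Representation) (f : Vector V → Vector W) : Set where
    field
      linearIso   : IsLinearIso (Representation.space V) (Representation.space W) f
      equivariant : IsEquivariant V W f

  _≅_ : Representation → Representation → Set
  V ≅ W = ∃ (IsRepIso V W)

  ∏ʳ : {I : Set} → (I → Representation) → Representation
  ∏ʳ {I} V = record
    { space      = ∏ᵛ λ i → V.space i
    ; act        = λ g v i → V.act i g (v i)
    ; act-linear = λ g → record
      { +ᴹ-isGroupHomomorphism = record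
        { isMonoidHomomorphism = record
          { isMagmaHomomorphism = record
            { isRelHomomorphism = record
              { cong = λ p i → L.⟦⟧-cong i g (p i) }
            ; homo = λ _ _ i → L.+ᴹ-homo i g _ _
            }
          ; ε-homo = λ i → L.0ᴹ-homo i g
          }
        ; ⁻¹-homo = λ _ i → L.-ᴹ-homo i g _
        }
      ; *ₗ-homo = λ _ _ i → L.*ₗ-homo i g _ _
      }
    ; act-cong = λ g h p v i → V.act-cong i g h p (v i)
    ; act-id   = λ v i → V.act-id i (v i)
    ; act-∘    = λ g h v i → V.act-∘ i g h (v i)
    }
    where
    module V (i : I) = Representation (V i)
    module L (i : I) (g : G) = IsLeftModuleHomomorphism (V.act-linear i g)

  L² : VectorSpace
  L² = ∏ᵛ {I = X} λ _ → record
    { Carrierᴹ = ℂ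
    ; _≈ᴹ_ = _≈_
    ; _+ᴹ_ = _+_
    ; _*ₗ_ = _*_
    ; 0ᴹ   = 0#
    ; -ᴹ_  = -_
    ; isLeftModule = record
      { isLeftSemimodule = record
        { +ᴹ-isCommutativeMonoid = +-isCommutativeMonoid
        ; isPreleftSemimodule = record
          { *ₗ-cong      = *-cong
          ; *ₗ-zeroˡ     = zeroˡ
          ; *ₗ-distribʳ  = distribʳ
          ; *ₗ-identityˡ = *-identityˡ
          ; *ₗ-assoc     = *-assoc
          ; *ₗ-zeroʳ     = zeroʳ
          ; *ₗ-distribˡ  = distribˡ
          }
        }
      ; -ᴹ‿cong    = -‿cong
      ; -ᴹ‿inverse = -‿inverse
      }
    }

  𝓛 : Representation
  𝓛 = record
    { space      = L²
    ; act        = λ g ψ x → ψ (Perm.flip g • x)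
    ; act-linear = λ g → record
      { +ᴹ-isGroupHomomorphism = record
        { isMonoidHomomorphism = record
          { isMagmaHomomorphism = record
            { isRelHomomorphism = record { cong = λ p x → p (Perm.flip g • x) }
            ; homo = λ _ _ _ → refl
            }
          ; ε-homo = λ _ → refl
          }
        ; ⁻¹-homo = λ _ _ → refl
        }
      ; *ₗ-homo = λ _ _ _ → refl
      }
    ; act-cong = λ g h p ψ x →
        reflexive (≡.cong ψ (tabulate-cong λ ω → ≡.cong (lookup x) (p ω)))
    ; act-id   = λ ψ x → reflexive (≡.cong ψ (tabulate∘lookup x))
    ; act-∘    = λ g h ψ x → reflexive (≡.cong ψ (tabulate-cong λ ω →
        ≡.sym (lookup∘tabulate (λ ω′ → lookup x (g ⟨$⟩ʳ ω′)) (h ⟨$⟩ʳ ω))))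
    }

  private
    module 𝓛 = Representation 𝓛

  record Subrep : Set₁ where
    field
      Mem         : Vector 𝓛 → Set
      resp        : ∀ {φ ψ} → φ 𝓛.≈ᴹ ψ → Mem φ → Mem ψ
      +-closed    : ∀ {φ ψ} → Mem φ → Mem ψ → Mem (φ 𝓛.+ᴹ ψ)
      0-closed    : Mem 𝓛.0ᴹ
      *-closed    : ∀ c {ψ} → Mem ψ → Mem (c 𝓛.*ₗ ψ)
      act-closed  : ∀ g {ψ} → Mem ψ → Mem (𝓛.act g ψ)

    neg-closed : ∀ {ψ} → Mem ψ → Mem (𝓛.-ᴹ ψ)
    neg-closed m = resp (λ x → RingProperties.-1*x≈-x ring _) (*-closed (- 1#) m)

    rep : Representation
    rep = record
      { space = record
        { Carrierᴹ = Σ (Vector 𝓛) Mem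
        ; _≈ᴹ_ = λ u v → proj₁ u 𝓛.≈ᴹ proj₁ v
        ; _+ᴹ_ = λ (φ , p) (ψ , q) → φ 𝓛.+ᴹ ψ , +-closed p q
        ; _*ₗ_ = λ c (ψ , q) → c 𝓛.*ₗ ψ , *-closed c q
        ; 0ᴹ   = 𝓛.0ᴹ , 0-closed
        ; -ᴹ_  = λ (ψ , q) → 𝓛.-ᴹ ψ , neg-closed q
        ; isLeftModule = record
          { isLeftSemimodule = record
            { +ᴹ-isCommutativeMonoid = record
              { isMonoid = record
                { isSemigroup = record
                  { isMagma = record
                    { isEquivalence = record
                      { refl  = 𝓛.≈ᴹ-refl
                      ; sym   = 𝓛.≈ᴹ-sym
                      ; trans = 𝓛.≈ᴹ-trans
                      }
                    ; ∙-cong = 𝓛.+ᴹ-cong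
                    }
                  ; assoc = λ _ _ _ → 𝓛.+ᴹ-assoc _ _ _
                  }
                ; identity = (λ _ → 𝓛.+ᴹ-identityˡ _) , (λ _ → 𝓛.+ᴹ-identityʳ _)
                }
              ; comm = λ _ _ → 𝓛.+ᴹ-comm _ _
              }
            ; isPreleftSemimodule = record
              { *ₗ-cong      = 𝓛.*ₗ-cong
              ; *ₗ-zeroˡ     = λ _ → 𝓛.*ₗ-zeroˡ _
              ; *ₗ-distribʳ  = λ _ _ _ → 𝓛.*ₗ-distribʳ _ _ _
              ; *ₗ-identityˡ = λ _ → 𝓛.*ₗ-identityˡ _
              ; *ₗ-assoc     = λ _ _ _ → 𝓛.*ₗ-assoc _ _ _
              ; *ₗ-zeroʳ     = λ _ → 𝓛.*ₗ-zeroʳ _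
              ; *ₗ-distribˡ  = λ _ _ _ → 𝓛.*ₗ-distribˡ _ _ _
              }
            }
          ; -ᴹ‿cong    = 𝓛.-ᴹ‿cong
          ; -ᴹ‿inverse = (λ _ → 𝓛.-ᴹ‿inverseˡ _) , (λ _ → 𝓛.-ᴹ‿inverseʳ _)
          }
        }
      ; act        = λ g (ψ , q) → 𝓛.act g ψ , act-closed g q
      ; act-linear = λ g → record
        { +ᴹ-isGroupHomomorphism = record
          { isMonoidHomomorphism = record
            { isMagmaHomomorphism = record
              { isRelHomomorphism = record { cong = λ p x → p (Perm.flip g • x) }
              ; homo = λ _ _ _ → refl
              }
            ; ε-homo = λ _ → refl
            }
          ; ⁻¹-homo = λ _ _ → refl
          }
        ; *ₗ-homo = λ _ _ _ → refl
        }
      ; act-cong   = λ g h p (ψ , _) → 𝓛.act-cong g h p ψ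
      ; act-id     = λ (ψ , _) → 𝓛.act-id ψ
      ; act-∘      = λ g h (ψ , _) → 𝓛.act-∘ g h ψ
      }

  infix 4 _∈_ _⊆_
  _∈_ : Vector 𝓛 → Subrep → Set
  ψ ∈ W = Subrep.Mem W ψ

  _⊆_ : Subrep → Subrep → Set
  U ⊆ W = ∀ ψ → ψ ∈ U → ψ ∈ W

  IsNonzero : Subrep → Set
  IsNonzero W = ∃ λ ψ → ψ ∈ W × ¬ (ψ 𝓛.≈ᴹ 𝓛.0ᴹ)

  IsIrreducible : Subrep → Set₁
  IsIrreducible W =
    IsNonzero W × (∀ (U : Subrep) → U ⊆ W → IsNonzero U → W ⊆ U)

  SupportedOn : ℕ → Vector 𝓛 → Set
  SupportedOn r ψ = ∀ x → ∣ x ∣ ≢ r → ψ x ≈ 0#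

  ∑-subsets : ∀ {m} → (Subset m → ℂ) → ℂ
  ∑-subsets {zero}  f = f []
  ∑-subsets {suc m} f =
    ∑-subsets (λ y → f (outside ∷ y)) + ∑-subsets (λ y → f (inside ∷ y))

  ∑X : (X → ℂ) → ℂ
  ∑X = ∑-subsets

  ∑X[_] : ℕ → (X → ℂ) → ℂ
  ∑X[ r ] f = ∑X λ x → if does (∣ x ∣ ℕ.≟ r) then f x else 0#

  ⟨_,_⟩ : Vector 𝓛 → Vector 𝓛 → ℂ
  ⟨ φ , ψ ⟩ = ∑X λ x → φ x * conj (ψ x)

  sign : ℕ → ℂ
  sign m = (- 1#) ^ m

  -- The irreducible representation associated with (n - s, s) is the Specht
  -- module: the span of the polytabloids of shape (n - s, s) in the permutation
  -- module on tabloids.  A tabloid of this shape is determined by its second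
  -- row, so the permutation module is realised on the subsets of size s.

  _≟X_ : (x y : X) → Dec (x ≡ y)
  _≟X_ = ≡-dec Bool._≟_

  δ : X → Vector 𝓛
  δ y x = if does (y ≟X x) then 1# else 0#

  image : ∀ {m} → (Fin m → Fin n) → X
  image f = tabulate λ ω → does (any? λ i → f i Fin.≟ ω)

  record Tableau (s : ℕ) : Set where
    field
      shape : s ℕ.≤ n ∸ s
      entry : (Fin (n ∸ s) ⊎ Fin s) ↔ Fin n

    upper lower : Fin s → Fin n
    upper i = Inverse.to entry (inj₁ (inject≤ i shape))
    lower i = Inverse.to entry (inj₂ i)

    -- A column permutation exchanges upper i and lower i for the i in some set
    -- I, and has sign (-1)^|I|; it is applied here to the second row.
    exchanged : Subset s → Fin s → Fin n
    exchanged I i = if lookup I i then upper i else lower i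

    polytabloid : Vector 𝓛
    polytabloid x = ∑-subsets λ I → sign ∣ I ∣ * δ (image (exchanged I)) x

  open Tableau

  data SpechtSpan (s : ℕ) : Vector 𝓛 → Set where
    gen   : (t : Tableau s) → SpechtSpan s (polytabloid t)
    nil   : SpechtSpan s 𝓛.0ᴹ
    add   : ∀ {φ ψ} → SpechtSpan s φ → SpechtSpan s ψ → SpechtSpan s (φ 𝓛.+ᴹ ψ)
    scale : ∀ c {ψ} → SpechtSpan s ψ → SpechtSpan s (c 𝓛.*ₗ ψ)
    resp  : ∀ {φ ψ} → φ 𝓛.≈ᴹ ψ → SpechtSpan s φ → SpechtSpan s ψ

  module _ (g : G) where
    private
      •-image : ∀ {m} (f : Fin m → Fin n) → g • image f ≡ image (λ i → g ⟨$⟩ʳ f i)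
      •-image f = tabulate-cong λ ω → ≡.trans
        (lookup∘tabulate (λ ω′ → does (any? λ i → f i Fin.≟ ω′)) (g ⟨$⟩ˡ ω))
        (does-⇔ (mk⇔
          (λ (i , p) → i , ≡.trans (≡.cong (g ⟨$⟩ʳ_) p) (Perm.inverseʳ g))
          (λ (i , p) → i , ≡.trans (≡.sym (Perm.inverseˡ g)) (≡.cong (g ⟨$⟩ˡ_) p)))
          (any? λ i → f i Fin.≟ (g ⟨$⟩ˡ ω))
          (any? λ i → (g ⟨$⟩ʳ f i) Fin.≟ ω))

      •-flip : ∀ x → g • Perm.flip g • x ≡ x
      •-flip x = ≡.trans
        (tabulate-cong λ ω → ≡.trans
          (lookup∘tabulate (λ ω′ → lookup x (g ⟨$⟩ʳ ω′)) (g ⟨$⟩ˡ ω))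
          (≡.cong (lookup x) (Perm.inverseʳ g)))
        (tabulate∘lookup x)

      flip-• : ∀ x → Perm.flip g • g • x ≡ x
      flip-• x = ≡.trans
        (tabulate-cong λ ω → ≡.trans
          (lookup∘tabulate (λ ω′ → lookup x (g ⟨$⟩ˡ ω′)) (g ⟨$⟩ʳ ω))
          (≡.cong (lookup x) (Perm.inverseˡ g)))
        (tabulate∘lookup x)

      δ-act : ∀ y x → 𝓛.act g (δ y) x ≡ δ (g • y) x
      δ-act y x = ≡.cong (if_then 1# else 0#) (does-⇔ (mk⇔
        (λ p → ≡.trans (≡.cong (g •_) p) (•-flip x))
        (λ p → ≡.trans (≡.sym (flip-• y)) (≡.cong (Perm.flip g •_) p)))
        (y ≟X (Perm.flip g • x)) ((g • y) ≟X x))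

      ∑-subsets-cong : ∀ {m} {f h : Subset m → ℂ} → (∀ y → f y ≡ h y) →
                       ∑-subsets f ≡ ∑-subsets h
      ∑-subsets-cong {zero}  p = p []
      ∑-subsets-cong {suc m} p = ≡.cong₂ _+_
        (∑-subsets-cong (λ y → p (outside ∷ y))) (∑-subsets-cong (λ y → p (inside ∷ y)))

      moved : ∀ {s} → Tableau s → Tableau s
      moved t = record { shape = shape t ; entry = g ↔-∘ entry t }

      image-exchanged : ∀ {s} (t : Tableau s) I →
        g • image (exchanged t I) ≡ image (exchanged (moved t) I)
      image-exchanged t I = ≡.trans (•-image (exchanged t I))
        (tabulate-cong λ ω → does-⇔ (mk⇔
          (λ (i , p) → i , ≡.trans (≡.sym (exchange i)) p)
          (λ (i , p) → i , ≡.trans (exchange i) p))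
          (any? λ i → (g ⟨$⟩ʳ exchanged t I i) Fin.≟ ω)
          (any? λ i → exchanged (moved t) I i Fin.≟ ω))
        where
        exchange : ∀ i → g ⟨$⟩ʳ exchanged t I i ≡ exchanged (moved t) I i
        exchange i = Bool.if-float (g ⟨$⟩ʳ_) (lookup I i)

      polytabloid-act : ∀ {s} (t : Tableau s) x →
        𝓛.act g (polytabloid t) x ≡ polytabloid (moved t) x
      polytabloid-act t x = ∑-subsets-cong λ I → ≡.cong (sign ∣ I ∣ *_) (≡.trans
        (δ-act (image (exchanged t I)) x)
        (≡.cong (λ y → δ y x) (image-exchanged t I)))

    SpechtSpan-act : ∀ {s ψ} → SpechtSpan s ψ → SpechtSpan s (𝓛.act g ψ)
    SpechtSpan-act (gen t)     = resp (λ x → reflexive (≡.sym (polytabloid-act t x))) (gen (moved t))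
    SpechtSpan-act nil         = nil
    SpechtSpan-act (add p q)   = add (SpechtSpan-act p) (SpechtSpan-act q)
    SpechtSpan-act (scale c p) = scale c (SpechtSpan-act p)
    SpechtSpan-act (resp e p)  = resp (λ x → e (Perm.flip g • x)) (SpechtSpan-act p)

  Specht : ℕ → Subrep
  Specht s = record
    { Mem = SpechtSpan s ; resp = resp ; +-closed = add ; 0-closed = nil
    ; *-closed = scale ; act-closed = λ g → SpechtSpan-act g }

  -- 0 ≤ s ≤ min(r, n - r) with r ≤ n.
  InRange : ℕ → ℕ → Set
  InRange r s = s ℕ.≤ r × r ℕ.+ s ℕ.≤ n

  -- For r, s in range these properties determine W uniquely, since L²(X_r) is
  -- multiplicity free; W is then L²(X_r)_s.

  record IsComponent (r s : ℕ) (W : Subrep) : Set₁ where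
    field
      supported   : ∀ ψ → ψ ∈ W → SupportedOn r ψ
      irreducible : IsIrreducible W
      isomorphic  : Subrep.rep W ≅ Subrep.rep (Specht s)

  eval : ∀ {d} → (Fin (suc d) → ℂ) → ℕ → ℂ
  eval p t = sum λ i → p i * ι t ^ toℕ i

  -- Here V r s stands for L²(X_r)_s.  When ∣ x₁ ∣ ≡ r₁ and ∣ x₂ ∣ ≡ r₂ the
  -- number ∣ x₂ ─ x₁ ∣ lies in the range of the field agrees, so values of the
  -- kernel outside that range play no role.

  record IsΛ (V : ℕ → ℕ → Subrep) (s r₁ r₂ : ℕ) (Λ : Vector 𝓛 → Vector 𝓛) : Set where
    field
      intertwiner   : IsIntertwiner 𝓛 𝓛 Λ
      maps-into     : ∀ ψ → ψ ∈ V r₁ s → Λ ψ ∈ V r₂ s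
      vanishes      : ∀ ψ → (∀ φ → φ ∈ V r₁ s → ⟨ ψ , φ ⟩ ≈ 0#) → Λ ψ 𝓛.≈ᴹ 𝓛.0ᴹ
      kernel        : ℕ → ℂ
      kernel-spec   : ∀ ψ x₂ → ∣ x₂ ∣ ≡ r₂ →
                      Λ ψ x₂ ≈ ∑X[ r₁ ] λ x₁ → kernel ∣ x₂ ─ x₁ ∣ * ψ x₁
      polynomial    : Fin (suc s) → ℂ
      degree        : ¬ (polynomial (fromℕ s) ≈ 0#)
      agrees        : ∀ k → r₂ ∸ r₁ ℕ.≤ k → k ℕ.≤ (n ∸ r₁) ⊓ r₂ →
                      kernel k ≈ eval polynomial k
      normalised    : eval polynomial 0 ≈ 1#

  -- m P k is the falling factorial [ m ]ₖ.
  α : (s r₁ r₂ : ℕ) → R.Carrier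
  α s r₁ r₂ =
    R.ι (((n ∸ r₁) P s) ℕ.* (r₂ P s)) R./
    (R.√ (R.ι (((n ∸ 2 ℕ.* s) C (r₁ ∸ s)) ℕ.* ((n ∸ 2 ℕ.* s) C (r₂ ∸ s))))
      R.* R.ι ((s !) ℕ.* ((n ∸ s ℕ.+ 1) P s)))

  fourier : Vector 𝓛 → Vector 𝓛
  fourier ψ x = ∑X λ x′ → sign ∣ x ∩ x′ ∣ * ψ x′

  krawtchouk : (m k N : ℕ) → R.Carrier
  krawtchouk m k N = R.sum {suc m} λ j →
    (R.- R.1#) R.^ toℕ j R.* R.ι ((k C toℕ j) ℕ.* ((N ∸ k) C (m ∸ toℕ j)))

  κ : (s r₁ r₂ : ℕ) → R.Carrier
  κ s r₁ r₂ =
    (R.- R.ι 2) R.^ s R.*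
    R.√ (R.ι ((n ∸ 2 ℕ.* s) C (r₂ ∸ s)) R./ R.ι ((n ∸ 2 ℕ.* s) C (r₁ ∸ s))) R.*
    krawtchouk (r₁ ∸ s) (r₂ ∸ s) (n ∸ 2 ℕ.* s)

  module Transform (V : ℕ → ℕ → Subrep) (Λ : (s r₁ r₂ : ℕ) → Vector 𝓛 → Vector 𝓛) where

    𝓥 : ℕ → Representation
    𝓥 s = Subrep.rep (V s s)

    Λ̃ : (s r₁ r₂ : ℕ) → Vector 𝓛 → Vector 𝓛
    Λ̃ s r₁ r₂ ψ = fromReal (α s r₁ r₂) 𝓛.*ₗ Λ s r₁ r₂ ψ

    S : Set
    S = Fin (suc ⌊ n /2⌋)

    -- The index j stands for r = s + j, so r runs over s, …, n - s.
    J : S → Set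
    J s = Fin (suc (n ∸ 2 ℕ.* toℕ s))

    deg : (s : S) → J s → ℕ
    deg s j = toℕ s ℕ.+ toℕ j

    ⨁𝓥 : Representation
    ⨁𝓥 = ∏ʳ λ (s : S) → ∏ʳ λ (_ : J s) → 𝓥 (toℕ s)

    T : Vector ⨁𝓥 → Vector 𝓛
    T v = sumᵛ L² λ s → sumᵛ L² λ j → Λ̃ (toℕ s) (toℕ s) (deg s j) (proj₁ (v s j))

    ⟨_,_⟩⨁ : Vector ⨁𝓥 → Vector ⨁𝓥 → ℂ
    ⟨ v , w ⟩⨁ = sum λ s → sum λ j → ⟨ proj₁ (v s j) , proj₁ (w s j) ⟩

    record IsUnitaryIso (f : Vector ⨁𝓥 → Vector 𝓛) : Set where
      field
        repIso   : IsRepIso ⨁𝓥 𝓛 f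
        isometry : ∀ v w → ⟨ f v , f w ⟩ ≈ ⟨ v , w ⟩⨁

      inverse : Vector 𝓛 → Vector ⨁𝓥
      inverse ψ =
        proj₁ (IsLeftModuleIsomorphism.surjective (IsRepIso.linearIso repIso) ψ)

    F : IsUnitaryIso T → Vector ⨁𝓥 → Vector ⨁𝓥
    F iso v = IsUnitaryIso.inverse iso (fourier (T v))

    w : Vector ⨁𝓥 → Vector ⨁𝓥
    w v s j₀ = sumᵛ 𝓥ₛ.space λ j →
      fromReal (κ (toℕ s) (deg s j) (deg s j₀)) 𝓥ₛ.*ₗ v s j
      where module 𝓥ₛ = Representation (𝓥 (toℕ s))

{-# OPTIONS --safe #-}
-- Write Uψ(x) for the sum of ψ over the subsets of x, and call a function ψ on
-- X_s harmonic if its sum over the supersets of any smaller set vanishes.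
-- Newton's difference formula gives, for harmonic ψ and an arbitrary kernel H,
--   ∑_y ψ(y) H(|y ∖ x|, |y ∩ x|) = (∂ˢH)(0,0) Uψ(x),  ∂H(a,b) = H(a,b+1) - H(a+1,b).
-- Antisymmetry under the column transpositions of a tableau shows that L²(X_s)_s
-- consists of harmonic functions and contains the polytabloids.  The action of
-- Λ_s^{s,r} on it, the inner products of the functions Uψ restricted to the X_r,
-- and the Fourier transforms of these restrictions are then instances of the
-- formula.  On the Fourier kernel ∂ acts as multiplication by -2, which produces
-- (-2)ˢ and leaves a Krawtchouk polynomial.  The scalar by which Λ_s^{s,r} acts is
-- found from the fact that Λ_s^{s,r} kills the indicators of the supersets of a
-- set of size s-1: this is a two-term recurrence for its kernel.  Finally T is
-- onto because, Σ_a x_a being constant on X_r, every function on X_r is a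
-- combination of products of at most n/2 factors x_a - x_b.
module Submission where

open import Defs
open import Data.Nat using (ℕ; _≤_)
open import Data.Product using (Σ-syntax)

open import Algebra.Bundles using (CommutativeMonoid; CommutativeRing)
open import Algebra.Module.Morphism.Structures using (IsLeftModuleIsomorphism)
import Algebra.Properties.CommutativeMonoid.Sum as MonoidSum
open import Data.Bool using (Bool; true; false; if_then_else_)
import Data.Bool.Properties as Bool
open import Data.Empty using (⊥-elim)
open import Data.Fin as Fin using (Fin; zero; suc; toℕ; fromℕ<; inject≤; join; splitAt)
open import Data.Fin.Permutation as Perm using (Permutation′; transpose; _⟨$⟩ʳ_; _⟨$⟩ˡ_)
import Data.Fin.Permutation.Components as PC
import Data.Fin.Properties as Fin
open import Data.Fin.Subset using (Subset; inside; outside; ∣_∣; _∩_; _∪_; _─_; ∁; _⊆_)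
open import Data.Fin.Subset.Properties
  using (_⊆?_; p⊆q⇒∣p∣≤∣q∣; drop-∷-⊆; ∩-comm; ∪-comm; ∣∁p∣≡n∸∣p∣; ∣p∣≤n)
open import Data.Integer using (0ℤ; 1ℤ)
import Data.Integer as ℤ
open import Data.List as List using (List; []; _∷_; _++_; length; map)
import Data.List.Membership.DecPropositional as DecMembership
open import Data.List.Membership.Propositional using () renaming (_∈_ to _∈ˡ_; _∉_ to _∉ˡ_)
open import Data.List.Membership.Propositional.Properties using (∈-++⁺ˡ; ∈-++⁺ʳ)
open import Data.List.Properties using (length-++; length-map)
open import Data.List.Relation.Binary.Disjoint.Propositional using (Disjoint)
open import Data.List.Relation.Unary.All as All using (All; []; _∷_)
import Data.List.Relation.Unary.All.Properties as All
open import Data.List.Relation.Unary.AllPairs using ([]; _∷_)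
open import Data.List.Relation.Unary.Any using (here; there)
open import Data.List.Relation.Unary.Unique.Propositional using (Unique)
import Data.List.Relation.Unary.Unique.Propositional.Properties as Unique
open import Data.Nat as ℕ using (zero; suc; _<_; _∸_; z≤n; s≤s; ⌊_/2⌋; _!)
open import Data.Nat.Combinatorics
  using (_C_; _P_; nCn≡1; nCk+nC[k+1]≡[n+1]C[k+1]; nCk≡n!/k![n-k]!; nPk≡n!/[n∸k]!; [n∸k]!k!∣n!)
open import Data.Nat.Divisibility using (_∣_; ∣-trans; m∣m*n)
open import Data.Nat.DivMod using (m/n*n≡m)
import Data.Nat.Properties as ℕ
open import Data.Product using (Σ; ∃; _×_; _,_; proj₁; proj₂)
open import Data.Sum using (_⊎_; inj₁; inj₂)
open import Data.Sum.Properties using (inj₁-injective; inj₂-injective)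
open import Data.Vec using ([]; _∷_; lookup; tabulate; here)
open import Data.Vec.Properties
  using (lookup∘tabulate; tabulate∘lookup; tabulate-cong; lookup⇒[]=; []=⇒lookup; ≡-dec)
open import Function using (_∘_; _↔_; Injection; Inverse)
open import Function.Construct.Composition using (_↔-∘_)
open import Function.Construct.Symmetry using (↔-sym)
open import Function.Properties.Inverse using (↔⇒↣)
open import Level using (0ℓ)
open import Relation.Binary using (IsStrictTotalOrder; tri<; tri≈; tri>)
open import Relation.Binary.PropositionalEquality as ≡ using (_≡_; _≢_)
open import Relation.Nullary using (¬_; Dec; yes; no; does; contradiction)
open import Relation.Nullary.Decidable using (dec-false; dec-true)

-- The spaces `V s s` are given only up to isomorphism with the Specht module, so nothing about
-- their elements can be read off directly. What an equivariant isomorphism does transport is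
-- antisymmetry under column swaps, and on X_s this property determines a function up to a scalar.
--
-- Once the elements are known to be harmonic, Λ_s^{s,r}, the Gram sums and the Fourier transform
-- all send ψ to a number times `Up ψ` on a layer, and only these numbers have to be found. Write N
-- = n - 2s and r = s + j. The scalar of Λ times α is β = 1/√(N choose j). The same binomial is the
-- factor by which ψ ↦ `Up ψ` on X_r multiplies squared norms, so T is isometric; and the ratio of
-- two values of β is the square root in κ.
--
-- On layers outside s, ..., n - s the function `Up ψ` vanishes. This is what confines the Fourier
-- image to the allowed indices.
--
-- Injectivity of T follows from the isometry. Surjectivity is an explicit elimination rather than a
-- count of dimensions, and it uses only that `V s s` contains every polytabloid.

private variable m n s : ℕ

-- Polynomial identities with integer coefficients in a commutative ring

module IntegerSolver (K : CommutativeRing 0ℓ 0ℓ) where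
  open CommutativeRing K hiding (zero)
  open import Algebra.Properties.Group +-group using (⁻¹-involutive; ε⁻¹≈ε)
  open import Algebra.Properties.AbelianGroup +-abelianGroup using (⁻¹-∙-comm)
  open import Algebra.Properties.Ring ring using (-‿distribˡ-*; -‿distribʳ-*)
  open import Algebra.Properties.Semiring.Mult.TCOptimised semiring
    using (1+×; ×-homo-+; ×1-homo-*) renaming (_×_ to _·_)
  open import Algebra.Solver.Ring.AlmostCommutativeRing
    using (fromCommutativeRing; _-Raw-AlmostCommutative⟶_)
  open import Data.Integer using (ℤ; +_; -[1+_])
  import Data.Integer.Properties as ℤ
  open import Data.Maybe using (Maybe; just; nothing)
  open import Relation.Binary.Reasoning.Setoid setoid

  private
    -- Coefficients are taken in ℤ because equality there is decidable, while that of `K` need not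
    -- be. The optimised multiple makes `1 · 1#` equal to `1#` by computation, so `con 1ℤ` denotes
    -- `1#` itself.
    ⟦_⟧ : ℤ → Carrier
    ⟦ + m ⟧      = m · 1#
    ⟦ -[1+ m ] ⟧ = - (suc m · 1#)

    ⊖-homo : ∀ m k → ⟦ m ℤ.⊖ k ⟧ ≈ m · 1# - k · 1#
    ⊖-homo m       zero    = sym (trans (+-congˡ ε⁻¹≈ε) (+-identityʳ _))
    ⊖-homo zero    (suc k) = sym (+-identityˡ _)
    ⊖-homo (suc m) (suc k) = begin
      ⟦ suc m ℤ.⊖ suc k ⟧                     ≡⟨ ≡.cong ⟦_⟧ (ℤ.[1+m]⊖[1+n]≡m⊖n m k) ⟩
      ⟦ m ℤ.⊖ k ⟧                             ≈⟨ ⊖-homo m k ⟩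
      m · 1# - k · 1#                         ≈⟨ +-congʳ (+-identityʳ _) ⟨
      m · 1# + 0# - k · 1#                    ≈⟨ +-congʳ (+-congˡ (-‿inverseʳ 1#)) ⟨
      m · 1# + (1# - 1#) - k · 1#             ≈⟨ +-congʳ (+-assoc _ _ _) ⟨
      m · 1# + 1# - 1# - k · 1#               ≈⟨ +-assoc _ _ _ ⟩
      m · 1# + 1# + (- 1# - k · 1#)           ≈⟨ +-cong (+-comm _ _) (⁻¹-∙-comm _ _) ⟩
      1# + m · 1# - (1# + k · 1#)             ≈⟨ +-cong (1+× m 1#) (-‿cong (1+× k 1#)) ⟨
      suc m · 1# - suc k · 1#                 ∎

    +-homo : ∀ i j → ⟦ i ℤ.+ j ⟧ ≈ ⟦ i ⟧ + ⟦ j ⟧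
    +-homo (+ m)    (+ k)    = ×-homo-+ 1# m k
    +-homo (+ m)    -[1+ k ] = ⊖-homo m (suc k)
    +-homo -[1+ m ] (+ k)    = trans (⊖-homo k (suc m)) (+-comm _ _)
    +-homo -[1+ m ] -[1+ k ] = begin
      - (suc (suc (m ℕ.+ k)) · 1#)       ≡⟨ ≡.cong (λ i → - (suc i · 1#)) (ℕ.+-suc m k) ⟨
      - ((suc m ℕ.+ suc k) · 1#)         ≈⟨ -‿cong (×-homo-+ 1# (suc m) (suc k)) ⟩
      - (suc m · 1# + suc k · 1#)        ≈⟨ ⁻¹-∙-comm _ _ ⟨
      - (suc m · 1#) - suc k · 1#        ∎

    -‿homo : ∀ i → ⟦ ℤ.- i ⟧ ≈ - ⟦ i ⟧
    -‿homo (+ zero)  = sym ε⁻¹≈ε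
    -‿homo (+ suc m) = refl
    -‿homo -[1+ m ]  = sym (⁻¹-involutive _)

    *-homo⁺ : ∀ m j → ⟦ + m ℤ.* j ⟧ ≈ ⟦ + m ⟧ * ⟦ j ⟧
    *-homo⁺ m (+ k) = trans (reflexive (≡.cong ⟦_⟧ (≡.sym (ℤ.pos-* m k)))) (×1-homo-* m k)
    *-homo⁺ m -[1+ k ] = begin
      ⟦ + m ℤ.* ℤ.- (+ suc k) ⟧     ≡⟨ ≡.cong ⟦_⟧ (ℤ.neg-distribʳ-* (+ m) (+ suc k)) ⟨
      ⟦ ℤ.- (+ m ℤ.* + suc k) ⟧     ≈⟨ -‿homo (+ m ℤ.* + suc k) ⟩
      - ⟦ + m ℤ.* + suc k ⟧         ≈⟨ -‿cong (*-homo⁺ m (+ suc k)) ⟩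
      - (m · 1# * suc k · 1#)       ≈⟨ -‿distribʳ-* _ _ ⟩
      m · 1# * - (suc k · 1#)       ∎

    *-homo : ∀ i j → ⟦ i ℤ.* j ⟧ ≈ ⟦ i ⟧ * ⟦ j ⟧
    *-homo (+ m)    j = *-homo⁺ m j
    *-homo -[1+ m ] j = begin
      ⟦ ℤ.- (+ suc m) ℤ.* j ⟧       ≡⟨ ≡.cong ⟦_⟧ (ℤ.neg-distribˡ-* (+ suc m) j) ⟨
      ⟦ ℤ.- (+ suc m ℤ.* j) ⟧       ≈⟨ -‿homo (+ suc m ℤ.* j) ⟩
      - ⟦ + suc m ℤ.* j ⟧           ≈⟨ -‿cong (*-homo⁺ (suc m) j) ⟩
      - (suc m · 1# * ⟦ j ⟧)        ≈⟨ -‿distribˡ-* _ _ ⟩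
      - (suc m · 1#) * ⟦ j ⟧        ∎

    ℤ-morphism : ℤ.+-*-rawRing -Raw-AlmostCommutative⟶ fromCommutativeRing K
    ℤ-morphism = record
      { ⟦_⟧ = ⟦_⟧ ; +-homo = +-homo ; *-homo = *-homo ; -‿homo = -‿homo
      ; 0-homo = refl ; 1-homo = refl }

    _coeff≟_ : ∀ i j → Maybe (⟦ i ⟧ ≈ ⟦ j ⟧)
    i coeff≟ j with i ℤ.≟ j
    ... | yes ≡.refl = just refl
    ... | no _       = nothing

  open import Algebra.Solver.Ring ℤ.+-*-rawRing _ ℤ-morphism _coeff≟_ public
    using (solve; _:=_; con; _:+_; _:*_; :-_; _:-_)

-- Sizes of intersections, differences and unions

module SubsetCounting where
  open import Data.Nat using (_+_)
  open import Data.Nat.Tactic.RingSolver using (solve-∀)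

  ∣p─q∣+∣p∩q∣≡∣p∣ : (p q : Subset m) → ∣ p ─ q ∣ + ∣ p ∩ q ∣ ≡ ∣ p ∣
  ∣p─q∣+∣p∩q∣≡∣p∣ [] [] = ≡.refl
  ∣p─q∣+∣p∩q∣≡∣p∣ (outside ∷ p) (outside ∷ q) = ∣p─q∣+∣p∩q∣≡∣p∣ p q
  ∣p─q∣+∣p∩q∣≡∣p∣ (outside ∷ p) (inside  ∷ q) = ∣p─q∣+∣p∩q∣≡∣p∣ p q
  ∣p─q∣+∣p∩q∣≡∣p∣ (inside  ∷ p) (outside ∷ q) = ≡.cong suc (∣p─q∣+∣p∩q∣≡∣p∣ p q)
  ∣p─q∣+∣p∩q∣≡∣p∣ (inside  ∷ p) (inside  ∷ q) =
    ≡.trans (ℕ.+-suc _ _) (≡.cong suc (∣p─q∣+∣p∩q∣≡∣p∣ p q))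

  ∣p∣+∣q─p∣+∣∁[p∪q]∣≡m : (p q : Subset m) → ∣ p ∣ + ∣ q ─ p ∣ + ∣ ∁ (p ∪ q) ∣ ≡ m
  ∣p∣+∣q─p∣+∣∁[p∪q]∣≡m [] [] = ≡.refl
  ∣p∣+∣q─p∣+∣∁[p∪q]∣≡m (outside ∷ p) (outside ∷ q) =
    ≡.trans (ℕ.+-suc _ _) (≡.cong suc (∣p∣+∣q─p∣+∣∁[p∪q]∣≡m p q))
  ∣p∣+∣q─p∣+∣∁[p∪q]∣≡m (outside ∷ p) (inside  ∷ q) =
    ≡.trans (≡.cong (_+ ∣ ∁ (p ∪ q) ∣) (ℕ.+-suc ∣ p ∣ (∣ q ─ p ∣))) (≡.cong suc (∣p∣+∣q─p∣+∣∁[p∪q]∣≡m p q))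
  ∣p∣+∣q─p∣+∣∁[p∪q]∣≡m (inside  ∷ p) (outside ∷ q) = ≡.cong suc (∣p∣+∣q─p∣+∣∁[p∪q]∣≡m p q)
  ∣p∣+∣q─p∣+∣∁[p∪q]∣≡m (inside  ∷ p) (inside  ∷ q) = ≡.cong suc (∣p∣+∣q─p∣+∣∁[p∪q]∣≡m p q)

  ∣q─p∣+∣p∣≡∣q∣ : (p q : Subset m) → p ⊆ q → ∣ q ─ p ∣ + ∣ p ∣ ≡ ∣ q ∣
  ∣q─p∣+∣p∣≡∣q∣ [] [] _ = ≡.refl
  ∣q─p∣+∣p∣≡∣q∣ (outside ∷ p) (outside ∷ q) h = ∣q─p∣+∣p∣≡∣q∣ p q (drop-∷-⊆ h)
  ∣q─p∣+∣p∣≡∣q∣ (outside ∷ p) (inside  ∷ q) h = ≡.cong suc (∣q─p∣+∣p∣≡∣q∣ p q (drop-∷-⊆ h))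
  ∣q─p∣+∣p∣≡∣q∣ (inside  ∷ p) (outside ∷ q) h with h here
  ... | ()
  ∣q─p∣+∣p∣≡∣q∣ (inside  ∷ p) (inside  ∷ q) h =
    ≡.trans (ℕ.+-suc _ _) (≡.cong suc (∣q─p∣+∣p∣≡∣q∣ p q (drop-∷-⊆ h)))

  p⊆q∧∣p∣≡∣q∣⇒p≡q : (p q : Subset m) → p ⊆ q → ∣ p ∣ ≡ ∣ q ∣ → p ≡ q
  p⊆q∧∣p∣≡∣q∣⇒p≡q [] [] _ _ = ≡.refl
  p⊆q∧∣p∣≡∣q∣⇒p≡q (outside ∷ p) (outside ∷ q) h e =
    ≡.cong (outside ∷_) (p⊆q∧∣p∣≡∣q∣⇒p≡q p q (drop-∷-⊆ h) e)
  p⊆q∧∣p∣≡∣q∣⇒p≡q (outside ∷ p) (inside  ∷ q) h e =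
    contradiction (p⊆q⇒∣p∣≤∣q∣ (drop-∷-⊆ h)) (ℕ.<⇒≱ (ℕ.≤-reflexive (≡.sym e)))
  p⊆q∧∣p∣≡∣q∣⇒p≡q (inside  ∷ p) (outside ∷ q) h _ with h here
  ... | ()
  p⊆q∧∣p∣≡∣q∣⇒p≡q (inside  ∷ p) (inside  ∷ q) h e =
    ≡.cong (inside ∷_) (p⊆q∧∣p∣≡∣q∣⇒p≡q p q (drop-∷-⊆ h) (ℕ.suc-injective e))

  -- Turns an identity known for all pairs of sets into one for every admissible integer argument of
  -- a kernel: the points are dealt out in order to the four regions cut out by two sets.
  configuration : ∀ i k l o → i + k + l + o ≡ m →
    ∃ λ (x : Subset m) → ∃ λ (z : Subset m) →
      ∣ x ∩ z ∣ ≡ i × ∣ x ─ z ∣ ≡ k × ∣ z ─ x ∣ ≡ l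
  configuration (suc i) k l o ≡.refl with configuration i k l o ≡.refl
  ... | x , z , ei , ek , el = inside ∷ x , inside ∷ z , ≡.cong suc ei , ek , el
  configuration zero (suc k) l o ≡.refl with configuration zero k l o ≡.refl
  ... | x , z , ei , ek , el = inside ∷ x , outside ∷ z , ei , ≡.cong suc ek , el
  configuration zero zero (suc l) o ≡.refl with configuration zero zero l o ≡.refl
  ... | x , z , ei , ek , el = outside ∷ x , inside ∷ z , ei , ek , ≡.cong suc el
  configuration zero zero zero (suc o) ≡.refl with configuration zero zero zero o ≡.refl
  ... | x , z , ei , ek , el = outside ∷ x , outside ∷ z , ei , ek , el
  configuration zero zero zero zero ≡.refl = [] , [] , ≡.refl , ≡.refl , ≡.refl

  disjoint⇒∣p∣+∣q∣≤m : (y x : Subset m) → ∣ y ∩ x ∣ ≡ 0 → ∣ y ∣ ℕ.+ ∣ x ∣ ≤ m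
  disjoint⇒∣p∣+∣q∣≤m {m} y x e = begin
    ∣ y ∣ ℕ.+ ∣ x ∣                        ≡⟨ ≡.cong (ℕ._+ ∣ x ∣) (∣p─q∣+∣p∩q∣≡∣p∣ y x) ⟨
    ∣ y ─ x ∣ ℕ.+ ∣ y ∩ x ∣ ℕ.+ ∣ x ∣      ≡⟨ ≡.cong (λ b → ∣ y ─ x ∣ ℕ.+ b ℕ.+ ∣ x ∣) e ⟩
    ∣ y ─ x ∣ ℕ.+ 0 ℕ.+ ∣ x ∣              ≡⟨ ≡.cong (ℕ._+ ∣ x ∣) (ℕ.+-identityʳ _) ⟩
    ∣ y ─ x ∣ ℕ.+ ∣ x ∣                    ≡⟨ ℕ.+-comm (∣ y ─ x ∣) (∣ x ∣) ⟩
    ∣ x ∣ ℕ.+ ∣ y ─ x ∣                    ≤⟨ ℕ.m≤m+n _ _ ⟩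
    ∣ x ∣ ℕ.+ ∣ y ─ x ∣ ℕ.+ ∣ ∁ (x ∪ y) ∣  ≡⟨ ∣p∣+∣q─p∣+∣∁[p∪q]∣≡m x y ⟩
    m ∎
    where open ℕ.≤-Reasoning

  -- Together with the next lemma this rewrites a kernel in `∣ x ─ y ∣` or in the size of the
  -- outside region in terms of `∣ y ─ x ∣` and `∣ y ∩ x ∣`, the variables of Newton's formula.
  ∣q─p∣-excess : ∀ {s} (p q : Subset m) k → ∣ p ∣ ≡ s → ∣ q ∣ ≡ s + k → ∣ q ─ p ∣ ≡ ∣ p ─ q ∣ + k
  ∣q─p∣-excess {s = s} p q k ∣p∣ ∣q∣ = ℕ.+-cancelʳ-≡ (∣ p ∩ q ∣) _ _ (begin
    ∣ q ─ p ∣ + ∣ p ∩ q ∣        ≡⟨ ≡.cong (λ v → ∣ q ─ p ∣ + ∣ v ∣) (∩-comm p q) ⟩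
    ∣ q ─ p ∣ + ∣ q ∩ p ∣        ≡⟨ ∣p─q∣+∣p∩q∣≡∣p∣ q p ⟩
    ∣ q ∣                        ≡⟨ ∣q∣ ⟩
    s + k                        ≡⟨ ≡.cong (_+ k) (≡.trans (∣p─q∣+∣p∩q∣≡∣p∣ p q) ∣p∣) ⟨
    ∣ p ─ q ∣ + ∣ p ∩ q ∣ + k    ≡⟨ identity (∣ p ─ q ∣) (∣ p ∩ q ∣) k ⟩
    ∣ p ─ q ∣ + k + ∣ p ∩ q ∣    ∎)
    where
    open ≡.≡-Reasoning
    identity : ∀ a b k → a + b + k ≡ a + k + b
    identity = solve-∀

  ∣∁[p∪q]∣-excess : ∀ {s} (p q : Subset m) k l → ∣ p ∣ ≡ s → ∣ q ∣ ≡ s + k → m ≡ s + (s + k) + l →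
                    ∣ ∁ (p ∪ q) ∣ ≡ ∣ p ∩ q ∣ + l
  ∣∁[p∪q]∣-excess {m} {s} p q k l ∣p∣ ∣q∣ m≡ = ℕ.+-cancelˡ-≡ (∣ p ∣ + ∣ q ─ p ∣) _ _ (begin
    ∣ p ∣ + ∣ q ─ p ∣ + ∣ ∁ (p ∪ q) ∣            ≡⟨ ∣p∣+∣q─p∣+∣∁[p∪q]∣≡m p q ⟩
    m                                            ≡⟨ m≡ ⟩
    s + (s + k) + l                              ≡⟨ ≡.cong (λ u → s + (u + k) + l) (≡.trans (∣p─q∣+∣p∩q∣≡∣p∣ p q) ∣p∣) ⟨
    s + (∣ p ─ q ∣ + ∣ p ∩ q ∣ + k) + l          ≡⟨ identity s (∣ p ─ q ∣) (∣ p ∩ q ∣) k l ⟩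
    s + (∣ p ─ q ∣ + k) + (∣ p ∩ q ∣ + l)        ≡⟨ ≡.cong₂ (λ u v → u + v + (∣ p ∩ q ∣ + l)) ∣p∣ (∣q─p∣-excess p q k ∣p∣ ∣q∣) ⟨
    ∣ p ∣ + ∣ q ─ p ∣ + (∣ p ∩ q ∣ + l)          ∎)
    where
    open ≡.≡-Reasoning
    identity : ∀ s a b k l → s + (a + b + k) + l ≡ s + (a + k) + (b + l)
    identity = solve-∀

open SubsetCounting

-- Newton's formula and harmonic functions on the subset lattice

module HarmonicFunctions (K : CommutativeRing 0ℓ 0ℓ) where
  open CommutativeRing K hiding (zero)
  open import Algebra.Properties.Semiring.Exp semiring using (_^_) public
  open import Algebra.Properties.Semiring.Mult semiring using () renaming (_×_ to _×ₘ_)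
  open import Algebra.Properties.CommutativeSemigroup +-commutativeSemigroup using (interchange)
  open import Relation.Binary.Reasoning.Setoid setoid
  open IntegerSolver K

  ι : ℕ → Carrier
  ι k = k ×ₘ 1#

  opaque
    ∑ : (Subset m → Carrier) → Carrier
    ∑ {m = zero}  f = f []
    ∑ {m = suc m} f = ∑ (λ y → f (outside ∷ y)) + ∑ (λ y → f (inside ∷ y))

    ∑-cong : {f g : Subset m → Carrier} → (∀ y → f y ≈ g y) → ∑ f ≈ ∑ g
    ∑-cong {m = zero}  p = p []
    ∑-cong {m = suc m} p = +-cong (∑-cong λ y → p (outside ∷ y)) (∑-cong λ y → p (inside ∷ y))

    ∑-zero : (f : Subset m → Carrier) → (∀ y → f y ≈ 0#) → ∑ f ≈ 0#
    ∑-zero {m = zero}  f p = p []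
    ∑-zero {m = suc m} f p = trans
      (+-cong (∑-zero {m} _ λ y → p (outside ∷ y)) (∑-zero {m} _ λ y → p (inside ∷ y))) (+-identityˡ 0#)

    ∑-+ : (f g : Subset m → Carrier) → ∑ (λ y → f y + g y) ≈ ∑ f + ∑ g
    ∑-+ {m = zero}  f g = refl
    ∑-+ {m = suc m} f g = trans (+-cong (∑-+ {m} _ _) (∑-+ {m} _ _)) (interchange _ _ _ _)

    ∑-*ˡ : ∀ c (f : Subset m → Carrier) → ∑ (λ y → c * f y) ≈ c * ∑ f
    ∑-*ˡ {m = zero}  c f = refl
    ∑-*ˡ {m = suc m} c f = trans (+-cong (∑-*ˡ {m} c _) (∑-*ˡ {m} c _)) (sym (distribˡ c _ _))

    ∑-swap : ∀ {k} (f : Subset m → Subset k → Carrier) →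
             ∑ (λ x → ∑ (λ y → f x y)) ≈ ∑ (λ y → ∑ (λ x → f x y))
    ∑-swap {m = zero}  f = refl
    ∑-swap {m = suc m} {k} f =
      trans (+-cong (∑-swap (λ x → f (outside ∷ x))) (∑-swap (λ x → f (inside ∷ x))))
            (sym (∑-+ {k} _ _))

  0*-zero : ∀ {a b} → a ≈ 0# → a * b ≈ 0#
  0*-zero e = trans (*-congʳ e) (zeroˡ _)

  *0-zero : ∀ {a b} → b ≈ 0# → a * b ≈ 0#
  *0-zero e = trans (*-congˡ e) (zeroʳ _)

  [_] : {A : Set} → Dec A → Carrier
  [ d ] = if does d then 1# else 0#

  [_]*_ : {A : Set} → Dec A → Carrier → Carrier
  [ d ]* a = if does d then a else 0#

  []*-cong : {A : Set} (d : Dec A) {a b : Carrier} → (A → a ≈ b) → [ d ]* a ≈ [ d ]* b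
  []*-cong (yes p) h = h p
  []*-cong (no _)  h = refl

  []*-true : {A : Set} (d : Dec A) {a : Carrier} → A → [ d ]* a ≈ a
  []*-true (yes _) _ = refl
  []*-true (no ¬p) p = contradiction p ¬p

  []*-false : {A : Set} (d : Dec A) {a : Carrier} → ¬ A → [ d ]* a ≈ 0#
  []*-false (yes p) ¬p = contradiction p ¬p
  []*-false (no _)  _  = refl

  []*-≈ : {A : Set} (d : Dec A) (a : Carrier) → [ d ]* a ≈ [ d ] * a
  []*-≈ (yes _) a = sym (*-identityˡ a)
  []*-≈ (no _)  a = sym (zeroˡ a)

  χ : Subset m → Subset m → Carrier
  χ w x = [ w ⊆? x ]

  χ-cong : {a b : Subset m} {c d : Subset n} → (a ⊆ b → c ⊆ d) → (c ⊆ d → a ⊆ b) → χ a b ≡ χ c d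
  χ-cong {a = a} {b} {c} {d} f g with a ⊆? b | c ⊆? d
  ... | yes _ | yes _ = ≡.refl
  ... | no _  | no _  = ≡.refl
  ... | yes p | no ¬q = ⊥-elim (¬q (f p))
  ... | no ¬p | yes q = ⊥-elim (¬p (g q))

  χ-sym : (w x : Subset n) → ∣ w ∣ ≡ ∣ x ∣ → χ w x ≡ χ x w
  χ-sym w x e = χ-cong {a = w} {x} {x} {w} (reverse w x e) (reverse x w (≡.sym e))
    where
    reverse : ∀ a b → ∣ a ∣ ≡ ∣ b ∣ → a ⊆ b → b ⊆ a
    reverse a b e p = ≡.subst (λ v → v ⊆ a) (p⊆q∧∣p∣≡∣q∣⇒p≡q a b p e) (λ i → i)

  χ-* : (w x : Subset m) {a b : Carrier} → (w ⊆ x → a ≈ b) → χ w x * a ≈ χ w x * b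
  χ-* w x h with w ⊆? x
  ... | yes p = *-congˡ (h p)
  ... | no  _ = trans (zeroˡ _) (sym (zeroˡ _))

  χ-zero : (w x : Subset m) → ∣ x ∣ < ∣ w ∣ → χ w x ≈ 0#
  χ-zero w x lt with w ⊆? x
  ... | yes p = contradiction (p⊆q⇒∣p∣≤∣q∣ p) (ℕ.<⇒≱ lt)
  ... | no  _ = refl

  opaque
    unfolding ∑

    -- A superset of `w` of the same size is `w` itself, so within one layer χ is the identity
    -- matrix.
    ∑-χ-eq : (w : Subset m) (ψ : Subset m → Carrier) →
             (∀ y → ∣ y ∣ ≢ ∣ w ∣ → ψ y ≈ 0#) → ∑ (λ y → χ w y * ψ y) ≈ ψ w
    ∑-χ-eq [] ψ supp = *-identityˡ _
    ∑-χ-eq (outside ∷ w) ψ supp = begin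
      ∑ (λ y → χ w y * ψ (outside ∷ y)) + ∑ (λ y → χ w y * ψ (inside ∷ y))
        ≈⟨ +-cong (∑-χ-eq w _ λ y → supp (outside ∷ y)) (∑-zero _ vanish) ⟩
      ψ (outside ∷ w) + 0#
        ≈⟨ +-identityʳ _ ⟩
      ψ (outside ∷ w) ∎
      where
      vanish : ∀ y → χ w y * ψ (inside ∷ y) ≈ 0#
      vanish y = trans
        (χ-* w y λ p → supp (inside ∷ y) λ e →
          contradiction (p⊆q⇒∣p∣≤∣q∣ p) (ℕ.<⇒≱ (ℕ.≤-reflexive e)))
        (zeroʳ _)
    ∑-χ-eq {m = suc m} (inside ∷ w) ψ supp = begin
      ∑ (λ y → 0# * ψ (outside ∷ y)) + ∑ (λ y → χ w y * ψ (inside ∷ y))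
        ≈⟨ +-cong (∑-zero {m = m} _ λ y → zeroˡ _)
                  (∑-χ-eq w _ λ y ne → supp (inside ∷ y) λ e → ne (ℕ.suc-injective e)) ⟩
      0# + ψ (inside ∷ w)
        ≈⟨ +-identityˡ _ ⟩
      ψ (inside ∷ w) ∎

  -- With `a = ∣ y ─ x ∣` and `b = ∣ y ∩ x ∣`, this is the change in the kernel when one point of
  -- `y` is put into `x`; the size of `y` is the same in both terms.
  ∂ : (ℕ → ℕ → Carrier) → ℕ → ℕ → Carrier
  ∂ H a b = H a (suc b) - H (suc a) b

  ∂^ : ℕ → (ℕ → ℕ → Carrier) → ℕ → ℕ → Carrier
  ∂^ zero    H = H
  ∂^ (suc k) H = ∂^ k (∂ H)

  ∂^-suc : ∀ k H a b → ∂^ k (∂ H) a b ≡ ∂ (∂^ k H) a b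
  ∂^-suc zero    H a b = ≡.refl
  ∂^-suc (suc k) H a b = ∂^-suc k (∂ H) a b

  ∂^-shiftˡ : ∀ k H a b → ∂^ k (λ a b → H (suc a) b) a b ≡ ∂^ k H (suc a) b
  ∂^-shiftˡ zero    H a b = ≡.refl
  ∂^-shiftˡ (suc k) H a b = ∂^-shiftˡ k (∂ H) a b

  ∂^-shiftʳ : ∀ k H a b → ∂^ k (λ a b → H a (suc b)) a b ≡ ∂^ k H a (suc b)
  ∂^-shiftʳ zero    H a b = ≡.refl
  ∂^-shiftʳ (suc k) H a b = ∂^-shiftʳ k (∂ H) a b

  -- The disjointness, Fourier and Gram kernels are all evaluated through this, with eigenvalues -1,
  -- -2 and 1.
  ∂^-eigen : ∀ c H → (∀ a b → ∂ H a b ≈ c * H a b) → ∀ k a b → ∂^ k H a b ≈ c ^ k * H a b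
  ∂^-eigen c H h zero    a b = sym (*-identityˡ _)
  ∂^-eigen c H h (suc k) a b = begin
    ∂^ k (∂ H) a b
      ≡⟨ ∂^-suc k H a b ⟩
    ∂^ k H a (suc b) - ∂^ k H (suc a) b
      ≈⟨ +-cong (∂^-eigen c H h k a (suc b)) (-‿cong (∂^-eigen c H h k (suc a) b)) ⟩
    c ^ k * H a (suc b) - c ^ k * H (suc a) b
      ≈⟨ solve 3 (λ c x y → c :* x :- c :* y := c :* (x :- y)) refl _ _ _ ⟩
    c ^ k * ∂ H a b
      ≈⟨ *-congˡ (h a b) ⟩
    c ^ k * (c * H a b)
      ≈⟨ solve 3 (λ c d x → d :* (c :* x) := c :* d :* x) refl _ _ _ ⟩
    c * c ^ k * H a b ∎

  opaque
    unfolding ∑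

    -- The forward difference formula at 0 for the function b ↦ H (∣ y ∣ - b) b.
    newton : (y x : Subset m) (H : ℕ → ℕ → Carrier) →
      H (∣ y ─ x ∣) (∣ y ∩ x ∣) ≈ ∑ λ w → χ w x * (χ w y * ∂^ (∣ w ∣) H (∣ y ─ w ∣) 0)
    newton [] [] H = sym (trans (*-identityˡ _) (*-identityˡ _))
    newton {m = suc m} (outside ∷ y) (c ∷ x) H = begin
      H (∣ (outside ∷ y) ─ (c ∷ x) ∣) (∣ y ∩ x ∣)
        ≡⟨ ≡.cong (λ k → H k (∣ y ∩ x ∣)) (size c) ⟩
      H (∣ y ─ x ∣) (∣ y ∩ x ∣)
        ≈⟨ newton y x H ⟩
      ∑ (λ w → χ w x * (χ w y * ∂^ (∣ w ∣) H (∣ y ─ w ∣) 0))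
        ≈⟨ +-identityʳ _ ⟨
      ∑ (λ w → χ w x * (χ w y * ∂^ (∣ w ∣) H (∣ y ─ w ∣) 0)) + 0#
        ≈⟨ +-congˡ (∑-zero {m = m} _ λ w → *0-zero (zeroˡ _)) ⟨
      ∑ (λ w → χ w x * (χ w y * ∂^ (∣ w ∣) H (∣ y ─ w ∣) 0)) +
      ∑ (λ w → χ (inside ∷ w) (c ∷ x) * (0# * ∂^ (suc ∣ w ∣) H (∣ y ─ w ∣) 0)) ∎
      where
      size : ∀ c → ∣ (outside ∷ y) ─ (c ∷ x) ∣ ≡ ∣ y ─ x ∣
      size true  = ≡.refl
      size false = ≡.refl
    newton {m = suc m} (inside ∷ y) (outside ∷ x) H = begin
      H (suc ∣ y ─ x ∣) (∣ y ∩ x ∣)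
        ≈⟨ newton y x (λ a b → H (suc a) b) ⟩
      ∑ (λ w → χ w x * (χ w y * ∂^ (∣ w ∣) (λ a b → H (suc a) b) (∣ y ─ w ∣) 0))
        ≈⟨ ∑-cong (λ w → *-congˡ (*-congˡ (reflexive (∂^-shiftˡ (∣ w ∣) H (∣ y ─ w ∣) 0)))) ⟩
      ∑ (λ w → χ w x * (χ w y * ∂^ (∣ w ∣) H (suc ∣ y ─ w ∣) 0))
        ≈⟨ +-identityʳ _ ⟨
      ∑ (λ w → χ w x * (χ w y * ∂^ (∣ w ∣) H (suc ∣ y ─ w ∣) 0)) + 0#
        ≈⟨ +-congˡ (∑-zero {m = m} _ λ w → zeroˡ _) ⟨
      ∑ (λ w → χ w x * (χ w y * ∂^ (∣ w ∣) H (suc ∣ y ─ w ∣) 0)) +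
      ∑ (λ w → 0# * (χ w y * ∂^ (suc ∣ w ∣) H (∣ y ─ w ∣) 0)) ∎
    newton {m = suc m} (inside ∷ y) (inside ∷ x) H = begin
      H (∣ y ─ x ∣) (suc ∣ y ∩ x ∣)
        ≈⟨ newton y x (λ a b → H a (suc b)) ⟩
      ∑ (λ w → χ w x * (χ w y * ∂^ (∣ w ∣) (λ a b → H a (suc b)) (∣ y ─ w ∣) 0))
        ≈⟨ ∑-cong (λ w → trans (*-congˡ (*-congˡ (split (∣ w ∣) (∣ y ─ w ∣))))
             (solve 4 (λ a b c d → a :* (b :* (c :+ d)) := a :* (b :* c) :+ a :* (b :* d))
                      refl (χ w x) (χ w y) _ _)) ⟩
      ∑ (λ w → χ w x * (χ w y * ∂^ (∣ w ∣) H (suc ∣ y ─ w ∣) 0) +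
               χ w x * (χ w y * ∂^ (suc ∣ w ∣) H (∣ y ─ w ∣) 0))
        ≈⟨ ∑-+ {m = m} _ _ ⟩
      ∑ (λ w → χ w x * (χ w y * ∂^ (∣ w ∣) H (suc ∣ y ─ w ∣) 0)) +
      ∑ (λ w → χ w x * (χ w y * ∂^ (suc ∣ w ∣) H (∣ y ─ w ∣) 0)) ∎
      where
      split : ∀ k a → ∂^ k (λ a b → H a (suc b)) a 0 ≈ ∂^ k H (suc a) 0 + ∂^ (suc k) H a 0
      split k a = begin
        ∂^ k (λ a b → H a (suc b)) a 0
          ≡⟨ ∂^-shiftʳ k H a 0 ⟩
        ∂^ k H a 1
          ≈⟨ solve 2 (λ u v → u := v :+ (u :- v)) refl _ _ ⟩
        ∂^ k H (suc a) 0 + ∂ (∂^ k H) a 0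
          ≡⟨ ≡.cong (∂^ k H (suc a) 0 +_) (∂^-suc k H a 0) ⟨
        ∂^ k H (suc a) 0 + ∂^ (suc k) H a 0 ∎

  Up : (Subset m → Carrier) → Subset m → Carrier
  Up ψ x = ∑ λ y → χ y x * ψ y

  -- For ∣ w ∣ = s the condition down follows from supported; for ∣ w ∣ < s it
  -- says that the sum of ψ over the supersets of w vanishes.
  record Harmonic (s : ℕ) (ψ : Subset m → Carrier) : Set where
    field
      supported : ∀ y → ∣ y ∣ ≢ s → ψ y ≈ 0#
      down      : ∀ w → ∑ (λ y → χ w y * ψ y) ≈ ψ w
  open Harmonic

  -- After Newton's formula and an exchange of sums, the coefficient of `w` depends on `y ⊇ w` only
  -- through `∣ y ─ w ∣ = s - ∣ w ∣`. It therefore leaves the sum over `y`, which `down` evaluates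
  -- to `ψ w`, and this vanishes unless `∣ w ∣ = s`.
  harmonic-kernel : ∀ {s} {ψ : Subset m → Carrier} → Harmonic s ψ → ∀ H x →
    ∑ (λ y → ψ y * H (∣ y ─ x ∣) (∣ y ∩ x ∣)) ≈ ∂^ s H 0 0 * Up ψ x
  harmonic-kernel {s = s} {ψ} h H x = begin
    ∑ (λ y → ψ y * H (∣ y ─ x ∣) (∣ y ∩ x ∣))
      ≈⟨ ∑-cong (λ y → trans (*-congˡ (newton y x H)) (sym (∑-*ˡ _ _))) ⟩
    ∑ (λ y → ∑ λ w → ψ y * (χ w x * (χ w y * ∂^ (∣ w ∣) H (∣ y ─ w ∣) 0)))
      ≈⟨ ∑-swap _ ⟩
    ∑ (λ w → ∑ λ y → ψ y * (χ w x * (χ w y * ∂^ (∣ w ∣) H (∣ y ─ w ∣) 0)))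
      ≈⟨ ∑-cong (λ w → ∑-cong λ y → trans
           (solve 4 (λ p a b c → p :* (a :* (b :* c)) := a :* (b :* (c :* p)))
                    refl (ψ y) (χ w x) (χ w y) _)
           (trans (*-congˡ (χ-* w y (coefficient w y)))
           (solve 4 (λ a b c p → a :* (b :* (c :* p)) := a :* c :* (b :* p))
                    refl (χ w x) (χ w y) _ (ψ y)))) ⟩
    ∑ (λ w → ∑ λ y → χ w x * ∂^ (∣ w ∣) H (s ℕ.∸ ∣ w ∣) 0 * (χ w y * ψ y))
      ≈⟨ ∑-cong (λ w → trans (∑-*ˡ _ _) (*-congˡ (down h w))) ⟩
    ∑ (λ w → χ w x * ∂^ (∣ w ∣) H (s ℕ.∸ ∣ w ∣) 0 * ψ w)
      ≈⟨ ∑-cong top ⟩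
    ∑ (λ w → ∂^ s H 0 0 * (χ w x * ψ w))
      ≈⟨ ∑-*ˡ _ _ ⟩
    ∂^ s H 0 0 * Up ψ x ∎
    where
    coefficient : ∀ w y → w ⊆ y →
      ∂^ (∣ w ∣) H (∣ y ─ w ∣) 0 * ψ y ≈ ∂^ (∣ w ∣) H (s ℕ.∸ ∣ w ∣) 0 * ψ y
    coefficient w y p with ∣ y ∣ ℕ.≟ s
    ... | no  ne = trans (*-congˡ (supported h y ne))
                         (trans (zeroʳ _) (sym (*0-zero (supported h y ne))))
    ... | yes e  = *-congʳ (reflexive (≡.cong (λ k → ∂^ (∣ w ∣) H k 0)
      (≡.trans (≡.sym (ℕ.m+n∸n≡m _ ∣ w ∣))
               (≡.cong (ℕ._∸ ∣ w ∣) (≡.trans (∣q─p∣+∣p∣≡∣q∣ w y p) e)))))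

    top : ∀ w → χ w x * ∂^ (∣ w ∣) H (s ℕ.∸ ∣ w ∣) 0 * ψ w ≈ ∂^ s H 0 0 * (χ w x * ψ w)
    top w with ∣ w ∣ ℕ.≟ s
    ... | no ne = trans (*-congˡ (supported h w ne)) (trans (zeroʳ _) (sym
      (*0-zero (*0-zero (supported h w ne)))))
    ... | yes ≡.refl = trans
      (*-congʳ (*-congˡ (reflexive (≡.cong (λ k → ∂^ s H k 0) (ℕ.n∸n≡0 s)))))
      (solve 3 (λ a b c → a :* b :* c := b :* (a :* c)) refl (χ w x) (∂^ s H 0 0) (ψ w))

-- Layers on which Up vanishes

module FiniteDifferences (K : CommutativeRing 0ℓ 0ℓ) where
  open CommutativeRing K hiding (zero)
  open import Algebra.Properties.Semiring.Sum semiring using (sum; sum-cong-≋; *-distribˡ-sum)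
  open import Algebra.Properties.Semiring.Mult semiring using (×-homo-+)
  open import Relation.Binary.Reasoning.Setoid setoid
  open IntegerSolver K
  open HarmonicFunctions K
  open Harmonic

  Up-below : ∀ {s} {ψ : Subset m → Carrier} → Harmonic s ψ → ∀ x → ∣ x ∣ < s → Up ψ x ≈ 0#
  Up-below h x lt = ∑-zero _ λ y → trans
    (χ-* y x λ p → supported h y λ { ≡.refl → contradiction (p⊆q⇒∣p∣≤∣q∣ p) (ℕ.<⇒≱ lt) })
    (zeroʳ _)

  Up-same-size : ∀ (ψ : Subset m → Carrier) x → (∀ y → ∣ y ∣ ≢ ∣ x ∣ → ψ y ≈ 0#) → Up ψ x ≈ ψ x
  Up-same-size ψ x supp = begin
    ∑ (λ y → χ y x * ψ y)      ≈⟨ ∑-cong flip ⟩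
    ∑ (λ y → χ x y * ψ y)      ≈⟨ ∑-χ-eq x ψ supp ⟩
    ψ x                        ∎
    where
    flip : ∀ y → χ y x * ψ y ≈ χ x y * ψ y
    flip y with ∣ y ∣ ℕ.≟ ∣ x ∣
    ... | yes e = *-congʳ (reflexive (χ-sym y x e))
    ... | no ne = trans (*0-zero (supp y ne)) (sym (*0-zero (supp y ne)))

  Up-middle : ∀ {s} {ψ : Subset m → Carrier} → Harmonic s ψ → ∀ x → ∣ x ∣ ≡ s → Up ψ x ≈ ψ x
  Up-middle {ψ = ψ} h x ≡.refl = Up-same-size ψ x (supported h)

  -1^k*-1^k≈1 : ∀ k → (- 1#) ^ k * (- 1#) ^ k ≈ 1#
  -1^k*-1^k≈1 zero    = *-identityˡ 1#
  -1^k*-1^k≈1 (suc k) = trans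
    (solve 1 (λ a → (:- con 1ℤ :* a) :* (:- con 1ℤ :* a) := a :* a) refl _)
    (-1^k*-1^k≈1 k)

  -- As a kernel this is the indicator of disjointness, and its Newton expansion is
  -- inclusion-exclusion.
  empty : ℕ → ℕ → Carrier
  empty a zero    = 1#
  empty a (suc b) = 0#

  empty-eigen : ∀ a b → ∂ empty a b ≈ - 1# * empty a b
  empty-eigen a zero    = solve 0 (con 0ℤ :- con 1ℤ := :- con 1ℤ :* con 1ℤ) refl
  empty-eigen a (suc b) = solve 0 (con 0ℤ :- con 0ℤ := :- con 1ℤ :* con 0ℤ) refl

  -- Two subsets whose sizes exceed m in total meet, so the kernel [ y ∩ x = ∅ ],
  -- which is an eigenfunction of ∂, gives the zero map.
  Up-above : ∀ {s} {ψ : Subset m → Carrier} → Harmonic s ψ → ∀ x → m < s ℕ.+ ∣ x ∣ → Up ψ x ≈ 0#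
  Up-above {m} {s} {ψ} h x lt = begin
    Up ψ x
      ≈⟨ *-identityˡ _ ⟨
    1# * Up ψ x
      ≈⟨ *-congʳ (-1^k*-1^k≈1 s) ⟨
    (- 1#) ^ s * (- 1#) ^ s * Up ψ x
      ≈⟨ *-assoc _ _ _ ⟩
    (- 1#) ^ s * ((- 1#) ^ s * Up ψ x)
      ≈⟨ *-congˡ (*-congʳ (trans (∂^-eigen (- 1#) empty empty-eigen s 0 0) (*-identityʳ _))) ⟨
    (- 1#) ^ s * (∂^ s empty 0 0 * Up ψ x)
      ≈⟨ *-congˡ (harmonic-kernel h empty x) ⟨
    (- 1#) ^ s * ∑ (λ y → ψ y * empty (∣ y ─ x ∣) (∣ y ∩ x ∣))
      ≈⟨ *-congˡ (∑-zero _ meet) ⟩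
    (- 1#) ^ s * 0#
      ≈⟨ zeroʳ _ ⟩
    0# ∎
    where
    meet : ∀ y → ψ y * empty (∣ y ─ x ∣) (∣ y ∩ x ∣) ≈ 0#
    meet y with ∣ y ∣ ℕ.≟ s | ∣ y ∩ x ∣ in e
    ... | no ne | b     = 0*-zero (supported h y ne)
    ... | yes _ | suc b = zeroʳ _
    ... | yes ≡.refl | zero = contradiction lt (ℕ.≤⇒≯ (disjoint⇒∣p∣+∣q∣≤m y x e))

  -- Finite differences of functions of one integer variable

  D : (ℕ → Carrier) → ℕ → Carrier
  D f i = f i - f (suc i)

  D^ : ℕ → (ℕ → Carrier) → ℕ → Carrier
  D^ zero    f = f
  D^ (suc k) f = D^ k (D f)

  D^-suc : ∀ k f i → D^ k (D f) i ≡ D (D^ k f) i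
  D^-suc zero    f i = ≡.refl
  D^-suc (suc k) f i = D^-suc k (D f) i

  D^-shift : ∀ k f i → D^ k (λ i → f (suc i)) i ≡ D^ k f (suc i)
  D^-shift zero    f i = ≡.refl
  D^-shift (suc k) f i = D^-shift k (D f) i

  -- The locality matters: the kernel of Λ coincides with its polynomial only on the domain j, ...,
  -- s + j, which is exactly the stretch that the s-th difference at j sees.
  D^-cong : ∀ k {f g} i → (∀ j → i ≤ j → j ≤ k ℕ.+ i → f j ≈ g j) → D^ k f i ≈ D^ k g i
  D^-cong zero    i h = h i ℕ.≤-refl ℕ.≤-refl
  D^-cong (suc k) i h = D^-cong k i λ j lo hi →
    +-cong (h j lo (ℕ.m≤n⇒m≤1+n hi)) (-‿cong (h (suc j) (ℕ.m≤n⇒m≤1+n lo) (s≤s hi)))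

  -- The sign convention of `D`, opposite to the usual one, is made for this: `D` is what `∂`
  -- becomes on a kernel depending on `a` alone.
  D^-∂^ : ∀ k f i a b → ∂^ k (λ a b → f (a ℕ.+ i)) a b ≡ D^ k f (a ℕ.+ i)
  D^-∂^ zero    f i a b = ≡.refl
  D^-∂^ (suc k) f i a b = D^-∂^ k (D f) i a b

  D^-zero-step : ∀ k f i → D^ (suc k) f i ≈ 0# → D^ k f i ≈ D^ k f (suc i)
  D^-zero-step k f i z = begin
    D^ k f i                                       ≈⟨ solve 2 (λ u v → u := (u :- v) :+ v) refl _ _ ⟩
    D (D^ k f) i + D^ k f (suc i)                  ≡⟨ ≡.cong (_+ D^ k f (suc i)) (D^-suc k f i) ⟨
    D^ (suc k) f i + D^ k f (suc i)                ≈⟨ +-congʳ z ⟩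
    0# + D^ k f (suc i)                            ≈⟨ +-identityˡ _ ⟩
    D^ k f (suc i)                                 ∎

  D^-const : ∀ k f → (∀ i → D^ (suc k) f i ≈ 0#) → ∀ i → D^ k f 0 ≈ D^ k f i
  D^-const k f z zero    = refl
  D^-const k f z (suc i) = trans (D^-const k f z i) (D^-zero-step k f i (z i))

  D^-+ : ∀ k f g i → D^ k (λ i → f i + g i) i ≈ D^ k f i + D^ k g i
  D^-+ zero    f g i = refl
  D^-+ (suc k) f g i = trans
    (D^-cong k i λ j _ _ → solve 4 (λ a b c d → (a :+ b) :- (c :+ d) := (a :- c) :+ (b :- d)) refl _ _ _ _)
    (D^-+ k (D f) (D g) i)

  D^-neg : ∀ k f i → D^ k (λ i → - f i) i ≈ - D^ k f i
  D^-neg zero    f i = refl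
  D^-neg (suc k) f i = trans
    (D^-cong k i λ j _ _ → solve 2 (λ a c → :- a :- :- c := :- (a :- c)) refl _ _)
    (D^-neg k (D f) i)

  D^-0 : ∀ k i → D^ k (λ _ → 0#) i ≈ 0#
  D^-0 zero    i = refl
  D^-0 (suc k) i = trans (D^-cong k i λ j _ _ → -‿inverseʳ 0#) (D^-0 k i)

  -- Leibniz rule: the difference of `ι i * f i` is `ι i * D f i - f (suc i)`, so a factor of the
  -- variable costs one more difference.
  D^-ι* : ∀ k f → (∀ i → D^ k f i ≈ 0#) → ∀ i → D^ (suc k) (λ i → ι i * f i) i ≈ 0#
  D^-ι* zero f z i = begin
    ι i * f i - ι (suc i) * f (suc i)   ≈⟨ +-cong (*-congˡ (z i)) (-‿cong (*-congˡ (z (suc i)))) ⟩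
    ι i * 0# - ι (suc i) * 0#           ≈⟨ solve 2 (λ a b → a :* con 0ℤ :- b :* con 0ℤ := con 0ℤ) refl (ι i) (ι (suc i)) ⟩
    0#                                  ∎
  D^-ι* (suc k) f z i = begin
    D^ (suc k) (D (λ i → ι i * f i)) i
      ≈⟨ D^-cong (suc k) i (λ j _ _ →
           solve 3 (λ a u v → a :* u :- (con 1ℤ :+ a) :* v := a :* (u :- v) :+ :- v) refl (ι j) (f j) (f (suc j))) ⟩
    D^ (suc k) (λ i → ι i * D f i + - f (suc i)) i
      ≈⟨ D^-+ (suc k) (λ i → ι i * D f i) (λ i → - f (suc i)) i ⟩
    D^ (suc k) (λ i → ι i * D f i) i + D^ (suc k) (λ i → - f (suc i)) i
      ≈⟨ +-cong (D^-ι* k (D f) z i) (D^-neg (suc k) (λ i → f (suc i)) i) ⟩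
    0# + - D^ (suc k) (λ i → f (suc i)) i
      ≡⟨ ≡.cong (λ u → 0# + - u) (D^-shift (suc k) f i) ⟩
    0# + - D^ (suc k) f (suc i)
      ≈⟨ +-congˡ (-‿cong (z (suc i))) ⟩
    0# + - 0#
      ≈⟨ -‿inverseʳ 0# ⟩
    0# ∎

  polynomial : ∀ {d} → (Fin d → Carrier) → ℕ → Carrier
  polynomial p t = sum λ i → p i * ι t ^ toℕ i

  D^-polynomial : ∀ d (p : Fin d → Carrier) i → D^ d (polynomial p) i ≈ 0#
  D^-polynomial zero    p i = refl
  D^-polynomial (suc d) p i = begin
    D^ (suc d) (polynomial p) i
      -- Horner's form: the constant term plus the variable times a polynomial with one coefficient
      -- fewer.
      ≈⟨ D^-cong (suc d) i (λ t _ _ → +-cong (*-identityʳ _)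
           (trans (sum-cong-≋ λ j → solve 3 (λ a b c → a :* (b :* c) := b :* (a :* c)) refl (p (suc j)) (ι t) _)
                  (sym (*-distribˡ-sum (ι t) λ j → p (suc j) * ι t ^ toℕ j)))) ⟩
    D^ (suc d) (λ t → p zero + ι t * polynomial (λ j → p (suc j)) t) i
      ≈⟨ D^-+ (suc d) (λ _ → p zero) (λ t → ι t * polynomial (λ j → p (suc j)) t) i ⟩
    D^ d (λ _ → p zero - p zero) i + D^ (suc d) (λ t → ι t * polynomial (λ j → p (suc j)) t) i
      ≈⟨ +-cong (trans (D^-cong d i λ _ _ _ → -‿inverseʳ _) (D^-0 d i))
                (D^-ι* d _ (D^-polynomial d λ j → p (suc j)) i) ⟩
    0# + 0#
      ≈⟨ +-identityˡ 0# ⟩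
    0# ∎

  -- Among the terms of the k-th difference at 0 only `q 0` survives, and in this sign convention
  -- its coefficient is 1.
  D^-head : ∀ k q → (∀ j → j < k → q (suc j) ≈ 0#) → D^ k q 0 ≈ q 0
  D^-head zero    q z = refl
  D^-head (suc k) q z = begin
    D^ k (D q) 0
      ≡⟨ D^-suc k q 0 ⟩
    D^ k q 0 - D^ k q 1
      ≡⟨ ≡.cong (λ u → D^ k q 0 - u) (D^-shift k q 0) ⟨
    D^ k q 0 - D^ k (λ i → q (suc i)) 0
      ≈⟨ +-cong (D^-head k q λ j lt → z j (ℕ.m<n⇒m<1+n lt))
                (-‿cong (D^-head k (λ i → q (suc i)) λ j lt → z (suc j) (s≤s lt))) ⟩
    q 0 - q 1
      ≈⟨ +-congˡ (-‿cong (z 0 (s≤s z≤n))) ⟩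
    q 0 - 0#
      ≈⟨ solve 1 (λ a → a :- con 0ℤ := a) refl _ ⟩
    q 0 ∎

  -- By degree and roots, q(t) is a multiple of the binomial (i + s - t choose s).
  consecutive-roots : ∀ s i q → (∀ t → D^ (suc s) q t ≈ 0#) →
    (∀ j → j < s → q (suc (i ℕ.+ j)) ≈ 0#) → q 0 ≈ ι ((i ℕ.+ s) C s) * D^ s q 0
  consecutive-roots zero i q z r = begin
    q 0                     ≈⟨ *-identityˡ _ ⟨
    1# * q 0                ≈⟨ *-congʳ (+-identityʳ 1#) ⟨
    ι 1 * q 0               ∎
  consecutive-roots (suc s) zero q z r = begin
    q 0                         ≈⟨ D^-head (suc s) q r ⟨
    D^ (suc s) q 0              ≈⟨ *-identityˡ _ ⟨
    1# * D^ (suc s) q 0         ≈⟨ *-congʳ (+-identityʳ 1#) ⟨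
    ι 1 * D^ (suc s) q 0        ≡⟨ ≡.cong (λ k → ι k * D^ (suc s) q 0) (nCn≡1 (suc s)) ⟨
    ι (suc s C suc s) * D^ (suc s) q 0 ∎
  -- The difference `D q` loses one root at the end, and the shift of `q` by one moves all roots
  -- closer to 0. Both have the same top difference as `q`, so their binomial coefficients add up by
  -- Pascal's rule.
  consecutive-roots (suc s) (suc i) q z r = begin
    q 0
      ≈⟨ solve 2 (λ u v → u := (u :- v) :+ v) refl _ _ ⟩
    D q 0 + q 1
      ≈⟨ +-cong (consecutive-roots s (suc i) (D q) z λ j lt → trans
             (+-cong (r j (ℕ.m<n⇒m<1+n lt))
                     (-‿cong (trans (reflexive (≡.cong (λ k → q (suc (suc k))) (≡.sym (ℕ.+-suc i j))))
                                    (r (suc j) (s≤s lt)))))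
             (-‿inverseʳ 0#))
           (consecutive-roots (suc s) i (λ t → q (suc t))
             (λ t → trans (reflexive (D^-shift (suc (suc s)) q t)) (z (suc t))) r) ⟩
    ι ((suc i ℕ.+ s) C s) * top + ι ((i ℕ.+ suc s) C suc s) * D^ (suc s) (λ t → q (suc t)) 0
      ≈⟨ +-congˡ (*-congˡ (trans (reflexive (D^-shift (suc s) q 0)) (sym (D^-zero-step (suc s) q 0 (z 0))))) ⟩
    ι ((suc i ℕ.+ s) C s) * top + ι ((i ℕ.+ suc s) C suc s) * top
      ≈⟨ distribʳ _ _ _ ⟨
    (ι ((suc i ℕ.+ s) C s) + ι ((i ℕ.+ suc s) C suc s)) * top
      ≈⟨ *-congʳ (×-homo-+ 1# ((suc i ℕ.+ s) C s) ((i ℕ.+ suc s) C suc s)) ⟨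
    ι ((suc i ℕ.+ s) C s ℕ.+ (i ℕ.+ suc s) C suc s) * top
      ≡⟨ ≡.cong (λ k → ι (k C s ℕ.+ (i ℕ.+ suc s) C suc s) * top) (ℕ.+-suc i s) ⟨
    ι ((i ℕ.+ suc s) C s ℕ.+ (i ℕ.+ suc s) C suc s) * top
      ≡⟨ ≡.cong (λ k → ι k * top) (nCk+nC[k+1]≡[n+1]C[k+1] (i ℕ.+ suc s) s) ⟩
    ι (suc (i ℕ.+ suc s) C suc s) * top ∎
    where top = D^ (suc s) q 0

  -- The operator p ↦ t p(t-1) + (ν - t) p(t), where the first term disappears at t = 0 because of
  -- its factor t. It arises with ν the number of points outside a set of size s - 1.
  recurrence : Carrier → (ℕ → Carrier) → ℕ → Carrier
  recurrence ν p zero    = ν * p 0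
  recurrence ν p (suc t) = ι (suc t) * p t + (ν - ι (suc t)) * p (suc t)

  -- Differencing keeps the form of the operator and lowers ν by 1. Hence the s-th difference of the
  -- result at 0 is ν - s times that of `p`, and the degree does not grow.
  D-recurrence : ∀ ν p t → D (recurrence ν p) t ≈ recurrence (ν - 1#) (D p) t
  D-recurrence ν p zero = solve 3
    (λ ν u v → ν :* u :- ((con 1ℤ :+ con 0ℤ) :* u :+ (ν :- (con 1ℤ :+ con 0ℤ)) :* v)
               := (ν :- con 1ℤ) :* (u :- v)) refl ν (p 0) (p 1)
  D-recurrence ν p (suc t) = solve 5
    (λ ν i u v w → ((con 1ℤ :+ i) :* u :+ (ν :- (con 1ℤ :+ i)) :* v)
                :- ((con 1ℤ :+ (con 1ℤ :+ i)) :* v :+ (ν :- (con 1ℤ :+ (con 1ℤ :+ i))) :* w)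
                := (con 1ℤ :+ i) :* (u :- v) :+ (ν :- con 1ℤ :- (con 1ℤ :+ i)) :* (v :- w))
    refl ν (ι t) (p t) (p (suc t)) (p (suc (suc t)))

  recurrence-cong : ∀ {ν μ} p → ν ≈ μ → ∀ t → recurrence ν p t ≈ recurrence μ p t
  recurrence-cong p e zero    = *-congʳ e
  recurrence-cong p e (suc t) = +-congˡ (*-congʳ (+-congʳ e))

  D^-recurrence : ∀ k ν p t → D^ k (recurrence ν p) t ≈ recurrence (ν - ι k) (D^ k p) t
  D^-recurrence zero ν p t = recurrence-cong p (solve 1 (λ a → a := a :- con 0ℤ) refl ν) t
  D^-recurrence (suc k) ν p t = trans
    (D^-cong k t λ j _ _ → D-recurrence ν p j)
    (trans (D^-recurrence k (ν - 1#) (D p) t) (recurrence-cong (D^ k (D p))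
      (solve 2 (λ a b → a :- con 1ℤ :- b := a :- (con 1ℤ :+ b)) refl ν (ι k)) t))

  -- ν p(0) is the value at 0 of the polynomial t p(t-1) + (ν - t) p(t), whose
  -- degree is that of p because its leading terms cancel.
  top-difference : ∀ s i ν p → (∀ t → D^ (suc s) p t ≈ 0#) →
    (∀ j → j < s → recurrence ν p (suc (i ℕ.+ j)) ≈ 0#) →
    ν * p 0 ≈ ι ((i ℕ.+ s) C s) * ((ν - ι s) * D^ s p i)
  top-difference s i ν p z r = trans
    (consecutive-roots s i (recurrence ν p) vanish r)
    (*-congˡ (trans (D^-recurrence s ν p 0) (*-congˡ (D^-const s p z i))))
    where
    vanish : ∀ t → D^ (suc s) (recurrence ν p) t ≈ 0#
    vanish t = trans (D^-recurrence (suc s) ν p t) (zero-recurrence t)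
      where
      zero-recurrence : ∀ t → recurrence (ν - ι (suc s)) (D^ (suc s) p) t ≈ 0#
      zero-recurrence zero    = *0-zero (z 0)
      zero-recurrence (suc t) = trans (+-cong (*-congˡ (z t)) (*-congˡ (z (suc t))))
        (trans (+-cong (zeroʳ _) (zeroʳ _)) (+-identityˡ 0#))

  -- The two-term recurrence for the kernel of Λ

  weighted-pred : (ℕ → Carrier) → ℕ → Carrier
  weighted-pred f zero    = 0#
  weighted-pred f (suc k) = ι (suc k) * f k

  ∑-same-size : (z x : Subset m) (f : ℕ → Carrier) →
    ∑ (λ y → χ z y * ([ ∣ y ∣ ℕ.≟ ∣ z ∣ ]* f (∣ x ─ y ∣))) ≈ f (∣ x ─ z ∣)
  ∑-same-size z x f = trans
    (∑-χ-eq z (λ y → [ ∣ y ∣ ℕ.≟ ∣ z ∣ ]* f (∣ x ─ y ∣)) λ y → []*-false (∣ y ∣ ℕ.≟ ∣ z ∣))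
    ([]*-true (∣ z ∣ ℕ.≟ ∣ z ∣) ≡.refl)

  opaque
    unfolding ∑

    -- Here `y` is `z` with one point added. Each of the `∣ x ─ z ∣` points inside `x` lowers
    -- `∣ x ─ y ∣` by one; each point outside `z ∪ x` leaves it at `∣ x ─ z ∣`.
    ∑-covers : (z x : Subset m) (f : ℕ → Carrier) →
      ∑ (λ y → χ z y * ([ ∣ y ∣ ℕ.≟ suc ∣ z ∣ ]* f (∣ x ─ y ∣))) ≈
      weighted-pred f (∣ x ─ z ∣) + ι (∣ ∁ (z ∪ x) ∣) * f (∣ x ─ z ∣)
    ∑-covers [] [] f = solve 1 (λ a → con 1ℤ :* con 0ℤ := con 0ℤ :+ con 0ℤ :* a) refl (f 0)
    ∑-covers {suc m} (inside ∷ z) (c ∷ x) f = begin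
      ∑ {m} _ + ∑ {m} _
        ≈⟨ +-cong (∑-zero {m} _ λ y → zeroˡ _) (∑-covers z x f) ⟩
      0# + (weighted-pred f (∣ x ─ z ∣) + ι (∣ ∁ (z ∪ x) ∣) * f (∣ x ─ z ∣))
        ≈⟨ +-identityˡ _ ⟩
      weighted-pred f (∣ x ─ z ∣) + ι (∣ ∁ (z ∪ x) ∣) * f (∣ x ─ z ∣) ∎
    ∑-covers {suc m} (outside ∷ z) (outside ∷ x) f = begin
      ∑ {m} _ + ∑ {m} _
        ≈⟨ +-cong (∑-covers z x f) (∑-same-size z x f) ⟩
      weighted-pred f (∣ x ─ z ∣) + ι (∣ ∁ (z ∪ x) ∣) * f (∣ x ─ z ∣) + f (∣ x ─ z ∣)
        ≈⟨ solve 3 (λ a b c → a :+ b :* c :+ c := a :+ (con 1ℤ :+ b) :* c) refl _ _ _ ⟩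
      weighted-pred f (∣ x ─ z ∣) + ι (suc (∣ ∁ (z ∪ x) ∣)) * f (∣ x ─ z ∣) ∎
    ∑-covers {suc m} (outside ∷ z) (inside ∷ x) f = begin
      ∑ {m} _ + ∑ {m} _
        ≈⟨ +-cong (∑-covers z x (λ k → f (suc k))) (∑-same-size z x f) ⟩
      weighted-pred (λ k → f (suc k)) (∣ x ─ z ∣) + ι (∣ ∁ (z ∪ x) ∣) * f (suc (∣ x ─ z ∣)) + f (∣ x ─ z ∣)
        ≈⟨ solve 3 (λ a b c → a :+ b :+ c := (a :+ c) :+ b) refl _ _ _ ⟩
      (weighted-pred (λ k → f (suc k)) (∣ x ─ z ∣) + f (∣ x ─ z ∣)) + ι (∣ ∁ (z ∪ x) ∣) * f (suc (∣ x ─ z ∣))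
        ≈⟨ +-congʳ (step (∣ x ─ z ∣)) ⟩
      weighted-pred f (suc (∣ x ─ z ∣)) + ι (∣ ∁ (z ∪ x) ∣) * f (suc (∣ x ─ z ∣)) ∎
      where
      step : ∀ k → weighted-pred (λ k → f (suc k)) k + f k ≈ weighted-pred f (suc k)
      step zero    = solve 1 (λ a → con 0ℤ :+ a := (con 1ℤ :+ con 0ℤ) :* a) refl (f 0)
      step (suc k) = solve 2 (λ a b → (con 1ℤ :+ a) :* b :+ b := (con 1ℤ :+ (con 1ℤ :+ a)) :* b) refl (ι k) (f (suc k))

  -- Here r = s + i.  The last hypothesis, for sets z and x with ∣ x ─ z ∣ = k, is the
  -- recurrence k f(k-1) + (n-s+1-k) f(k) = 0 for k = i+1 , … , i+s.
  kernel-scalar : ∀ n s i e → i ℕ.+ (s ℕ.+ s) ℕ.+ e ≡ n → (f p : ℕ → Carrier) →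
    (∀ k → i ≤ k → k ≤ s ℕ.+ i → f k ≈ p k) → (∀ t → D^ (suc s) p t ≈ 0#) → p 0 ≈ 1# →
    ((z x : Subset n) → suc ∣ z ∣ ≡ s → ∣ x ∣ ≡ s ℕ.+ i →
      ∑ (λ y → χ z y * ([ ∣ y ∣ ℕ.≟ suc ∣ z ∣ ]* f (∣ x ─ y ∣))) ≈ 0#) →
    ι ((s ℕ.+ i) C s) * (ι (suc (i ℕ.+ e)) * D^ s f i) ≈ ι (suc (s ℕ.+ i ℕ.+ e))
  kernel-scalar n s i e n≡ f p agree deg p0 vanish = begin
    ι ((s ℕ.+ i) C s) * (ι (suc (i ℕ.+ e)) * D^ s f i)
      ≈⟨ *-cong (reflexive (≡.cong (λ k → ι (k C s)) (ℕ.+-comm s i)))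
                (*-cong ν-s (D^-cong s i agree)) ⟩
    ι ((i ℕ.+ s) C s) * ((ν - ι s) * D^ s p i)
      ≈⟨ top-difference s i ν p deg roots ⟨
    ν * p 0
      ≈⟨ trans (*-congˡ p0) (*-identityʳ ν) ⟩
    ν ∎
    where
    ν = ι (suc (s ℕ.+ i ℕ.+ e))

    ι-cancel : ∀ {a b c} → b ℕ.+ c ≡ a → ι c ≈ ι a - ι b
    ι-cancel {b = b} {c} ≡.refl = trans
      (solve 2 (λ b c → c := b :+ c :- b) refl (ι b) (ι c)) (+-congʳ (sym (×-homo-+ 1# b c)))

    ν-s : ι (suc (i ℕ.+ e)) ≈ ν - ι s
    ν-s = ι-cancel {b = s} (≡.trans (ℕ.+-suc s (i ℕ.+ e)) (≡.cong suc (≡.sym (ℕ.+-assoc s i e))))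

    roots : ∀ j → j < s → recurrence ν p (suc (i ℕ.+ j)) ≈ 0#
    roots j j<s = begin
      ι (suc (i ℕ.+ j)) * p (i ℕ.+ j) + (ν - ι (suc (i ℕ.+ j))) * p (suc (i ℕ.+ j))
        ≈⟨ +-cong (*-congˡ (agree (i ℕ.+ j) (ℕ.m≤m+n i j) (upper (ℕ.<⇒≤ j<s))))
                  (*-cong (ι-cancel {b = suc (i ℕ.+ j)} (≡.trans arith (≡.cong (λ s → suc (s ℕ.+ i ℕ.+ e)) s≡)))
                          (agree (suc (i ℕ.+ j)) (ℕ.m≤n⇒m≤1+n (ℕ.m≤m+n i j))
                            (ℕ.≤-trans (ℕ.≤-reflexive (≡.sym (ℕ.+-suc i j))) (upper j<s)))) ⟨
      weighted-pred f (suc (i ℕ.+ j)) + ι (e ℕ.+ suc b) * f (suc (i ℕ.+ j))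
        ≡⟨ ≡.cong₂ (λ k o → weighted-pred f k + ι o * f k) (≡.sym ∣x─z∣) (≡.sym out) ⟩
      weighted-pred f (∣ x ─ z ∣) + ι (∣ ∁ (z ∪ x) ∣) * f (∣ x ─ z ∣)
        ≈⟨ ∑-covers z x f ⟨
      ∑ (λ y → χ z y * ([ ∣ y ∣ ℕ.≟ suc ∣ z ∣ ]* f (∣ x ─ y ∣)))
        ≈⟨ vanish z x (≡.trans (≡.cong suc ∣z∣) s≡) ∣x∣ ⟩
      0# ∎
      where
      open import Data.Nat.Tactic.RingSolver using (solve-∀)
      b = s ℕ.∸ suc j
      s≡ : suc (j ℕ.+ b) ≡ s
      s≡ = ℕ.m+[n∸m]≡n j<s
      upper : ∀ {j} → j ≤ s → i ℕ.+ j ≤ s ℕ.+ i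
      upper j≤s = ℕ.≤-trans (ℕ.+-monoʳ-≤ i j≤s) (ℕ.≤-reflexive (ℕ.+-comm i s))
      arith : suc (i ℕ.+ j) ℕ.+ (e ℕ.+ suc b) ≡ suc (suc (j ℕ.+ b) ℕ.+ i ℕ.+ e)
      arith = identity i j e b
        where
        identity : ∀ i j e b → suc (i ℕ.+ j) ℕ.+ (e ℕ.+ suc b) ≡ suc (suc (j ℕ.+ b) ℕ.+ i ℕ.+ e)
        identity = solve-∀
      total : b ℕ.+ suc (i ℕ.+ j) ℕ.+ j ℕ.+ (e ℕ.+ suc b) ≡ n
      total = ≡.trans (identity i j e b)
        (≡.trans (≡.cong (λ s → i ℕ.+ (s ℕ.+ s) ℕ.+ e) s≡) n≡)
        where
        identity : ∀ i j e b → b ℕ.+ suc (i ℕ.+ j) ℕ.+ j ℕ.+ (e ℕ.+ suc b) ≡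
                   i ℕ.+ (suc (j ℕ.+ b) ℕ.+ suc (j ℕ.+ b)) ℕ.+ e
        identity = solve-∀
      -- The regions `x ∩ z`, `x ─ z`, `z ─ x` and the outside get b, i+j+1, j and e+b+1 points.
      -- Since j + b = s - 1, this gives `z` the size s - 1 and `x` the size s + i.
      config = configuration {n} b (suc (i ℕ.+ j)) j (e ℕ.+ suc b) total
      x = proj₁ config
      z = proj₁ (proj₂ config)
      ∣x─z∣ : ∣ x ─ z ∣ ≡ suc (i ℕ.+ j)
      ∣x─z∣ = proj₁ (proj₂ (proj₂ (proj₂ config)))
      ∣x∩z∣ : ∣ x ∩ z ∣ ≡ b
      ∣x∩z∣ = proj₁ (proj₂ (proj₂ config))
      ∣x∣ : ∣ x ∣ ≡ s ℕ.+ i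
      ∣x∣ = ≡.trans (≡.sym (∣p─q∣+∣p∩q∣≡∣p∣ x z)) (≡.trans (≡.cong₂ ℕ._+_ ∣x─z∣ ∣x∩z∣)
        (≡.trans (identity i j b) (≡.cong (ℕ._+ i) s≡)))
        where
        identity : ∀ i j b → suc (i ℕ.+ j) ℕ.+ b ≡ suc (j ℕ.+ b) ℕ.+ i
        identity = solve-∀
      ∣z∣ : ∣ z ∣ ≡ j ℕ.+ b
      ∣z∣ = ≡.trans (≡.sym (∣p─q∣+∣p∩q∣≡∣p∣ z x)) (≡.cong₂ ℕ._+_
        (proj₂ (proj₂ (proj₂ (proj₂ config)))) (≡.trans (≡.cong ∣_∣ (∩-comm z x)) ∣x∩z∣))
      out : ∣ ∁ (z ∪ x) ∣ ≡ e ℕ.+ suc b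
      out = ℕ.+-cancelˡ-≡ (∣ z ∣ ℕ.+ ∣ x ─ z ∣) _ _ (≡.trans (∣p∣+∣q─p∣+∣∁[p∪q]∣≡m z x)
        (≡.trans (≡.sym total) (≡.trans (identity b (suc (i ℕ.+ j)) j (e ℕ.+ suc b))
          (≡.cong (ℕ._+ (e ℕ.+ suc b)) (≡.sym (≡.cong₂ ℕ._+_ ∣z∣ ∣x─z∣))))))
        where
        identity : ∀ b k j o → b ℕ.+ k ℕ.+ j ℕ.+ o ≡ j ℕ.+ b ℕ.+ k ℕ.+ o
        identity = solve-∀

-- Fourier and Gram kernels on harmonic functions

module Krawtchouk (K : CommutativeRing 0ℓ 0ℓ) where
  open CommutativeRing K hiding (zero)
  open import Algebra.Properties.Semiring.Sum semiring using (sum; sum-cong-≋)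
  open import Algebra.Properties.Semiring.Mult semiring using (×-homo-+; ×1-homo-*)
  open import Relation.Binary.Reasoning.Setoid setoid
  open IntegerSolver K
  open HarmonicFunctions K
  open FiniteDifferences K
  open Harmonic

  sign : ℕ → Carrier
  sign k = (- 1#) ^ k

  -- (1 - u)ᵏ (1 + u)ˡ φ for the shift operator (u φ) i = φ (suc i).
  shifts : ℕ → ℕ → (ℕ → Carrier) → ℕ → Carrier
  shifts zero    zero    φ i = φ i
  shifts zero    (suc l) φ i = shifts zero l φ i + shifts zero l φ (suc i)
  shifts (suc k) l       φ i = shifts k l φ i - shifts k l φ (suc i)

  shifts-+ : ∀ k l φ i → shifts k (suc l) φ i ≈ shifts k l φ i + shifts k l φ (suc i)
  shifts-+ zero    l φ i = refl
  shifts-+ (suc k) l φ i = trans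
    (+-cong (shifts-+ k l φ i) (-‿cong (shifts-+ k l φ (suc i))))
    (solve 3 (λ a b c → (a :+ b) :- (b :+ c) := (a :- b) :+ (b :- c)) refl _ _ _)

  shifts-∘suc : ∀ k l φ i → shifts k l (λ i → φ (suc i)) i ≡ shifts k l φ (suc i)
  shifts-∘suc zero    zero    φ i = ≡.refl
  shifts-∘suc zero    (suc l) φ i = ≡.cong₂ _+_ (shifts-∘suc zero l φ i) (shifts-∘suc zero l φ (suc i))
  shifts-∘suc (suc k) l       φ i = ≡.cong₂ _-_ (shifts-∘suc k l φ i) (shifts-∘suc k l φ (suc i))

  shifts-0 : ∀ k l i → shifts k l (λ _ → 0#) i ≈ 0#
  shifts-0 zero    zero    i = refl
  shifts-0 zero    (suc l) i = trans (+-cong (shifts-0 zero l i) (shifts-0 zero l (suc i))) (+-identityˡ 0#)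
  shifts-0 (suc k) l       i = trans (+-cong (shifts-0 k l i) (-‿cong (shifts-0 k l (suc i)))) (-‿inverseʳ 0#)

  opaque
    unfolding ∑

    -- A superset `w` of `y` is chosen point by point. A point of `x ─ y` contributes 1 - u, since
    -- taking it flips the sign and raises the size; a point outside `y ∪ x` contributes 1 + u. The
    -- points of `y` are forced and give the constant sign and the starting size.
    ∑-sign : (y x : Subset m) (φ : ℕ → Carrier) →
      ∑ (λ w → χ y w * (sign (∣ x ∩ w ∣) * φ (∣ w ∣))) ≈
      sign (∣ x ∩ y ∣) * shifts (∣ x ─ y ∣) (∣ ∁ (y ∪ x) ∣) φ (∣ y ∣)
    ∑-sign-suc : (y x : Subset m) (φ : ℕ → Carrier) →
      ∑ (λ w → χ y w * (sign (∣ x ∩ w ∣) * φ (suc (∣ w ∣)))) ≈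
      sign (∣ x ∩ y ∣) * shifts (∣ x ─ y ∣) (∣ ∁ (y ∪ x) ∣) φ (suc (∣ y ∣))
    ∑-sign-neg : (y x : Subset m) (φ : ℕ → Carrier) →
      ∑ (λ w → χ y w * (- 1# * sign (∣ x ∩ w ∣) * φ (suc (∣ w ∣)))) ≈
      - 1# * (sign (∣ x ∩ y ∣) * shifts (∣ x ─ y ∣) (∣ ∁ (y ∪ x) ∣) φ (suc (∣ y ∣)))

    ∑-sign [] [] φ = *-identityˡ _
    ∑-sign {suc m} (outside ∷ y) (outside ∷ x) φ = trans
      (+-cong (∑-sign y x φ) (∑-sign-suc y x φ))
      (trans (sym (distribˡ _ _ _)) (*-congˡ (sym (shifts-+ (∣ x ─ y ∣) (∣ ∁ (y ∪ x) ∣) φ (∣ y ∣)))))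
    ∑-sign {suc m} (outside ∷ y) (inside ∷ x) φ = trans
      (+-cong (∑-sign y x φ) (∑-sign-neg y x φ))
      (solve 3 (λ s a b → s :* a :+ :- con 1ℤ :* (s :* b) := s :* (a :- b)) refl _ _ _)
    ∑-sign {suc m} (inside ∷ y) (outside ∷ x) φ = trans
      (+-cong (∑-zero {m} _ λ w → zeroˡ _) (∑-sign-suc y x φ))
      (+-identityˡ _)
    ∑-sign {suc m} (inside ∷ y) (inside ∷ x) φ = trans
      (+-cong (∑-zero {m} _ λ w → zeroˡ _) (∑-sign-neg y x φ))
      (trans (+-identityˡ _) (sym (*-assoc _ _ _)))

    ∑-sign-suc y x φ = trans (∑-sign y x (λ i → φ (suc i)))
      (*-congˡ (reflexive (shifts-∘suc (∣ x ─ y ∣) (∣ ∁ (y ∪ x) ∣) φ (∣ y ∣))))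

    ∑-sign-neg y x φ = trans
      (∑-cong λ w → solve 3 (λ a b c → a :* (:- con 1ℤ :* b :* c) := :- con 1ℤ :* (a :* (b :* c)))
                            refl (χ y w) (sign (∣ x ∩ w ∣)) (φ (suc (∣ w ∣))))
      (trans (∑-*ˡ (- 1#) (λ w → χ y w * (sign (∣ x ∩ w ∣) * φ (suc (∣ w ∣))))) (*-congˡ (∑-sign-suc y x φ)))

    ∑-common : (y z : Subset m) (φ : ℕ → Carrier) →
      ∑ (λ w → χ z w * (χ y w * φ (∣ w ∣))) ≈ shifts 0 (∣ ∁ (y ∪ z) ∣) φ (∣ y ∣ ℕ.+ ∣ z ─ y ∣)
    ∑-common-suc : (y z : Subset m) (φ : ℕ → Carrier) →
      ∑ (λ w → χ z w * (χ y w * φ (suc (∣ w ∣)))) ≈ shifts 0 (∣ ∁ (y ∪ z) ∣) φ (suc (∣ y ∣ ℕ.+ ∣ z ─ y ∣))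

    ∑-common [] [] φ = trans (*-identityˡ _) (*-identityˡ _)
    ∑-common {suc m} (outside ∷ y) (outside ∷ z) φ = +-cong (∑-common y z φ) (∑-common-suc y z φ)
    ∑-common {suc m} (outside ∷ y) (inside ∷ z) φ = trans
      (+-cong (∑-zero {m} _ λ w → zeroˡ _) (∑-common-suc y z φ))
      (trans (+-identityˡ _) (reflexive (≡.cong (shifts 0 (∣ ∁ (y ∪ z) ∣) φ) (≡.sym (ℕ.+-suc (∣ y ∣) (∣ z ─ y ∣))))))
    ∑-common {suc m} (inside ∷ y) (outside ∷ z) φ = trans
      (+-cong (∑-zero {m} _ λ w → *0-zero (zeroˡ _)) (∑-common-suc y z φ)) (+-identityˡ _)
    ∑-common {suc m} (inside ∷ y) (inside ∷ z) φ = trans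
      (+-cong (∑-zero {m} _ λ w → zeroˡ _) (∑-common-suc y z φ)) (+-identityˡ _)

    ∑-common-suc y z φ = trans (∑-common y z (λ i → φ (suc i)))
      (reflexive (shifts-∘suc 0 (∣ ∁ (y ∪ z) ∣) φ (∣ y ∣ ℕ.+ ∣ z ─ y ∣)))

  private
    -- Replaces `Up` by its adjoint, acting on the kernel.
    swap-sums : (ψ κ : Subset m → Carrier) →
      ∑ (λ w → κ w * Up ψ w) ≈ ∑ (λ y → ψ y * ∑ (λ w → χ y w * κ w))
    swap-sums ψ κ = begin
      ∑ (λ w → κ w * ∑ (λ y → χ y w * ψ y))
        ≈⟨ ∑-cong (λ w → sym (∑-*ˡ (κ w) (λ y → χ y w * ψ y))) ⟩
      ∑ (λ w → ∑ (λ y → κ w * (χ y w * ψ y)))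
        ≈⟨ ∑-swap (λ w y → κ w * (χ y w * ψ y)) ⟩
      ∑ (λ y → ∑ (λ w → κ w * (χ y w * ψ y)))
        ≈⟨ ∑-cong (λ y → ∑-cong λ w → solve 3 (λ k c p → k :* (c :* p) := p :* (c :* k)) refl (κ w) (χ y w) (ψ y)) ⟩
      ∑ (λ y → ∑ (λ w → ψ y * (χ y w * κ w)))
        ≈⟨ ∑-cong (λ y → ∑-*ˡ (ψ y) (λ w → χ y w * κ w)) ⟩
      ∑ (λ y → ψ y * ∑ (λ w → χ y w * κ w)) ∎

  on-support : ∀ {s} {ψ : Subset m → Carrier} → Harmonic s ψ → {f g : Subset m → Carrier} →
    (∀ y → ∣ y ∣ ≡ s → f y ≈ g y) → ∑ (λ y → ψ y * f y) ≈ ∑ (λ y → ψ y * g y)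
  on-support {s = s} h e = ∑-cong λ y → lemma y
    where
    lemma : ∀ y → _ * _ ≈ _ * _
    lemma y with ∣ y ∣ ℕ.≟ s
    ... | yes p = *-congˡ (e y p)
    ... | no ne = trans (*-congʳ (supported h y ne)) (trans (zeroˡ _)
                    (sym (0*-zero (supported h y ne))))

  module _ {s} {ψ : Subset m → Carrier} (h : Harmonic s ψ) (φ : ℕ → Carrier) where

    private
      -- `H` has to match the kernel only for `y` of size s, where ψ lives. This leaves room to
      -- choose the parametrisation by `∣ y ─ x ∣` and `∣ y ∩ x ∣` that suits the size of `x`.
      fourier-sum : ∀ x H → (∀ y → ∣ y ∣ ≡ s →
          sign (∣ x ∩ y ∣) * shifts (∣ x ─ y ∣) (∣ ∁ (y ∪ x) ∣) φ (∣ y ∣) ≈ H (∣ y ─ x ∣) (∣ y ∩ x ∣)) →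
        ∑ (λ w → sign (∣ x ∩ w ∣) * φ (∣ w ∣) * Up ψ w) ≈ ∂^ s H 0 0 * Up ψ x
      fourier-sum x H e = begin
        ∑ (λ w → sign (∣ x ∩ w ∣) * φ (∣ w ∣) * Up ψ w)
          ≈⟨ swap-sums ψ (λ w → sign (∣ x ∩ w ∣) * φ (∣ w ∣)) ⟩
        ∑ (λ y → ψ y * ∑ (λ w → χ y w * (sign (∣ x ∩ w ∣) * φ (∣ w ∣))))
          ≈⟨ ∑-cong (λ y → *-congˡ (∑-sign y x φ)) ⟩
        ∑ (λ y → ψ y * (sign (∣ x ∩ y ∣) * shifts (∣ x ─ y ∣) (∣ ∁ (y ∪ x) ∣) φ (∣ y ∣)))
          ≈⟨ on-support h e ⟩
        ∑ (λ y → ψ y * H (∣ y ─ x ∣) (∣ y ∩ x ∣))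
          ≈⟨ harmonic-kernel h H x ⟩
        ∂^ s H 0 0 * Up ψ x ∎

      gram-sum : ∀ y H → (∀ z → ∣ z ∣ ≡ s →
          shifts 0 (∣ ∁ (y ∪ z) ∣) φ (∣ y ∣ ℕ.+ ∣ z ─ y ∣) ≈ H (∣ z ─ y ∣) (∣ z ∩ y ∣)) →
        ∑ (λ w → χ y w * φ (∣ w ∣) * Up ψ w) ≈ ∂^ s H 0 0 * Up ψ y
      gram-sum y H e = begin
        ∑ (λ w → χ y w * φ (∣ w ∣) * Up ψ w)
          ≈⟨ swap-sums ψ (λ w → χ y w * φ (∣ w ∣)) ⟩
        ∑ (λ z → ψ z * ∑ (λ w → χ z w * (χ y w * φ (∣ w ∣))))
          ≈⟨ ∑-cong (λ z → *-congˡ (∑-common y z φ)) ⟩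
        ∑ (λ z → ψ z * shifts 0 (∣ ∁ (y ∪ z) ∣) φ (∣ y ∣ ℕ.+ ∣ z ─ y ∣))
          ≈⟨ on-support h e ⟩
        ∑ (λ z → ψ z * H (∣ z ─ y ∣) (∣ z ∩ y ∣))
          ≈⟨ harmonic-kernel h H y ⟩
        ∂^ s H 0 0 * Up ψ y ∎

    fourier-Up : ∀ k l x → ∣ x ∣ ≡ s ℕ.+ k → m ≡ s ℕ.+ (s ℕ.+ k) ℕ.+ l →
      ∑ (λ w → sign (∣ x ∩ w ∣) * φ (∣ w ∣) * Up ψ w) ≈ (- ι 2) ^ s * shifts k l φ s * Up ψ x
    fourier-Up k l x ∣x∣ m≡ = begin
      ∑ (λ w → sign (∣ x ∩ w ∣) * φ (∣ w ∣) * Up ψ w)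
        ≈⟨ fourier-sum x H pointwise ⟩
      ∂^ s H 0 0 * Up ψ x
        ≈⟨ *-congʳ (∂^-eigen (- ι 2) H eigen s 0 0) ⟩
      (- ι 2) ^ s * (1# * shifts k l φ s) * Up ψ x
        ≈⟨ *-congʳ (*-congˡ (*-identityˡ _)) ⟩
      (- ι 2) ^ s * shifts k l φ s * Up ψ x ∎
      where
      H : ℕ → ℕ → Carrier
      H a b = sign b * shifts (a ℕ.+ k) (b ℕ.+ l) φ s

      -- Putting a point of `y` into `x` replaces a factor 1 - u by -(1 + u), and -(1 + u) - (1 - u)
      -- = -2. The 2 is written 1 + (1 + 0) below because `ι 2` unfolds to that.
      eigen : ∀ a b → ∂ H a b ≈ - ι 2 * H a b
      eigen a b = trans
        (+-congʳ (*-congˡ (shifts-+ (a ℕ.+ k) (b ℕ.+ l) φ s)))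
        (solve 3 (λ g u v → :- con 1ℤ :* g :* (u :+ v) :- g :* (u :- v)
                            := :- (con 1ℤ :+ (con 1ℤ :+ con 0ℤ)) :* (g :* u)) refl _ _ _)

      pointwise : ∀ y → ∣ y ∣ ≡ s → sign (∣ x ∩ y ∣) * shifts (∣ x ─ y ∣) (∣ ∁ (y ∪ x) ∣) φ (∣ y ∣) ≈
                  H (∣ y ─ x ∣) (∣ y ∩ x ∣)
      pointwise y ∣y∣ = *-cong
        (reflexive (≡.cong (λ v → sign (∣ v ∣)) (∩-comm x y)))
        (reflexive (≡.trans
          (≡.cong₂ (λ u v → shifts u v φ (∣ y ∣))
            (∣q─p∣-excess y x k ∣y∣ ∣x∣) (∣∁[p∪q]∣-excess y x k l ∣y∣ ∣x∣ m≡))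
          (≡.cong (shifts (∣ y ─ x ∣ ℕ.+ k) (∣ y ∩ x ∣ ℕ.+ l) φ) ∣y∣)))

    private
      out≡ : ∀ (y x : Subset m) → ∣ ∁ (y ∪ x) ∣ ≡ m ℕ.∸ (∣ y ∣ ℕ.+ ∣ x ─ y ∣)
      out≡ y x = ≡.trans (≡.sym (ℕ.m+n∸m≡n (∣ y ∣ ℕ.+ ∣ x ─ y ∣) _))
                         (≡.cong (ℕ._∸ (∣ y ∣ ℕ.+ ∣ x ─ y ∣)) (∣p∣+∣q─p∣+∣∁[p∪q]∣≡m y x))

    -- For sizes of `x` that admit no `k` and `l` as in `fourier-Up`. Truncated subtraction still
    -- expresses the kernel through `∣ y ∩ x ∣`, and any value of its s-fold difference will do, as
    -- it multiplies `Up ψ x`.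
    fourier-Up-zero : ∀ x → Up ψ x ≈ 0# →
      ∑ (λ w → sign (∣ x ∩ w ∣) * φ (∣ w ∣) * Up ψ w) ≈ 0#
    fourier-Up-zero x z = trans (fourier-sum x H pointwise) (*0-zero z)
      where
      H : ℕ → ℕ → Carrier
      H a b = sign b * shifts (∣ x ∣ ℕ.∸ b) (m ℕ.∸ (s ℕ.+ (∣ x ∣ ℕ.∸ b))) φ s

      pointwise : ∀ y → ∣ y ∣ ≡ s → sign (∣ x ∩ y ∣) * shifts (∣ x ─ y ∣) (∣ ∁ (y ∪ x) ∣) φ (∣ y ∣) ≈
                  H (∣ y ─ x ∣) (∣ y ∩ x ∣)
      pointwise y ≡.refl = reflexive (≡.trans
        (≡.cong₂ (λ k l → sign (∣ x ∩ y ∣) * shifts k l φ (∣ y ∣)) x─y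
           (≡.trans (out≡ y x) (≡.cong (λ k → m ℕ.∸ (∣ y ∣ ℕ.+ k)) x─y)))
        (≡.cong (λ v → sign (∣ v ∣) * shifts (∣ x ∣ ℕ.∸ ∣ v ∣) (m ℕ.∸ (s ℕ.+ (∣ x ∣ ℕ.∸ ∣ v ∣))) φ s) (∩-comm x y)))
        where
        x─y : ∣ x ─ y ∣ ≡ ∣ x ∣ ℕ.∸ ∣ x ∩ y ∣
        x─y = ≡.trans (≡.sym (ℕ.m+n∸n≡m _ (∣ x ∩ y ∣))) (≡.cong (ℕ._∸ ∣ x ∩ y ∣) (∣p─q∣+∣p∩q∣≡∣p∣ x y))

    -- When a point of `z` is made common to `y`, a forced element of `w` (factor u) is exchanged
    -- for a free outside point (factor 1 + u), so the eigenvalue is (1 + u) - u = 1. What remains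
    -- is (1 + u)^N, hence a binomial coefficient once φ is the indicator of a layer.
    gram-Up : ∀ N y → ∣ y ∣ ≡ s → m ≡ s ℕ.+ s ℕ.+ N →
      ∑ (λ w → χ y w * φ (∣ w ∣) * Up ψ w) ≈ shifts 0 N φ s * ψ y
    gram-Up N y ≡.refl m≡ = begin
      ∑ (λ w → χ y w * φ (∣ w ∣) * Up ψ w)     ≈⟨ gram-sum y H pointwise ⟩
      ∂^ s H 0 0 * Up ψ y                      ≈⟨ *-cong (∂^-eigen 1# H eigen s 0 0) (Up-middle h y ≡.refl) ⟩
      1# ^ s * shifts 0 N φ s * ψ y            ≈⟨ *-congʳ (trans (*-congʳ (1^k≈1 s)) (*-identityˡ _)) ⟩
      shifts 0 N φ s * ψ y                     ∎
      where
      H : ℕ → ℕ → Carrier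
      H a b = shifts 0 (b ℕ.+ N) φ (a ℕ.+ s)

      1^k≈1 : ∀ k → 1# ^ k ≈ 1#
      1^k≈1 zero    = refl
      1^k≈1 (suc k) = trans (*-identityˡ _) (1^k≈1 k)

      eigen : ∀ a b → ∂ H a b ≈ 1# * H a b
      eigen a b = solve 2 (λ u v → u :+ v :- v := con 1ℤ :* u) refl _ _

      pointwise : ∀ z → ∣ z ∣ ≡ s → shifts 0 (∣ ∁ (y ∪ z) ∣) φ (∣ y ∣ ℕ.+ ∣ z ─ y ∣) ≈ H (∣ z ─ y ∣) (∣ z ∩ y ∣)
      pointwise z ∣z∣ = reflexive (≡.cong₂ (λ u v → shifts 0 u φ v)
        (≡.trans (≡.cong (λ v → ∣ ∁ v ∣) (∪-comm y z))
          (∣∁[p∪q]∣-excess z y 0 N ∣z∣ (≡.sym (ℕ.+-identityʳ _))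
            (≡.trans m≡ (≡.cong (λ k → s ℕ.+ k ℕ.+ N) (≡.sym (ℕ.+-identityʳ _))))))
        (ℕ.+-comm (∣ y ∣) _))

    gram-Up-zero : ∀ y → Up ψ y ≈ 0# → ∑ (λ w → χ y w * φ (∣ w ∣) * Up ψ w) ≈ 0#
    gram-Up-zero y z = trans
      (gram-sum y (λ a b → shifts 0 (m ℕ.∸ (∣ y ∣ ℕ.+ a)) φ (∣ y ∣ ℕ.+ a))
        λ z _ → reflexive (≡.cong (λ k → shifts 0 k φ (∣ y ∣ ℕ.+ ∣ z ─ y ∣)) (out≡ y z)))
      (*0-zero z)

  -- Binomial and Krawtchouk numbers as coefficients

  indicator : ℕ → ℕ → Carrier
  indicator r i = [ i ℕ.≟ r ]

  shifts-indicator : ∀ k l s j → shifts k l (indicator (s ℕ.+ j)) s ≡ shifts k l (indicator j) 0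
  shifts-indicator k l zero    j = ≡.refl
  shifts-indicator k l (suc s) j =
    ≡.trans (≡.sym (shifts-∘suc k l (indicator (suc s ℕ.+ j)) s)) (shifts-indicator k l s j)

  shifts-binomial : ∀ l j → shifts 0 l (indicator j) 0 ≈ ι (l C j)
  shifts-binomial zero    zero    = sym (+-identityʳ 1#)
  shifts-binomial zero    (suc j) = refl
  shifts-binomial (suc l) zero    = begin
    shifts 0 l (indicator 0) 0 + shifts 0 l (indicator 0) 1
      ≈⟨ +-cong (shifts-binomial l 0) (trans (reflexive (≡.sym (shifts-∘suc 0 l (indicator 0) 0))) (shifts-0 0 l 0)) ⟩
    ι (l C 0) + 0#
      ≈⟨ +-identityʳ _ ⟩
    ι (suc l C 0) ∎
  shifts-binomial (suc l) (suc j) = begin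
    shifts 0 l (indicator (suc j)) 0 + shifts 0 l (indicator (suc j)) 1
      ≈⟨ +-cong (shifts-binomial l (suc j))
                (trans (reflexive (≡.sym (shifts-∘suc 0 l (indicator (suc j)) 0))) (shifts-binomial l j)) ⟩
    ι (l C suc j) + ι (l C j)
      ≈⟨ trans (+-comm _ _) (sym (×-homo-+ 1# (l C j) (l C suc j))) ⟩
    ι (l C j ℕ.+ l C suc j)
      ≡⟨ ≡.cong ι (nCk+nC[k+1]≡[n+1]C[k+1] l j) ⟩
    ι (suc l C suc j) ∎

  -- Coefficient of a product of two power series, unfolded from the front so that Pascal's rule can
  -- be applied to `f` while `g` stays fixed.
  convolution : (ℕ → Carrier) → (ℕ → Carrier) → ℕ → Carrier
  convolution f g zero    = f 0 * g 0
  convolution f g (suc j) = f 0 * g (suc j) + convolution (λ i → f (suc i)) g j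

  convolution-cong : ∀ {f f′} g → (∀ i → f i ≈ f′ i) → ∀ j → convolution f g j ≈ convolution f′ g j
  convolution-cong g e zero    = *-congʳ (e 0)
  convolution-cong g e (suc j) = +-cong (*-congʳ (e 0)) (convolution-cong g (λ i → e (suc i)) j)

  convolution-minus : ∀ f f′ g j →
    convolution (λ i → f i - f′ i) g j ≈ convolution f g j - convolution f′ g j
  convolution-minus f f′ g zero    = solve 3 (λ a b c → (a :- b) :* c := a :* c :- b :* c) refl _ _ _
  convolution-minus f f′ g (suc j) = trans
    (+-congˡ (convolution-minus (λ i → f (suc i)) (λ i → f′ (suc i)) g j))
    (solve 5 (λ a b c x y → (a :- b) :* c :+ (x :- y) := (a :* c :+ x) :- (b :* c :+ y)) refl _ _ _ _ _)

  convolution-sum : ∀ f g j → sum {suc j} (λ i → f (toℕ i) * g (j ℕ.∸ toℕ i)) ≈ convolution f g j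
  convolution-sum f g zero    = +-identityʳ _
  convolution-sum f g (suc j) = +-congˡ (convolution-sum (λ i → f (suc i)) g j)

  convolution-zero : ∀ f g → (∀ i → f i ≈ 0#) → ∀ j → convolution f g j ≈ 0#
  convolution-zero f g z zero    = 0*-zero (z 0)
  convolution-zero f g z (suc j) = trans
    (+-cong (0*-zero (z 0)) (convolution-zero _ g (λ i → z (suc i)) j)) (+-identityˡ 0#)

  krawtchouk-sum : (j k l : ℕ) → Carrier
  krawtchouk-sum j k l = sum {suc j} λ i → sign (toℕ i) * ι ((k C toℕ i) ℕ.* (l C (j ℕ.∸ toℕ i)))

  -- The Krawtchouk numbers have the generating function (1 - u)^k (1 + u)^l, and `indicator j`
  -- evaluated at 0 extracts the coefficient of u^j. In the induction, multiplication by 1 - u is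
  -- Pascal's rule for signed binomials.
  shifts-krawtchouk : ∀ j k l → shifts k l (indicator j) 0 ≈ krawtchouk-sum j k l
  shifts-krawtchouk j k l = begin
    shifts k l (indicator j) 0
      ≈⟨ lemma j k ⟩
    convolution (signed k) (λ i → ι (l C i)) j
      ≈⟨ convolution-sum (signed k) (λ i → ι (l C i)) j ⟨
    sum {suc j} (λ i → signed k (toℕ i) * ι (l C (j ℕ.∸ toℕ i)))
      ≈⟨ sum-cong-≋ {suc j} (λ i → trans (*-assoc (sign (toℕ i)) _ _) (*-congˡ (sym (×1-homo-* (k C toℕ i) (l C (j ℕ.∸ toℕ i)))))) ⟩
    krawtchouk-sum j k l ∎
    where
    signed : ℕ → ℕ → Carrier
    signed k i = sign i * ι (k C i)

    pascal : ∀ k i → signed (suc k) (suc i) ≈ signed k (suc i) - signed k i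
    pascal k i = trans
      (*-congˡ (trans (reflexive (≡.cong ι (≡.sym (nCk+nC[k+1]≡[n+1]C[k+1] k i)))) (×-homo-+ 1# (k C i) (k C suc i))))
      (solve 3 (λ g a b → :- con 1ℤ :* g :* (a :+ b) := :- con 1ℤ :* g :* b :- g :* a) refl _ _ _)

    lemma : ∀ j k → shifts k l (indicator j) 0 ≈ convolution (signed k) (λ i → ι (l C i)) j
    lemma zero zero = trans (shifts-binomial l 0)
      (solve 1 (λ a → a := con 1ℤ :* (con 1ℤ :+ con 0ℤ) :* a) refl _)
    lemma (suc j) zero = begin
      shifts 0 l (indicator (suc j)) 0
        ≈⟨ shifts-binomial l (suc j) ⟩
      ι (l C suc j)
        ≈⟨ solve 1 (λ a → a := con 1ℤ :* (con 1ℤ :+ con 0ℤ) :* a :+ con 0ℤ) refl _ ⟩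
      1# * ι 1 * ι (l C suc j) + 0#
        ≈⟨ +-congˡ (convolution-zero _ _ (λ i → zeroʳ _) j) ⟨
      1# * ι 1 * ι (l C suc j) + convolution (λ i → signed 0 (suc i)) (λ i → ι (l C i)) j ∎
    lemma zero (suc k) = begin
      shifts k l (indicator 0) 0 - shifts k l (indicator 0) 1
        ≈⟨ +-cong (lemma zero k) (-‿cong (trans (reflexive (≡.sym (shifts-∘suc k l (indicator 0) 0))) (shifts-0 k l 0))) ⟩
      convolution (signed k) (λ i → ι (l C i)) 0 - 0#
        ≈⟨ solve 1 (λ a → a :- con 0ℤ := a) refl _ ⟩
      convolution (signed (suc k)) (λ i → ι (l C i)) 0 ∎
    lemma (suc j) (suc k) = begin
      shifts k l (indicator (suc j)) 0 - shifts k l (indicator (suc j)) 1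
        ≈⟨ +-cong (lemma (suc j) k)
             (-‿cong (trans (reflexive (≡.sym (shifts-∘suc k l (indicator (suc j)) 0))) (lemma j k))) ⟩
      signed k 0 * ι (l C suc j) + convolution (λ i → signed k (suc i)) (λ i → ι (l C i)) j
        - convolution (signed k) (λ i → ι (l C i)) j
        ≈⟨ +-assoc _ _ _ ⟩
      signed k 0 * ι (l C suc j) + (convolution (λ i → signed k (suc i)) (λ i → ι (l C i)) j
        - convolution (signed k) (λ i → ι (l C i)) j)
        ≈⟨ +-congˡ (trans (convolution-cong _ (pascal k) j)
             (convolution-minus (λ i → signed k (suc i)) (signed k) (λ i → ι (l C i)) j)) ⟨
      convolution (signed (suc k)) (λ i → ι (l C i)) (suc j) ∎

-- Sums with at most one nontrivial term

module SingleTermSum (M : CommutativeMonoid 0ℓ 0ℓ) where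
  open CommutativeMonoid M renaming (_∙_ to _+_; ε to 0#)
  open MonoidSum M using (sum)

  sum-zero : ∀ {k} (f : Fin k → Carrier) → (∀ i → f i ≈ 0#) → sum f ≈ 0#
  sum-zero {zero}  f z = refl
  sum-zero {suc k} f z = trans (∙-cong (z zero) (sum-zero (f ∘ suc) (z ∘ suc))) (identityˡ 0#)

  sum-single : ∀ {k} (f : Fin k → Carrier) i → (∀ j → j ≢ i → f j ≈ 0#) → sum f ≈ f i
  sum-single f zero    z = trans (∙-congˡ (sum-zero (f ∘ suc) λ j → z (suc j) λ ())) (identityʳ _)
  sum-single f (suc i) z = trans
    (∙-cong (z zero λ ()) (sum-single (f ∘ suc) i λ j ne → z (suc j) (ne ∘ Fin.suc-injective)))
    (identityˡ _)

-- Permutations acting on subsets, and ranges of injections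

module Permutations where
  open MonoidSum ℕ.+-0-commutativeMonoid using (sum; sum-permute; sum-cong-≋; ∑-comm)
  open SingleTermSum ℕ.+-0-commutativeMonoid

  -- Unfolds to the same term as the action `_•_`, but makes no reference to ℝ, so it serves over
  -- any commutative ring.
  permute : Permutation′ n → Subset n → Subset n
  permute g x = tabulate λ ω → lookup x (g ⟨$⟩ˡ ω)

  lookup-permute : ∀ (g : Permutation′ n) x ω → lookup (permute g x) ω ≡ lookup x (g ⟨$⟩ˡ ω)
  lookup-permute g x ω = lookup∘tabulate (λ ω → lookup x (g ⟨$⟩ˡ ω)) ω

  permute-flip : ∀ (g : Permutation′ n) x → permute g (permute (Perm.flip g) x) ≡ x
  permute-flip g x = ≡.trans
    (tabulate-cong λ ω → ≡.trans (lookup-permute (Perm.flip g) x (g ⟨$⟩ˡ ω)) (≡.cong (lookup x) (Perm.inverseʳ g)))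
    (tabulate∘lookup x)

  flip-permute : ∀ (g : Permutation′ n) x → permute (Perm.flip g) (permute g x) ≡ x
  flip-permute g x = ≡.trans
    (tabulate-cong λ ω → ≡.trans (lookup-permute g x (g ⟨$⟩ʳ ω)) (≡.cong (lookup x) (Perm.inverseˡ g)))
    (tabulate∘lookup x)

  bitℕ : Bool → ℕ
  bitℕ b = if b then 1 else 0

  ∣p∣≡sum : (x : Subset n) → ∣ x ∣ ≡ sum (λ ω → bitℕ (lookup x ω))
  ∣p∣≡sum []             = ≡.refl
  ∣p∣≡sum (outside ∷ x) = ∣p∣≡sum x
  ∣p∣≡sum (inside ∷ x)  = ≡.cong suc (∣p∣≡sum x)

  ∣permute∣ : ∀ (g : Permutation′ n) x → ∣ permute g x ∣ ≡ ∣ x ∣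
  ∣permute∣ g x = begin
    ∣ permute g x ∣                                ≡⟨ ∣p∣≡sum (permute g x) ⟩
    sum (λ ω → bitℕ (lookup (permute g x) ω))      ≡⟨ sum-cong-≋ (λ ω → ≡.cong bitℕ (lookup-permute g x ω)) ⟩
    sum (λ ω → bitℕ (lookup x (g ⟨$⟩ˡ ω)))         ≡⟨ sum-permute (bitℕ ∘ lookup x) (Perm.flip g) ⟨
    sum (λ ω → bitℕ (lookup x ω))                  ≡⟨ ∣p∣≡sum x ⟨
    ∣ x ∣                                          ∎
    where open ≡.≡-Reasoning

  ⊆⇒lookup : ∀ {p q : Subset n} → p ⊆ q → ∀ ω → lookup p ω ≡ inside → lookup q ω ≡ inside
  ⊆⇒lookup {p = p} p⊆q ω e = []=⇒lookup (p⊆q (lookup⇒[]= ω p e))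

  lookup⇒⊆ : ∀ {p q : Subset n} → (∀ ω → lookup p ω ≡ inside → lookup q ω ≡ inside) → p ⊆ q
  lookup⇒⊆ {q = q} h {ω} i = lookup⇒[]= ω q (h ω ([]=⇒lookup i))

  permute-mono : ∀ (g : Permutation′ n) {p q} → p ⊆ q → permute g p ⊆ permute g q
  permute-mono g {p} {q} p⊆q = lookup⇒⊆ λ ω e → ≡.trans (lookup-permute g q ω)
    (⊆⇒lookup p⊆q (g ⟨$⟩ˡ ω) (≡.trans (≡.sym (lookup-permute g p ω)) e))

  permute-reflect : ∀ (g : Permutation′ n) {p q} → permute g p ⊆ permute g q → p ⊆ q
  permute-reflect g {p} {q} h = back
    where
    back : p ⊆ q
    back = ≡.subst₂ (λ u v → u ⊆ v) (flip-permute g p) (flip-permute g q) (permute-mono (Perm.flip g) h)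

  module _ (a b : Fin n) where
    lookup-transposeˡ : ∀ x → lookup (permute (transpose a b) x) a ≡ lookup x b
    lookup-transposeˡ x = ≡.trans (lookup-permute (transpose a b) x a) (≡.cong (lookup x) step)
      where
      step : PC.transpose b a a ≡ b
      step with a Fin.≟ b
      ... | yes e = e
      ... | no _ rewrite dec-true (a Fin.≟ a) ≡.refl = ≡.refl

    lookup-transposeʳ : ∀ x → lookup (permute (transpose a b) x) b ≡ lookup x a
    lookup-transposeʳ x = ≡.trans (lookup-permute (transpose a b) x b) (≡.cong (lookup x) step)
      where
      step : PC.transpose b a b ≡ a
      step rewrite dec-true (b Fin.≟ b) ≡.refl = ≡.refl

    transpose-other : ∀ {c} → c ≢ a → c ≢ b → transpose a b ⟨$⟩ʳ c ≡ c
    transpose-other {c} c≢a c≢b rewrite dec-false (c Fin.≟ a) c≢a | dec-false (c Fin.≟ b) c≢b = ≡.refl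

    lookup-transpose-other : ∀ x {c} → c ≢ a → c ≢ b → lookup (permute (transpose a b) x) c ≡ lookup x c
    lookup-transpose-other x {c} c≢a c≢b = ≡.trans (lookup-permute (transpose a b) x c) (≡.cong (lookup x) step)
      where
      step : PC.transpose b a c ≡ c
      step rewrite dec-false (c Fin.≟ b) c≢b | dec-false (c Fin.≟ a) c≢a = ≡.refl

    transpose-fixes : ∀ x → lookup x a ≡ lookup x b → permute (transpose a b) x ≡ x
    transpose-fixes x e = ≡.trans (tabulate-cong pointwise) (tabulate∘lookup x)
      where
      pointwise : ∀ ω → lookup x (PC.transpose b a ω) ≡ lookup x ω
      pointwise ω with ω Fin.≟ b
      ... | yes ≡.refl = e
      ... | no _ with ω Fin.≟ a
      ...   | yes ≡.refl = ≡.sym e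
      ...   | no _       = ≡.refl

  range : (Fin s → Fin n) → Subset n
  range f = tabulate λ ω → does (Fin.any? λ i → f i Fin.≟ ω)

  lookup-range : (f : Fin s → Fin n) → ∀ i → lookup (range f) (f i) ≡ inside
  lookup-range f i = ≡.trans (lookup∘tabulate _ (f i)) (dec-true (Fin.any? λ j → f j Fin.≟ f i) (i , ≡.refl))

  lookup-range-outside : (f : Fin s → Fin n) → ∀ ω → (∀ i → f i ≢ ω) → lookup (range f) ω ≡ outside
  lookup-range-outside f ω h =
    ≡.trans (lookup∘tabulate _ ω) (dec-false (Fin.any? λ j → f j Fin.≟ ω) λ (i , e) → h i e)

  range-⊆ : (f : Fin s → Fin n) → ∀ {x} → (∀ i → lookup x (f i) ≡ inside) → range f ⊆ x
  range-⊆ f {x} h = lookup⇒⊆ λ ω e → member ω (Fin.any? λ i → f i Fin.≟ ω)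
    (≡.trans (≡.sym (lookup∘tabulate (λ ω → does (Fin.any? λ i → f i Fin.≟ ω)) ω)) e)
    where
    member : ∀ ω → (d : Dec (∃ λ i → f i ≡ ω)) → does d ≡ true → lookup x ω ≡ inside
    member ω (yes (i , ≡.refl)) _ = h i

  -- Double counting of the pairs of a point ω and an index i with `f i` equal to ω.
  ∣range∣ : (f : Fin s → Fin n) → (∀ {i j} → f i ≡ f j → i ≡ j) → ∣ range f ∣ ≡ s
  ∣range∣ {s} {n} f inj = begin
    ∣ range f ∣
      ≡⟨ ∣p∣≡sum (range f) ⟩
    sum (λ ω → bitℕ (lookup (range f) ω))
      ≡⟨ sum-cong-≋ column ⟩
    sum {n} (λ ω → sum {s} λ i → bitℕ (does (f i Fin.≟ ω)))
      ≡⟨ ∑-comm (λ ω i → bitℕ (does (f i Fin.≟ ω))) ⟩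
    sum {s} (λ i → sum {n} λ ω → bitℕ (does (f i Fin.≟ ω)))
      ≡⟨ sum-cong-≋ (λ i → ≡.trans
           (sum-single (λ ω → bitℕ (does (f i Fin.≟ ω))) (f i) λ ω ne →
             ≡.cong bitℕ (dec-false (f i Fin.≟ ω) (ne ∘ ≡.sym)))
           (≡.cong bitℕ (dec-true (f i Fin.≟ f i) ≡.refl))) ⟩
    sum {s} (λ _ → 1)
      ≡⟨ ones s ⟩
    s ∎
    where
    open ≡.≡-Reasoning

    ones : ∀ k → sum {k} (λ _ → 1) ≡ k
    ones zero    = ≡.refl
    ones (suc k) = ≡.cong suc (ones k)

    column : ∀ ω → bitℕ (lookup (range f) ω) ≡ sum λ i → bitℕ (does (f i Fin.≟ ω))
    column ω with Fin.any? (λ i → f i Fin.≟ ω)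
    ... | yes (i , ≡.refl) = ≡.trans (≡.cong bitℕ (lookup-range f i)) (≡.sym (≡.trans
      (sum-single (λ j → bitℕ (does (f j Fin.≟ f i))) i λ j ne →
        ≡.cong bitℕ (dec-false (f j Fin.≟ f i) (ne ∘ inj)))
      (≡.cong bitℕ (dec-true (f i Fin.≟ f i) ≡.refl))))
    ... | no ne = ≡.trans (≡.cong bitℕ (lookup-range-outside f ω λ i e → ne (i , e)))
      (≡.sym (sum-zero (λ i → bitℕ (does (f i Fin.≟ ω))) λ i →
        ≡.cong bitℕ (dec-false (f i Fin.≟ ω) λ e → ne (i , e))))

open Permutations

-- Column antisymmetry

module Antisymmetry (K : CommutativeRing 0ℓ 0ℓ) where
  open CommutativeRing K hiding (zero)
  open import Algebra.Properties.Group +-group using (x∙y⁻¹≈ε⇒x≈y)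
  open import Algebra.Properties.Ring ring using (-‿distribʳ-*; -‿distribˡ-*)
  open import Relation.Binary.Reasoning.Setoid setoid
  open MonoidSum *-commutativeMonoid using () renaming (sum to ∏; sum-cong-≋ to ∏-cong)
  open IntegerSolver K
  open HarmonicFunctions K
  open FiniteDifferences K
  open Krawtchouk K

  χ-permute : ∀ (g : Permutation′ n) w x → χ (permute g w) (permute g x) ≡ χ w x
  χ-permute g w x = χ-cong {a = permute g w} {permute g x} {w} {x} (permute-reflect g) (permute-mono g)

  sample : (f : Subset n → Carrier) → ∀ x → f x ≈ ∑ λ y → χ x y * ([ ∣ y ∣ ℕ.≟ ∣ x ∣ ]* f y)
  sample f x = sym (trans
    (∑-χ-eq x (λ y → [ ∣ y ∣ ℕ.≟ ∣ x ∣ ]* f y) λ y → []*-false (∣ y ∣ ℕ.≟ ∣ x ∣))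
    ([]*-true (∣ x ∣ ℕ.≟ ∣ x ∣) ≡.refl))

  -- `∑` runs through the points in a fixed order, so reindexing is not immediate. `sample` writes a
  -- value of `f` as a sum against the identity matrix of a layer; after exchanging the sums, each
  -- `y` is met exactly once, at its preimage under `g`.
  ∑-permute : ∀ (g : Permutation′ n) f → ∑ (λ x → f (permute g x)) ≈ ∑ f
  ∑-permute g f = begin
    ∑ (λ x → f (permute g x))
      ≈⟨ ∑-cong (λ x → sample f (permute g x)) ⟩
    ∑ (λ x → ∑ λ y → χ (permute g x) y * ([ ∣ y ∣ ℕ.≟ ∣ permute g x ∣ ]* f y))
      ≈⟨ ∑-swap (λ x y → χ (permute g x) y * ([ ∣ y ∣ ℕ.≟ ∣ permute g x ∣ ]* f y)) ⟩
    ∑ (λ y → ∑ λ x → χ (permute g x) y * ([ ∣ y ∣ ℕ.≟ ∣ permute g x ∣ ]* f y))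
      ≈⟨ ∑-cong (λ y → trans (∑-cong (transfer y)) (∑-*ˡ (f y) (λ x → χ (back y) x * ([ ∣ x ∣ ℕ.≟ ∣ back y ∣ ]* 1#)))) ⟩
    ∑ (λ y → f y * ∑ λ x → χ (back y) x * ([ ∣ x ∣ ℕ.≟ ∣ back y ∣ ]* 1#))
      ≈⟨ ∑-cong (λ y → trans (*-congˡ (sym (sample (λ _ → 1#) (back y)))) (*-identityʳ (f y))) ⟩
    ∑ f ∎
    where
    back = permute (Perm.flip g)

    ∣back∣ : ∀ y → ∣ back y ∣ ≡ ∣ y ∣
    ∣back∣ = ∣permute∣ (Perm.flip g)

    transfer : ∀ y x → χ (permute g x) y * ([ ∣ y ∣ ℕ.≟ ∣ permute g x ∣ ]* f y) ≈
                       f y * (χ (back y) x * ([ ∣ x ∣ ℕ.≟ ∣ back y ∣ ]* 1#))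
    transfer y x rewrite ∣permute∣ g x | ∣back∣ y with ∣ y ∣ ℕ.≟ ∣ x ∣
    ... | no ne = begin
      χ (permute g x) y * ([ ∣ y ∣ ℕ.≟ ∣ x ∣ ]* f y)    ≈⟨ *-congˡ ([]*-false (∣ y ∣ ℕ.≟ ∣ x ∣) ne) ⟩
      χ (permute g x) y * 0#                            ≈⟨ zeroʳ _ ⟩
      0#                                                ≈⟨ *0-zero (zeroʳ _) ⟨
      f y * (χ (back y) x * 0#)                         ≈⟨ *-congˡ (*-congˡ ([]*-false (∣ x ∣ ℕ.≟ ∣ y ∣) (ne ∘ ≡.sym))) ⟨
      f y * (χ (back y) x * ([ ∣ x ∣ ℕ.≟ ∣ y ∣ ]* 1#))  ∎
    ... | yes e = begin
      χ (permute g x) y * ([ ∣ y ∣ ℕ.≟ ∣ x ∣ ]* f y)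
        ≈⟨ *-congˡ ([]*-true (∣ y ∣ ℕ.≟ ∣ x ∣) e) ⟩
      χ (permute g x) y * f y
        ≡⟨ ≡.cong (λ v → χ (permute g x) v * f y) (permute-flip g y) ⟨
      χ (permute g x) (permute g (back y)) * f y
        ≡⟨ ≡.cong (_* f y) (χ-permute g x (back y)) ⟩
      χ x (back y) * f y
        ≡⟨ ≡.cong (_* f y) (χ-sym x (back y) (≡.trans (≡.sym e) (≡.sym (∣back∣ y)))) ⟩
      χ (back y) x * f y
        ≈⟨ solve 2 (λ a b → a :* b := b :* (a :* con 1ℤ)) refl _ _ ⟩
      f y * (χ (back y) x * 1#)
        ≈⟨ *-congˡ (*-congˡ ([]*-true (∣ x ∣ ℕ.≟ ∣ y ∣) (≡.sym e))) ⟨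
      f y * (χ (back y) x * ([ ∣ x ∣ ℕ.≟ ∣ y ∣ ]* 1#)) ∎

  bit : Subset n → Fin n → Carrier
  bit x ω = if lookup x ω then 1# else 0#

  χ-range : (f : Fin s → Fin n) → ∀ x → χ (range f) x ≈ ∏ λ i → bit x (f i)
  χ-range f x with range f ⊆? x
  ... | yes p = sym (ones _ λ i → reflexive (≡.cong (if_then 1# else 0#) (⊆⇒lookup p (f i) (lookup-range f i))))
    where
    ones : ∀ {k} (h : Fin k → Carrier) → (∀ i → h i ≈ 1#) → ∏ h ≈ 1#
    ones = SingleTermSum.sum-zero *-commutativeMonoid
  ... | no ¬p with Fin.¬∀⟶∃¬ _ (λ i → lookup x (f i) ≡ inside) (λ i → lookup x (f i) Bool.≟ inside)
                               (λ h → ¬p (range-⊆ f h))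
  ...   | i , ne = sym (zero-factor _ i (reflexive (≡.cong (if_then 1# else 0#) (Bool.¬-not ne))))
    where
    zero-factor : ∀ {k} (h : Fin k → Carrier) i → h i ≈ 0# → ∏ h ≈ 0#
    zero-factor h zero    z = 0*-zero z
    zero-factor h (suc i) z = *0-zero (zero-factor (h ∘ suc) i z)

  ∏-negate : ∀ {k} (f g : Fin k → Carrier) i → f i ≈ - g i → (∀ j → j ≢ i → f j ≈ g j) → ∏ f ≈ - ∏ g
  ∏-negate f g zero    e h = trans (*-cong e (∏-cong λ j → h (suc j) λ ())) (sym (-‿distribˡ-* _ _))
  ∏-negate f g (suc i) e h = trans
    (*-cong (h zero λ ()) (∏-negate (f ∘ suc) (g ∘ suc) i e λ j ne → h (suc j) (ne ∘ Fin.suc-injective)))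
    (sym (-‿distribʳ-* _ _))

  pick : (l u : Fin s → Fin n) → Subset s → Fin s → Fin n
  pick l u I i = if lookup I i then u i else l i

  column-product : (l u : Fin s → Fin n) → Subset n → Carrier
  column-product l u x = ∏ λ i → bit x (l i) - bit x (u i)

  -- The polytabloid with columns `l i`, `u i`. `range` and `pick` repeat `image` and `exchanged`
  -- term for term, so only the summation operator distinguishes it from `polytabloid`.
  column-antisymmetrizer : (l u : Fin s → Fin n) → Subset n → Carrier
  column-antisymmetrizer l u x = ∑ λ I → sign ∣ I ∣ * [ ≡-dec Bool._≟_ (range (pick l u I)) x ]

  opaque
    unfolding ∑

    ∑-pick : (l u : Fin s → Fin n) → ∀ x →
      ∑ (λ I → sign ∣ I ∣ * ∏ λ i → bit x (pick l u I i)) ≈ column-product l u x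
    ∑-pick {zero}  l u x = *-identityˡ _
    ∑-pick {suc s} l u x = begin
      ∑ {s} (λ I → sign ∣ I ∣ * (bit x (l zero) * rest I)) +
      ∑ {s} (λ I → - 1# * sign ∣ I ∣ * (bit x (u zero) * rest I))
        ≈⟨ +-cong (trans (∑-cong {s} λ I → solve 3 (λ a b c → a :* (b :* c) := b :* (a :* c)) refl (sign ∣ I ∣) (bit x (l zero)) (rest I))
                         (∑-*ˡ {s} (bit x (l zero)) (λ I → sign ∣ I ∣ * rest I)))
                  (trans (∑-cong {s} λ I → solve 3 (λ a b c → :- con 1ℤ :* a :* (b :* c) := :- b :* (a :* c)) refl (sign ∣ I ∣) (bit x (u zero)) (rest I))
                         (∑-*ˡ {s} (- bit x (u zero)) (λ I → sign ∣ I ∣ * rest I))) ⟩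
      bit x (l zero) * ∑ {s} (λ I → sign ∣ I ∣ * rest I) + - bit x (u zero) * ∑ {s} (λ I → sign ∣ I ∣ * rest I)
        ≈⟨ sym (distribʳ _ _ _) ⟩
      (bit x (l zero) - bit x (u zero)) * ∑ {s} (λ I → sign ∣ I ∣ * rest I)
        ≈⟨ *-congˡ (∑-pick (l ∘ suc) (u ∘ suc) x) ⟩
      column-product l u x ∎
      where
      rest : Subset s → Carrier
      rest I = ∏ λ i → bit x (pick (l ∘ suc) (u ∘ suc) I i)

  ∑-δ : (w : Subset n) (f : Subset n → Carrier) → ∑ (λ y → f y * [ ≡-dec Bool._≟_ w y ]) ≈ f w
  ∑-δ w f = begin
    ∑ (λ y → f y * [ ≡-dec Bool._≟_ w y ])                ≈⟨ ∑-cong transfer ⟩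
    ∑ (λ y → χ w y * ([ ∣ y ∣ ℕ.≟ ∣ w ∣ ]* f y))          ≈⟨ sample f w ⟨
    f w                                                   ∎
    where
    transfer : ∀ y → f y * [ ≡-dec Bool._≟_ w y ] ≈ χ w y * ([ ∣ y ∣ ℕ.≟ ∣ w ∣ ]* f y)
    transfer y with ≡-dec Bool._≟_ w y | w ⊆? y
    ... | yes ≡.refl | yes _ = trans (*-comm _ _) (*-congˡ (sym ([]*-true (∣ w ∣ ℕ.≟ ∣ w ∣) ≡.refl)))
    ... | yes ≡.refl | no ¬p = ⊥-elim (¬p λ i → i)
    ... | no ne | yes p = trans (zeroʳ _) (sym (*0-zero ([]*-false (∣ y ∣ ℕ.≟ ∣ w ∣)
                            λ e → ne (p⊆q∧∣p∣≡∣q∣⇒p≡q w y p (≡.sym e)))))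
    ... | no _  | no _  = trans (zeroʳ _) (sym (zeroˡ _))

  -- `Up` turns the point mass at a set into the monomial in the points of that set, and the signed
  -- sum of these monomials factors column by column.
  Up-antisymmetrizer : (l u : Fin s → Fin n) → ∀ x →
    Up (column-antisymmetrizer l u) x ≈ column-product l u x
  Up-antisymmetrizer l u x = begin
    ∑ (λ y → χ y x * ∑ λ I → sign ∣ I ∣ * [ ≡-dec Bool._≟_ (range (pick l u I)) y ])
      ≈⟨ ∑-cong (λ y → sym (∑-*ˡ (χ y x) (λ I → sign ∣ I ∣ * [ ≡-dec Bool._≟_ (range (pick l u I)) y ]))) ⟩
    ∑ (λ y → ∑ λ I → χ y x * (sign ∣ I ∣ * [ ≡-dec Bool._≟_ (range (pick l u I)) y ]))
      ≈⟨ ∑-swap (λ y I → χ y x * (sign ∣ I ∣ * [ ≡-dec Bool._≟_ (range (pick l u I)) y ])) ⟩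
    ∑ (λ I → ∑ λ y → χ y x * (sign ∣ I ∣ * [ ≡-dec Bool._≟_ (range (pick l u I)) y ]))
      ≈⟨ ∑-cong (λ I → trans
           (∑-cong λ y → solve 3 (λ a b c → a :* (b :* c) := b :* (a :* c)) refl
                         (χ y x) (sign ∣ I ∣) [ ≡-dec Bool._≟_ (range (pick l u I)) y ])
           (trans (∑-*ˡ (sign ∣ I ∣) (λ y → χ y x * [ ≡-dec Bool._≟_ (range (pick l u I)) y ]))
                  (*-congˡ (trans (∑-δ (range (pick l u I)) (λ y → χ y x)) (χ-range (pick l u I) x))))) ⟩
    ∑ (λ I → sign ∣ I ∣ * ∏ λ i → bit x (pick l u I i))
      ≈⟨ ∑-pick l u x ⟩
    column-product l u x ∎

  module Columns (l u : Fin s → Fin n)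
    (l-injective : ∀ {i j} → l i ≡ l j → i ≡ j) (u-injective : ∀ {i j} → u i ≡ u j → i ≡ j)
    (l≢u : ∀ i j → l i ≢ u j) where

    swap : Fin s → Permutation′ n
    swap i = transpose (u i) (l i)

    Antisymmetric : (Subset n → Carrier) → Set
    Antisymmetric φ = ∀ i x → φ (permute (swap i) x) ≈ - φ x

    pick-injective : ∀ I {i j} → pick l u I i ≡ pick l u I j → i ≡ j
    pick-injective I {i} {j} e with lookup I i | lookup I j
    ... | true  | true  = u-injective e
    ... | true  | false = contradiction (≡.sym e) (l≢u j i)
    ... | false | true  = contradiction e (l≢u i j)
    ... | false | false = l-injective e

    antisymmetrizer-supported : ∀ x → ∣ x ∣ ≢ s → column-antisymmetrizer l u x ≈ 0#
    antisymmetrizer-supported x ne = ∑-zero _ λ I → term I (≡-dec Bool._≟_ (range (pick l u I)) x)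
      where
      term : ∀ I (d : Dec (range (pick l u I) ≡ x)) → sign ∣ I ∣ * [ d ] ≈ 0#
      term I (yes ≡.refl) = contradiction (∣range∣ (pick l u I) (pick-injective I)) ne
      term I (no _)       = zeroʳ _

    antisymmetrizer-product : ∀ x → ∣ x ∣ ≡ s → column-antisymmetrizer l u x ≈ column-product l u x
    antisymmetrizer-product x ≡.refl = trans
      (sym (Up-same-size (column-antisymmetrizer l u) x antisymmetrizer-supported))
      (Up-antisymmetrizer l u x)

    product-antisymmetric : Antisymmetric (column-product l u)
    product-antisymmetric i x = ∏-negate _ _ i
      (trans (+-cong (bit-cong (lookup-transposeʳ (u i) (l i) x))
                     (-‿cong (bit-cong (lookup-transposeˡ (u i) (l i) x))))
             (solve 2 (λ a b → a :- b := :- (b :- a)) refl _ _))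
      λ j ne → +-cong
        (bit-cong (lookup-transpose-other (u i) (l i) x (l≢u j i) (ne ∘ l-injective)))
        (-‿cong (bit-cong (lookup-transpose-other (u i) (l i) x (ne ∘ u-injective) (l≢u i j ∘ ≡.sym))))
      where
      bit-cong : ∀ {b c} → b ≡ c → (if b then 1# else 0#) ≈ (if c then 1# else 0#)
      bit-cong e = reflexive (≡.cong (if_then 1# else 0#) e)

    antisymmetrizer-antisymmetric : Antisymmetric (column-antisymmetrizer l u)
    antisymmetrizer-antisymmetric i x with ∣ x ∣ ℕ.≟ s
    ... | yes e = trans (antisymmetrizer-product _ (≡.trans (∣permute∣ (swap i) x) e))
      (trans (product-antisymmetric i x) (-‿cong (sym (antisymmetrizer-product x e))))
    ... | no ne = trans (antisymmetrizer-supported _ (ne ∘ ≡.trans (≡.sym (∣permute∣ (swap i) x))))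
      (sym (trans (-‿cong (antisymmetrizer-supported x ne)) (solve 0 (:- con 0ℤ := con 0ℤ) refl)))

    antisymmetrizer-base : column-antisymmetrizer l u (range l) ≈ 1#
    antisymmetrizer-base = trans (antisymmetrizer-product (range l) (∣range∣ l l-injective))
      (SingleTermSum.sum-zero *-commutativeMonoid _ λ i → trans
        (+-cong (reflexive (≡.cong (if_then 1# else 0#) (lookup-range l i)))
                (-‿cong (reflexive (≡.cong (if_then 1# else 0#)
                  (lookup-range-outside l (u i) λ j → l≢u j i)))))
        (solve 0 (con 1ℤ :- con 0ℤ := con 1ℤ) refl))

    module _ (2-torsion-free : ∀ {a} → a ≈ - a → a ≈ 0#) where

      -- x is moved into base by exchanging, column by column, u i ∈ x for l i ∉ x; a
      -- column met in 0 or 2 points forces φ x = - φ x.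
      antisymmetric-zero : ∀ {φ} → Antisymmetric φ → (∀ x → range l ⊆ x → φ x ≈ 0#) → ∀ x → φ x ≈ 0#
      antisymmetric-zero {φ} anti base x = below s x λ i le → contradiction (Fin.toℕ<n i) (ℕ.≤⇒≯ le)
        where
        below : ∀ k x → (∀ i → k ≤ toℕ i → lookup x (l i) ≡ inside) → φ x ≈ 0#
        below zero    x h = base x (range-⊆ l λ i → h i z≤n)
        below (suc k) x h with k ℕ.<? s
        ... | no k≮s = below k x λ i k≤i → contradiction (ℕ.≤-<-trans k≤i (Fin.toℕ<n i)) k≮s
        ... | yes k<s = cases (lookup x (l i)) (lookup x (u i)) ≡.refl ≡.refl
          where
          i = fromℕ< k<s
          extend : ∀ y → (∀ j → k < toℕ j → lookup y (l j) ≡ inside) → lookup y (l i) ≡ inside →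
                   ∀ j → k ≤ toℕ j → lookup y (l j) ≡ inside
          extend y h e j k≤j with ℕ.m≤n⇒m<n∨m≡n k≤j
          ... | inj₁ k<j = h j k<j
          ... | inj₂ k≡j = ≡.subst (λ j → lookup y (l j) ≡ inside)
                (Fin.toℕ-injective (≡.trans (Fin.toℕ-fromℕ< k<s) k≡j)) e
          cases : ∀ b c → lookup x (l i) ≡ b → lookup x (u i) ≡ c → φ x ≈ 0#
          cases true  _     e _  = below k x (extend x h e)
          cases false false e e′ = 2-torsion-free (trans
            (reflexive (≡.cong φ (≡.sym (transpose-fixes (u i) (l i) x (≡.trans e′ (≡.sym e)))))) (anti i x))
          cases false true  e e′ = begin
            φ x                          ≈⟨ solve 1 (λ a → a := :- (:- a)) refl _ ⟩
            - - φ x                      ≈⟨ -‿cong (anti i x) ⟨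
            - φ (permute (swap i) x)     ≈⟨ -‿cong (below k (permute (swap i) x) (extend (permute (swap i) x)
                  (λ j k<j → ≡.trans (lookup-transpose-other (u i) (l i) x (l≢u j i)
                      λ lj≡li → ℕ.<⇒≢ k<j (≡.trans (≡.sym (Fin.toℕ-fromℕ< k<s)) (≡.cong toℕ (≡.sym (l-injective lj≡li)))))
                    (h j k<j))
                  (≡.trans (lookup-transposeʳ (u i) (l i) x) e′))) ⟩
            - 0#                         ≈⟨ solve 0 (:- con 0ℤ := con 0ℤ) refl ⟩
            0#                           ∎

      -- Antisymmetric functions on X_s form a line. The difference of the two sides vanishes at
      -- `range l`, the only superset of `range l` of size s, and `antisymmetric-zero` spreads this
      -- to all sets.
      antisymmetric-unique : ∀ {ψ} → Antisymmetric ψ → (∀ x → ∣ x ∣ ≢ s → ψ x ≈ 0#) →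
        ∀ x → ψ x ≈ ψ (range l) * column-antisymmetrizer l u x
      antisymmetric-unique {ψ} anti supp x = x∙y⁻¹≈ε⇒x≈y _ _ (antisymmetric-zero
        (λ i y → trans (+-cong (anti i y) (-‿cong (*-congˡ (antisymmetrizer-antisymmetric i y))))
          (solve 3 (λ a b c → :- a :- b :* :- c := :- (a :- b :* c)) refl _ _ _))
        base x)
        where
        base : ∀ y → range l ⊆ y → ψ y - ψ (range l) * column-antisymmetrizer l u y ≈ 0#
        base y p with ∣ y ∣ ℕ.≟ s
        ... | no ne = trans
          (+-cong (supp y ne) (-‿cong (*-congˡ (antisymmetrizer-supported y ne))))
          (solve 1 (λ a → con 0ℤ :- a :* con 0ℤ := con 0ℤ) refl _)
        ... | yes e = trans
          (+-congˡ (-‿cong (*-cong (reflexive (≡.cong ψ range≡y))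
            (trans (reflexive (≡.cong (column-antisymmetrizer l u) (≡.sym range≡y))) antisymmetrizer-base))))
          (solve 1 (λ a → a :- a :* con 1ℤ := con 0ℤ) refl _)
          where
          range≡y : range l ≡ y
          range≡y = p⊆q∧∣p∣≡∣q∣⇒p≡q (range l) y p (≡.trans (∣range∣ l l-injective) (≡.sym e))

      -- The defect in `down` is itself antisymmetric in `w`. On supersets of `range l`, which have
      -- at least s points, it vanishes for reasons of size; `antisymmetric-zero` carries this over
      -- to the smaller sets, where harmonicity has its content.
      antisymmetric-harmonic : ∀ {ψ} → Antisymmetric ψ → (∀ x → ∣ x ∣ ≢ s → ψ x ≈ 0#) → Harmonic s ψ
      antisymmetric-harmonic {ψ} anti supp = record
        { supported = supp
        ; down = λ w → x∙y⁻¹≈ε⇒x≈y _ _ (antisymmetric-zero antisymmetric base w)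
        }
        where
        antisymmetric : Antisymmetric (λ w → ∑ (λ y → χ w y * ψ y) - ψ w)
        antisymmetric i w = begin
          ∑ (λ y → χ (permute g w) y * ψ y) - ψ (permute g w)
            ≈⟨ +-cong (sym (∑-permute g (λ y → χ (permute g w) y * ψ y))) (-‿cong (anti i w)) ⟩
          ∑ (λ y → χ (permute g w) (permute g y) * ψ (permute g y)) - - ψ w
            ≈⟨ +-congʳ (∑-cong λ y → trans
                 (*-cong (reflexive (χ-permute g w y)) (anti i y))
                 (solve 2 (λ a b → a :* :- b := :- con 1ℤ :* (a :* b)) refl _ _)) ⟩
          ∑ (λ y → - 1# * (χ w y * ψ y)) - - ψ w
            ≈⟨ +-congʳ (∑-*ˡ (- 1#) (λ y → χ w y * ψ y)) ⟩
          - 1# * ∑ (λ y → χ w y * ψ y) - - ψ w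
            ≈⟨ solve 2 (λ a b → :- con 1ℤ :* a :- :- b := :- (a :- b)) refl _ _ ⟩
          - (∑ (λ y → χ w y * ψ y) - ψ w) ∎
          where g = swap i

        base : ∀ w → range l ⊆ w → ∑ (λ y → χ w y * ψ y) - ψ w ≈ 0#
        base w p with ∣ w ∣ ℕ.≟ s
        ... | yes ≡.refl = trans (+-congʳ (∑-χ-eq w ψ supp)) (-‿inverseʳ _)
        ... | no ne = trans (+-cong (∑-zero _ term) (-‿cong (supp w ne))) (-‿inverseʳ 0#)
          where
          s<∣w∣ : s < ∣ w ∣
          s<∣w∣ = ℕ.≤∧≢⇒< (ℕ.≤-trans (ℕ.≤-reflexive (≡.sym (∣range∣ l l-injective))) (p⊆q⇒∣p∣≤∣q∣ p)) (ne ∘ ≡.sym)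
          term : ∀ y → χ w y * ψ y ≈ 0#
          term y with ∣ y ∣ ℕ.≟ s
          ... | yes ≡.refl = 0*-zero (χ-zero w y s<∣w∣)
          ... | no ne′ = *0-zero (supp y ne′)

-- Lists of pairwise distinct points and pairs

module Pairs where

  flatten : {A : Set} → List (A × A) → List A
  flatten []            = []
  flatten ((a , b) ∷ I) = a ∷ b ∷ flatten I

  length-flatten : {A : Set} (I : List (A × A)) → length (flatten I) ≡ length I ℕ.+ length I
  length-flatten []            = ≡.refl
  length-flatten ((a , b) ∷ I) = ≡.cong suc (≡.trans (≡.cong suc (length-flatten I)) (≡.sym (ℕ.+-suc _ _)))

  first second : {A : Set} (I : List (A × A)) → Fin (length I) → A
  first  I i = proj₁ (List.lookup I i)
  second I i = proj₂ (List.lookup I i)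

  first-∈ : {A : Set} (I : List (A × A)) → ∀ i → first I i ∈ˡ flatten I
  first-∈ (_ ∷ I) zero    = here ≡.refl
  first-∈ (_ ∷ I) (suc i) = there (there (first-∈ I i))

  second-∈ : {A : Set} (I : List (A × A)) → ∀ i → second I i ∈ˡ flatten I
  second-∈ (_ ∷ I) zero    = there (here ≡.refl)
  second-∈ (_ ∷ I) (suc i) = there (there (second-∈ I i))

  first-injective : {A : Set} (I : List (A × A)) → Unique (flatten I) → ∀ {i j} → first I i ≡ first I j → i ≡ j
  first-injective (_ ∷ I) _ {zero}  {zero}  e = ≡.refl
  first-injective (_ ∷ I) ((_ ∷ h) ∷ _) {zero}  {suc j} e = contradiction e (All.lookup h (first-∈ I j))
  first-injective (_ ∷ I) ((_ ∷ h) ∷ _) {suc i} {zero}  e = contradiction (≡.sym e) (All.lookup h (first-∈ I i))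
  first-injective (_ ∷ I) (_ ∷ (_ ∷ u)) {suc i} {suc j} e = ≡.cong suc (first-injective I u e)

  second-injective : {A : Set} (I : List (A × A)) → Unique (flatten I) → ∀ {i j} → second I i ≡ second I j → i ≡ j
  second-injective (_ ∷ I) _ {zero}  {zero}  e = ≡.refl
  second-injective (_ ∷ I) (_ ∷ (h ∷ _)) {zero}  {suc j} e = contradiction e (All.lookup h (second-∈ I j))
  second-injective (_ ∷ I) (_ ∷ (h ∷ _)) {suc i} {zero}  e = contradiction (≡.sym e) (All.lookup h (second-∈ I i))
  second-injective (_ ∷ I) (_ ∷ (_ ∷ u)) {suc i} {suc j} e = ≡.cong suc (second-injective I u e)

  first≢second : {A : Set} (I : List (A × A)) → Unique (flatten I) → ∀ i j → first I i ≢ second I j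
  first≢second (_ ∷ I) ((h ∷ _) ∷ _) zero    zero    = h
  first≢second (_ ∷ I) ((_ ∷ h) ∷ _) zero    (suc j) = All.lookup h (second-∈ I j)
  first≢second (_ ∷ I) (_ ∷ (h ∷ _)) (suc i) zero    = λ e → All.lookup h (first-∈ I i) (≡.sym e)
  first≢second (_ ∷ I) (_ ∷ (_ ∷ u)) (suc i) (suc j) = first≢second I u i j

  elements : Subset m → List (Fin m)
  elements []            = []
  elements (outside ∷ w) = map suc (elements w)
  elements (inside ∷ w)  = zero ∷ map suc (elements w)

  length-elements : (w : Subset m) → length (elements w) ≡ ∣ w ∣
  length-elements []            = ≡.refl
  length-elements (outside ∷ w) = ≡.trans (length-map suc (elements w)) (length-elements w)
  length-elements (inside ∷ w)  = ≡.cong suc (≡.trans (length-map suc (elements w)) (length-elements w))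

  elements-unique : (w : Subset m) → Unique (elements w)
  elements-unique []            = []
  elements-unique (outside ∷ w) = Unique.map⁺ Fin.suc-injective (elements-unique w)
  elements-unique (inside ∷ w)  =
    All.map⁺ (All.universal (λ _ ()) (elements w)) ∷ Unique.map⁺ Fin.suc-injective (elements-unique w)

open Pairs

-- Products of differences span all functions

module Spanning (K : CommutativeRing 0ℓ 0ℓ) (n : ℕ) where
  open CommutativeRing K hiding (zero)
  open import Algebra.Properties.Semiring.Sum semiring using (sum; sum-cong-≋; *-distribʳ-sum; ∑-distrib-+)
  open import Algebra.Properties.Semiring.Mult semiring using (×-homo-+)
  open import Relation.Binary.Reasoning.Setoid setoid
  open MonoidSum *-commutativeMonoid using () renaming (sum to ∏)
  open SingleTermSum +-commutativeMonoid
  open IntegerSolver K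
  open HarmonicFunctions K
  open FiniteDifferences K
  open Krawtchouk K
  open Antisymmetry K
  open DecMembership (Fin._≟_ {n}) using (_∉?_)

  monomial : List (Fin m) → Subset m → Carrier
  monomial []      x = 1#
  monomial (a ∷ c) x = bit x a * monomial c x

  differences : List (Fin m × Fin m) → Subset m → Carrier
  differences []            x = 1#
  differences ((a , b) ∷ I) x = (bit x a - bit x b) * differences I x

  differences-columns : (I : List (Fin m × Fin m)) → ∀ x → column-product (first I) (second I) x ≈ differences I x
  differences-columns []      x = refl
  differences-columns (_ ∷ I) x = *-congˡ (differences-columns I x)

  monomial-suc : ∀ c b (x : Subset m) → monomial (map suc c) (b ∷ x) ≈ monomial c x
  monomial-suc []      b x = refl
  monomial-suc (_ ∷ c) b x = *-congˡ (monomial-suc c b x)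

  χ-monomial : (w x : Subset m) → χ w x ≈ monomial (elements w) x
  χ-monomial []            []            = refl
  χ-monomial (outside ∷ w) (b ∷ x)       = trans (χ-monomial w x) (sym (monomial-suc (elements w) b x))
  χ-monomial (inside ∷ w)  (inside ∷ x)  = trans (χ-monomial w x)
    (sym (trans (*-identityˡ _) (monomial-suc (elements w) inside x)))
  χ-monomial (inside ∷ w)  (outside ∷ x) = sym (zeroˡ _)

  total : {A : Set} → (A → Carrier) → List A → Carrier
  total h []      = 0#
  total h (a ∷ L) = h a + total h L

  sum-outside : ∀ {L} → Unique L → (h : Fin n → Carrier) →
    sum (λ a → [ a ∉? L ]* h a) + total h L ≈ sum h
  sum-outside [] h = +-identityʳ _
  sum-outside {b ∷ L} (b∉L ∷ u) h = begin
    sum (λ a → [ a ∉? (b ∷ L) ]* h a) + (h b + total h L)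
      ≈⟨ +-assoc _ _ _ ⟨
    sum (λ a → [ a ∉? (b ∷ L) ]* h a) + h b + total h L
      ≈⟨ +-congʳ (+-congˡ (sym (trans
           (sum-single (λ a → [ a Fin.≟ b ]* h a) b λ a ne → []*-false (a Fin.≟ b) ne)
           ([]*-true (b Fin.≟ b) ≡.refl)))) ⟩
    sum (λ a → [ a ∉? (b ∷ L) ]* h a) + sum (λ a → [ a Fin.≟ b ]* h a) + total h L
      ≈⟨ +-congʳ (sym (∑-distrib-+ (λ a → [ a ∉? (b ∷ L) ]* h a) (λ a → [ a Fin.≟ b ]* h a))) ⟩
    sum (λ a → [ a ∉? (b ∷ L) ]* h a + [ a Fin.≟ b ]* h a) + total h L
      ≈⟨ +-congʳ (sum-cong-≋ pointwise) ⟩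
    sum (λ a → [ a ∉? L ]* h a) + total h L
      ≈⟨ sum-outside u h ⟩
    sum h ∎
    where
    pointwise : ∀ a → [ a ∉? (b ∷ L) ]* h a + [ a Fin.≟ b ]* h a ≈ [ a ∉? L ]* h a
    pointwise a = cases (a Fin.≟ b)
      where
      cases : Dec (a ≡ b) → [ a ∉? (b ∷ L) ]* h a + [ a Fin.≟ b ]* h a ≈ [ a ∉? L ]* h a
      cases (yes ≡.refl) = trans
        (+-cong ([]*-false (a ∉? (a ∷ L)) λ ni → ni (here ≡.refl)) ([]*-true (a Fin.≟ a) ≡.refl))
        (trans (+-identityˡ _) (sym ([]*-true (a ∉? L) λ i → All.lookup b∉L i ≡.refl)))
      cases (no a≢b) = trans (+-congˡ ([]*-false (a Fin.≟ b) a≢b)) (trans (+-identityʳ _) (tail (a ∉? L)))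
        where
        tail : (d : Dec (a ∉ˡ L)) → [ a ∉? (b ∷ L) ]* h a ≈ [ d ]* h a
        tail (yes ni) = []*-true (a ∉? (b ∷ L)) λ { (here e) → a≢b e ; (there i) → ni i }
        tail (no ¬ni) = []*-false (a ∉? (b ∷ L)) λ ni → ¬ni λ i → ni (there i)

  sum-bits : (x : Subset m) → sum (bit x) ≈ ι ∣ x ∣
  sum-bits []            = refl
  sum-bits (outside ∷ x) = trans (+-identityˡ _) (sum-bits x)
  sum-bits (inside ∷ x)  = +-congˡ (sum-bits x)

  bit-idem : ∀ (x : Subset m) a → bit x a * bit x a ≈ bit x a
  bit-idem x a with lookup x a
  ... | true  = *-identityˡ 1#
  ... | false = zeroˡ 0#

  total-++ : {A : Set} (h : A → Carrier) → ∀ L M → total h (L ++ M) ≈ total h L + total h M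
  total-++ h []      M = sym (+-identityˡ _)
  total-++ h (a ∷ L) M = trans (+-congˡ (total-++ h L M)) (sym (+-assoc _ _ _))

  total-1 : {A : Set} (L : List A) → total (λ _ → 1#) L ≈ ι (length L)
  total-1 []      = refl
  total-1 (_ ∷ L) = +-congˡ (total-1 L)

  total-monomial : ∀ c (x : Subset m) → total (bit x) c * monomial c x ≈ ι (length c) * monomial c x
  total-monomial []      x = refl
  total-monomial (a ∷ c) x = begin
    (bit x a + total (bit x) c) * (bit x a * monomial c x)
      ≈⟨ solve 3 (λ b t p → (b :+ t) :* (b :* p) := (b :* b) :* p :+ b :* (t :* p)) refl _ _ _ ⟩
    bit x a * bit x a * monomial c x + bit x a * (total (bit x) c * monomial c x)
      ≈⟨ +-cong (*-congʳ (bit-idem x a)) (*-congˡ (total-monomial c x)) ⟩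
    bit x a * monomial c x + bit x a * (ι (length c) * monomial c x)
      ≈⟨ solve 3 (λ b i p → b :* p :+ b :* (i :* p) := (con 1ℤ :+ i) :* (b :* p)) refl _ _ _ ⟩
    ι (suc (length c)) * (bit x a * monomial c x) ∎

  -- For bits, (x_a + x_b)(x_a - x_b) = x_a - x_b: wherever the product is nonzero, each pair has
  -- exactly one of its points in `x`.
  total-differences : ∀ I (x : Subset m) →
    total (bit x) (flatten I) * differences I x ≈ ι (length I) * differences I x
  total-differences []            x = refl
  total-differences ((a , b) ∷ I) x = begin
    (bit x a + (bit x b + total (bit x) (flatten I))) * ((bit x a - bit x b) * differences I x)
      ≈⟨ solve 4 (λ a b t p → (a :+ (b :+ t)) :* ((a :- b) :* p)
                           := (a :* a :- b :* b) :* p :+ (a :- b) :* (t :* p)) refl _ _ _ _ ⟩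
    (bit x a * bit x a - bit x b * bit x b) * differences I x
      + (bit x a - bit x b) * (total (bit x) (flatten I) * differences I x)
      ≈⟨ +-cong (*-congʳ (+-cong (bit-idem x a) (-‿cong (bit-idem x b)))) (*-congˡ (total-differences I x)) ⟩
    (bit x a - bit x b) * differences I x + (bit x a - bit x b) * (ι (length I) * differences I x)
      ≈⟨ solve 3 (λ b i p → b :* p :+ b :* (i :* p) := (con 1ℤ :+ i) :* (b :* p)) refl _ _ _ ⟩
    ι (suc (length I)) * ((bit x a - bit x b) * differences I x) ∎

  module _ (Mem : (Subset n → Carrier) → Set)
    (resp : ∀ {φ ψ} → (∀ x → φ x ≈ ψ x) → Mem φ → Mem ψ)
    (nil : Mem λ _ → 0#)
    (add : ∀ {φ ψ} → Mem φ → Mem ψ → Mem (λ x → φ x + ψ x))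
    (scale : ∀ c {ψ} → Mem ψ → Mem (λ x → c * ψ x))
    (inverse : ∀ k → ∃ λ y → y * ι (suc k) ≈ 1#)
    (columns : ∀ s → s ℕ.+ s ≤ n → (l u : Fin s → Fin n) →
      (∀ {i j} → l i ≡ l j → i ≡ j) → (∀ {i j} → u i ≡ u j → i ≡ j) → (∀ i j → l i ≢ u j) →
      ∀ r → Mem λ x → [ ∣ x ∣ ℕ.≟ r ] * column-product l u x)
    where

    private
      Mem-sum : ∀ {k} (F : Fin k → Subset n → Carrier) → (∀ i → Mem (F i)) → Mem λ x → sum λ i → F i x
      Mem-sum {zero}  F h = nil
      Mem-sum {suc k} F h = add (h zero) (Mem-sum (F ∘ suc) (h ∘ suc))

      opaque
        unfolding ∑

        Mem-∑ : ∀ {k} (F : Subset k → Subset n → Carrier) → (∀ y → Mem (F y)) → Mem λ x → ∑ λ y → F y x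
        Mem-∑ {zero}  F h = h []
        Mem-∑ {suc k} F h = add (Mem-∑ {k} (λ y → F (outside ∷ y)) λ y → h (outside ∷ y))
                                (Mem-∑ {k} (λ y → F (inside ∷ y)) λ y → h (inside ∷ y))

    module _ (r : ℕ) where
      private
        layer : Subset n → Carrier
        layer x = [ ∣ x ∣ ℕ.≟ r ]

        layer-ι : ∀ x → layer x * ι ∣ x ∣ ≈ layer x * ι r
        layer-ι x with ∣ x ∣ ℕ.≟ r
        ... | yes ≡.refl = refl
        ... | no ne = trans (*-congʳ z) (trans (zeroˡ _) (sym (0*-zero z)))
          where
          z : layer x ≈ 0#
          z = []*-false (∣ x ∣ ℕ.≟ r) ne

      -- For b ∷ c: if f is the function for c and I, and a ranges over the points outside both,
      -- ∑_a (x_b - x_a) f = N x_b f - (r - ∣ c ∣ - ∣ I ∣) f on this layer, where N counts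
      -- the a; so x_b f is reduced to products with a shorter monomial.
      mixed : ∀ c I → Unique c → Unique (flatten I) → Disjoint c (flatten I) →
        length c ℕ.+ length I ℕ.+ (length c ℕ.+ length I) ≤ n →
        Mem λ x → layer x * (monomial c x * differences I x)
      mixed [] I _ uI _ le = resp
        (λ x → *-congˡ (trans (differences-columns I x) (sym (*-identityˡ _))))
        (columns (length I) le (first I) (second I) (first-injective I uI) (second-injective I uI)
                 (first≢second I uI) r)
      mixed (b ∷ c) I (b∉c ∷ uc) uI disjoint le = resp (λ x → sym (identity x))
        (scale y (add (Mem-sum _ λ a → outer a (a ∉? L)) (scale (ι r - ι d) inner)))
        where
        L = c ++ flatten I
        d = length c ℕ.+ length I
        -- `suc k` is the number N of points outside `L`. The bound `le` ensures that it is
        -- positive, which makes division by it possible.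
        k = n ℕ.∸ suc (length L)

        c-disjoint : Disjoint c (flatten I)
        c-disjoint (i , j) = disjoint (there i , j)

        uL : Unique L
        uL = Unique.++⁺ uc uI c-disjoint

        b∉I : b ∉ˡ flatten I
        b∉I i = disjoint (here ≡.refl , i)

        inner : Mem λ x → layer x * (monomial c x * differences I x)
        inner = mixed c I uc uI c-disjoint
          (ℕ.≤-trans (ℕ.+-mono-≤ (ℕ.n≤1+n d) (ℕ.n≤1+n d)) le)

        outer : ∀ a (e : Dec (a ∉ˡ L)) →
          Mem λ x → [ e ]* (layer x * ((bit x b - bit x a) * (monomial c x * differences I x)))
        outer a (no _) = nil
        outer a (yes a∉L) with a Fin.≟ b
        -- `b` is itself one of the points outside `L`; its term contains x_b - x_b.
        ... | yes ≡.refl = resp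
          (λ x → solve 3 (λ e t f → con 0ℤ := e :* ((t :- t) :* f)) refl (layer x) (bit x b) _) nil
        ... | no a≢b = resp
          (λ x → solve 4 (λ e t p q → e :* (p :* (t :* q)) := e :* (t :* (p :* q))) refl (layer x) _ _ _)
          -- The factor x_b - x_a becomes a new pair: the monomial gets shorter while the total
          -- length in the bound stays the same.
          (mixed c ((b , a) ∷ I) uc
            (((a≢b ∘ ≡.sym) ∷ All.¬Any⇒All¬ _ b∉I) ∷ (All.¬Any⇒All¬ _ (a∉L ∘ ∈-++⁺ʳ c)) ∷ uI)
            (λ { (i , here ≡.refl) → All.lookup b∉c i ≡.refl
               ; (i , there (here ≡.refl)) → a∉L (∈-++⁺ˡ i)
               ; (i , there (there j)) → c-disjoint (i , j) })
            (ℕ.≤-trans (ℕ.≤-reflexive (≡.cong (λ k → k ℕ.+ k) (ℕ.+-suc (length c) (length I)))) le))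

        size : suc k ℕ.+ length L ≡ n
        size = ≡.trans (≡.sym (ℕ.+-suc k (length L))) (ℕ.m∸n+n≡m (ℕ.≤-trans (s≤s bound) le))
          where
          bound : length L ≤ length c ℕ.+ length I ℕ.+ suc (length c ℕ.+ length I)
          bound = ℕ.≤-trans (ℕ.≤-reflexive (≡.trans (length-++ c) (≡.trans
            (≡.cong (length c ℕ.+_) (length-flatten I)) (≡.sym (ℕ.+-assoc (length c) _ _)))))
            (ℕ.+-monoʳ-≤ d (ℕ.m≤n⇒m≤1+n (ℕ.m≤n+m (length I) (length c))))

        y = proj₁ (inverse k)

        count : y * sum (λ a → [ a ∉? L ]* 1#) ≈ 1#
        count = trans (*-congˡ (begin
          sum (λ a → [ a ∉? L ]* 1#)
            ≈⟨ solve 2 (λ s t → s := s :+ t :- t) refl _ _ ⟩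
          sum (λ a → [ a ∉? L ]* 1#) + total (λ _ → 1#) L - total (λ _ → 1#) L
            ≈⟨ +-cong (trans (sum-outside uL λ _ → 1#) (ones n)) (-‿cong (total-1 L)) ⟩
          ι n - ι (length L)
            ≈⟨ +-congʳ (trans (reflexive (≡.cong ι (≡.sym size))) (×-homo-+ 1# (suc k) (length L))) ⟩
          ι (suc k) + ι (length L) - ι (length L)
            ≈⟨ solve 2 (λ s t → s :+ t :- t := s) refl _ _ ⟩
          ι (suc k) ∎)) (proj₂ (inverse k))
          where
          ones : ∀ k → sum {k} (λ _ → 1#) ≈ ι k
          ones zero    = refl
          ones (suc k) = +-congˡ (ones k)

        identity : ∀ x → layer x * (bit x b * monomial c x * differences I x) ≈
          y * (sum (λ a → [ a ∉? L ]* (layer x * ((bit x b - bit x a) * (monomial c x * differences I x))))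
               + (ι r - ι d) * (layer x * (monomial c x * differences I x)))
        identity x = sym (begin
          y * (sum (λ a → [ a ∉? L ]* (layer x * ((bit x b - bit x a) * f))) + (ι r - ι d) * (layer x * f))
            ≈⟨ *-congˡ (+-congʳ (trans (sum-cong-≋ λ a → split a (a ∉? L)) (trans
                 (∑-distrib-+ (λ a → ([ a ∉? L ]* 1#) * (layer x * (bit x b * f)))
                              (λ a → ([ a ∉? L ]* bit x a) * - (layer x * f)))
                 (sym (+-cong (*-distribʳ-sum (layer x * (bit x b * f)) (λ a → [ a ∉? L ]* 1#))
                         (*-distribʳ-sum (- (layer x * f)) (λ a → [ a ∉? L ]* bit x a))))))) ⟩
          y * (S * (layer x * (bit x b * f)) + O * - (layer x * f) + (ι r - ι d) * (layer x * f))
            ≈⟨ solve 8 (λ y S g O e f R D → y :* (S :* g :+ O :* :- (e :* f) :+ (R :- D) :* (e :* f))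
                 := (y :* S) :* g :+ y :* (e :* R :* f :- e :* (O :* f) :- e :* (D :* f)))
                 refl y S (layer x * (bit x b * f)) O (layer x) f (ι r) (ι d) ⟩
          (y * S) * (layer x * (bit x b * f)) + y * (layer x * ι r * f - layer x * (O * f) - layer x * (ι d * f))
            ≈⟨ +-cong (trans (*-congʳ count) (*-identityˡ _))
                      (trans (*-congˡ (trans (+-cong (+-congʳ (*-congʳ (trans (sym (layer-ι x))
                                (*-congˡ (sym (trans (sum-outside uL (bit x)) (sum-bits x)))))))
                                (-‿cong (*-congˡ (sym inside-total))))
                         (solve 4 (λ e O t f → e :* (O :+ t) :* f :- e :* (O :* f) :- e :* (t :* f) := con 0ℤ)
                           refl (layer x) O (total (bit x) L) f))) (zeroʳ y)) ⟩
          layer x * (bit x b * f) + 0#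
            ≈⟨ solve 4 (λ e t p q → e :* (t :* (p :* q)) :+ con 0ℤ := e :* (t :* p :* q)) refl _ _ _ _ ⟩
          layer x * (bit x b * monomial c x * differences I x) ∎)
          where
          f = monomial c x * differences I x
          S = sum λ a → [ a ∉? L ]* 1#
          O = sum λ a → [ a ∉? L ]* bit x a

          split : ∀ a (e : Dec (a ∉ˡ L)) → [ e ]* (layer x * ((bit x b - bit x a) * f)) ≈
            ([ e ]* 1#) * (layer x * (bit x b * f)) + ([ e ]* bit x a) * - (layer x * f)
          split a (yes _) = solve 4 (λ e t u f → e :* ((t :- u) :* f) := con 1ℤ :* (e :* (t :* f)) :+ u :* :- (e :* f))
                                    refl (layer x) (bit x b) (bit x a) f
          split a (no _)  = solve 2 (λ g h → con 0ℤ := con 0ℤ :* g :+ con 0ℤ :* h) refl _ _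

          inside-total : total (bit x) L * f ≈ ι d * f
          inside-total = begin
            total (bit x) L * f
              ≈⟨ *-congʳ (total-++ (bit x) c (flatten I)) ⟩
            (total (bit x) c + total (bit x) (flatten I)) * (monomial c x * differences I x)
              ≈⟨ solve 4 (λ a b p q → (a :+ b) :* (p :* q) := (a :* p) :* q :+ p :* (b :* q)) refl _ _ _ _ ⟩
            (total (bit x) c * monomial c x) * differences I x
              + monomial c x * (total (bit x) (flatten I) * differences I x)
              ≈⟨ +-cong (*-congʳ (total-monomial c x)) (*-congˡ (total-differences I x)) ⟩
            (ι (length c) * monomial c x) * differences I x
              + monomial c x * (ι (length I) * differences I x)
              ≈⟨ solve 4 (λ a b p q → (a :* p) :* q :+ p :* (b :* q) := (a :+ b) :* (p :* q)) refl _ _ _ _ ⟩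
            (ι (length c) + ι (length I)) * f
              ≈⟨ *-congʳ (×-homo-+ 1# (length c) (length I)) ⟨
            ι d * f ∎

      small-sets : ∀ w → ∣ w ∣ ℕ.+ ∣ w ∣ ≤ n → Mem λ x → layer x * χ w x
      small-sets w le = resp
        (λ x → *-congˡ (trans (*-identityʳ _) (sym (χ-monomial w x))))
        (mixed (elements w) [] (elements-unique w) [] (λ ())
          (ℕ.≤-trans (ℕ.≤-reflexive (≡.cong (λ k → k ℕ.+ k)
            (≡.trans (ℕ.+-identityʳ _) (length-elements w)))) le))

    private
      -- A set with more than n/2 elements is expressed through its complement.
      point : ∀ y → Mem λ x → [ ∣ x ∣ ℕ.≟ ∣ y ∣ ] * χ x y
      point y with ∣ y ∣ ℕ.+ ∣ y ∣ ℕ.≤? n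
      ... | yes le = resp same (small-sets (∣ y ∣) y le)
        where
        same : ∀ x → [ ∣ x ∣ ℕ.≟ ∣ y ∣ ] * χ y x ≈ [ ∣ x ∣ ℕ.≟ ∣ y ∣ ] * χ x y
        same x = trans (sym ([]*-≈ (∣ x ∣ ℕ.≟ ∣ y ∣) _)) (trans
          ([]*-cong (∣ x ∣ ℕ.≟ ∣ y ∣) λ e → reflexive (χ-sym y x (≡.sym e)))
          ([]*-≈ (∣ x ∣ ℕ.≟ ∣ y ∣) _))
      ... | no gt = resp expand (Mem-∑ _ term)
        where
        c = ∁ y

        half : ∣ c ∣ ℕ.+ ∣ c ∣ ≤ n
        half = ℕ.≤-trans (ℕ.+-monoʳ-≤ ∣ c ∣ (ℕ.+-cancelʳ-≤ (∣ y ∣) (∣ c ∣) (∣ y ∣)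
          (ℕ.≤-trans (ℕ.≤-reflexive ∣c∣+∣y∣) (ℕ.<⇒≤ (ℕ.≰⇒> gt))))) (ℕ.≤-reflexive ∣c∣+∣y∣)
          where
          ∣c∣+∣y∣ : ∣ c ∣ ℕ.+ ∣ y ∣ ≡ n
          ∣c∣+∣y∣ = ≡.trans (≡.cong (ℕ._+ ∣ y ∣) (∣∁p∣≡n∸∣p∣ y)) (ℕ.m∸n+n≡m (∣p∣≤n y))

        F : Subset n → Subset n → Carrier
        F w x = χ w c * ∂^ (∣ w ∣) empty (∣ c ─ w ∣) 0 * ([ ∣ x ∣ ℕ.≟ ∣ y ∣ ] * χ w x)

        term : ∀ w → Mem (F w)
        term w with w ⊆? c
        ... | yes p = scale _ (small-sets (∣ y ∣) w
                (ℕ.≤-trans (ℕ.+-mono-≤ (p⊆q⇒∣p∣≤∣q∣ p) (p⊆q⇒∣p∣≤∣q∣ p)) half))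
        ... | no _  = resp (λ x → sym (0*-zero (zeroˡ _))) nil

        -- `x ⊆ y` means that `x` misses the complement `c`. Newton's formula for `empty` expands
        -- this over subsets `w` of `c`, and all of these have at most n/2 points.
        expand : ∀ x → ∑ (λ w → F w x) ≈ [ ∣ x ∣ ℕ.≟ ∣ y ∣ ] * χ x y
        expand x = begin
          ∑ (λ w → F w x)
            ≈⟨ ∑-cong (λ w → solve 4 (λ a b e d → a :* b :* (e :* d) := e :* (d :* (a :* b))) refl
                 (χ w c) (∂^ (∣ w ∣) empty (∣ c ─ w ∣) 0) [ ∣ x ∣ ℕ.≟ ∣ y ∣ ] (χ w x)) ⟩
          ∑ (λ w → [ ∣ x ∣ ℕ.≟ ∣ y ∣ ] * (χ w x * (χ w c * ∂^ (∣ w ∣) empty (∣ c ─ w ∣) 0)))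
            ≈⟨ ∑-*ˡ [ ∣ x ∣ ℕ.≟ ∣ y ∣ ] (λ w → χ w x * (χ w c * ∂^ (∣ w ∣) empty (∣ c ─ w ∣) 0)) ⟩
          [ ∣ x ∣ ℕ.≟ ∣ y ∣ ] * ∑ (λ w → χ w x * (χ w c * ∂^ (∣ w ∣) empty (∣ c ─ w ∣) 0))
            ≈⟨ *-congˡ (newton c x empty) ⟨
          [ ∣ x ∣ ℕ.≟ ∣ y ∣ ] * empty (∣ c ─ x ∣) (∣ c ∩ x ∣)
            ≈⟨ *-congˡ (disjoint-complement y x) ⟩
          [ ∣ x ∣ ℕ.≟ ∣ y ∣ ] * χ x y ∎
          where
          disjoint-complement : ∀ {m} (y x : Subset m) → empty (∣ ∁ y ─ x ∣) (∣ ∁ y ∩ x ∣) ≈ χ x y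
          disjoint-complement []            []            = refl
          disjoint-complement (outside ∷ y) (outside ∷ x) = disjoint-complement y x
          disjoint-complement (outside ∷ y) (inside ∷ x)  = refl
          disjoint-complement (inside ∷ y)  (outside ∷ x) = disjoint-complement y x
          disjoint-complement (inside ∷ y)  (inside ∷ x)  = disjoint-complement y x

    everything : ∀ ψ → Mem ψ
    everything ψ = resp (λ x → sym (trans (sample ψ x) (∑-cong λ y → rearrange x y)))
      (Mem-∑ _ λ y → scale (ψ y) (point y))
      where
      rearrange : ∀ x y → χ x y * ([ ∣ y ∣ ℕ.≟ ∣ x ∣ ]* ψ y) ≈ ψ y * ([ ∣ x ∣ ℕ.≟ ∣ y ∣ ] * χ x y)
      rearrange x y with ∣ x ∣ ℕ.≟ ∣ y ∣
      ... | yes e = trans (*-congˡ ([]*-true (∣ y ∣ ℕ.≟ ∣ x ∣) (≡.sym e)))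
        (trans (*-comm _ _) (*-congˡ (sym (trans (*-congʳ ([]*-true (∣ x ∣ ℕ.≟ ∣ y ∣) e)) (*-identityˡ _)))))
      ... | no ne = trans (*-congˡ ([]*-false (∣ y ∣ ℕ.≟ ∣ x ∣) (ne ∘ ≡.sym)))
        (trans (zeroʳ _) (sym (*0-zero (0*-zero ([]*-false (∣ x ∣ ℕ.≟ ∣ y ∣) ne)))))

-- Ranges of the indices s and r

2*⌊n/2⌋≤n : ∀ n → 2 ℕ.* ⌊ n /2⌋ ≤ n
2*⌊n/2⌋≤n n = ℕ.≤-trans (ℕ.≤-reflexive (≡.cong (⌊ n /2⌋ ℕ.+_) (ℕ.+-identityʳ _)))
  (ℕ.≤-trans (ℕ.+-monoʳ-≤ ⌊ n /2⌋ (ℕ.⌊n/2⌋≤⌈n/2⌉ n)) (ℕ.≤-reflexive (ℕ.⌊n/2⌋+⌈n/2⌉≡n n)))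

module Degrees (n : ℕ) where
  S : Set
  S = Fin (suc ⌊ n /2⌋)

  J : S → Set
  J s = Fin (suc (n ℕ.∸ 2 ℕ.* toℕ s))

  deg : (s : S) → J s → ℕ
  deg s j = toℕ s ℕ.+ toℕ j

  2s≤n : (s : S) → 2 ℕ.* toℕ s ≤ n
  2s≤n s = ℕ.≤-trans (ℕ.*-monoʳ-≤ 2 (Fin.toℕ≤pred[n] s)) (2*⌊n/2⌋≤n n)

  s+s+N≡n : (s : S) → toℕ s ℕ.+ toℕ s ℕ.+ (n ℕ.∸ 2 ℕ.* toℕ s) ≡ n
  s+s+N≡n s = ≡.trans (≡.cong (λ k → toℕ s ℕ.+ k ℕ.+ (n ℕ.∸ 2 ℕ.* toℕ s)) (≡.sym (ℕ.+-identityʳ (toℕ s))))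
    (ℕ.m+[n∸m]≡n (2s≤n s))

  -- An index past the end of `J s` corresponds to a size greater than n - s, the regime of
  -- `Up-above`.
  beyond : ∀ (s : S) {k} → toℕ s ≤ k → ¬ (k ∸ toℕ s < suc (n ∸ 2 ℕ.* toℕ s)) → n < toℕ s ℕ.+ k
  beyond s {k} s≤k ≮ = begin-strict
    n                                          ≡⟨ s+s+N≡n s ⟨
    toℕ s ℕ.+ toℕ s ℕ.+ (n ∸ 2 ℕ.* toℕ s)      ≡⟨ ℕ.+-assoc (toℕ s) (toℕ s) _ ⟩
    toℕ s ℕ.+ (toℕ s ℕ.+ (n ∸ 2 ℕ.* toℕ s))    <⟨ ℕ.+-monoʳ-< (toℕ s) (ℕ.+-monoʳ-< (toℕ s) (ℕ.≮⇒≥ ≮)) ⟩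
    toℕ s ℕ.+ (toℕ s ℕ.+ (k ∸ toℕ s))          ≡⟨ ≡.cong (toℕ s ℕ.+_) (ℕ.m+[n∸m]≡n s≤k) ⟩
    toℕ s ℕ.+ k                                ∎
    where open ℕ.≤-Reasoning

-- T in terms of Up, and its Fourier transform

module Synthesis (K : CommutativeRing 0ℓ 0ℓ) (n : ℕ) where
  open CommutativeRing K hiding (zero)
  open import Algebra.Properties.Semiring.Sum semiring using (sum; sum-cong-≋; *-distribˡ-sum; ∑-distrib-+)
  open import Relation.Binary.Reasoning.Setoid setoid
  open SingleTermSum +-commutativeMonoid
  open IntegerSolver K
  open HarmonicFunctions K
  open FiniteDifferences K
  open Krawtchouk K
  open Antisymmetry K
  open Degrees n
  open import Algebra.Properties.Ring ring using (-1*x≈-x)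
  open Harmonic

  raise : ℕ → (Subset n → Carrier) → Subset n → Carrier
  raise r ψ x = [ ∣ x ∣ ℕ.≟ r ] * Up ψ x

  Vectors : Set
  Vectors = (s : S) → J s → Subset n → Carrier

  -- The shape of `T` once each Λ̃ is known to act by a scalar β followed by `raise`; it makes sense
  -- over any commutative ring.
  synthesize : ((s : S) → J s → Carrier) → Vectors → Subset n → Carrier
  synthesize β v x = sum λ s → sum λ j → β s j * raise (deg s j) (v s j) x

  Up-cong : ∀ {φ ψ : Subset n → Carrier} → (∀ y → φ y ≈ ψ y) → ∀ x → Up φ x ≈ Up ψ x
  Up-cong e x = ∑-cong λ y → *-congˡ (e y)

  Up-+ : ∀ (φ ψ : Subset n → Carrier) x → Up (λ y → φ y + ψ y) x ≈ Up φ x + Up ψ x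
  Up-+ φ ψ x = begin
    ∑ (λ y → χ y x * (φ y + ψ y))           ≈⟨ ∑-cong (λ y → distribˡ (χ y x) (φ y) (ψ y)) ⟩
    ∑ (λ y → χ y x * φ y + χ y x * ψ y)     ≈⟨ ∑-+ (λ y → χ y x * φ y) (λ y → χ y x * ψ y) ⟩
    Up φ x + Up ψ x                         ∎

  Up-* : ∀ c (ψ : Subset n → Carrier) x → Up (λ y → c * ψ y) x ≈ c * Up ψ x
  Up-* c ψ x = begin
    ∑ (λ y → χ y x * (c * ψ y))     ≈⟨ ∑-cong (λ y → solve 3 (λ a c p → a :* (c :* p) := c :* (a :* p)) refl (χ y x) c (ψ y)) ⟩
    ∑ (λ y → c * (χ y x * ψ y))     ≈⟨ ∑-*ˡ c (λ y → χ y x * ψ y) ⟩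
    c * Up ψ x                      ∎

  Up-permute : ∀ (g : Permutation′ n) ψ x → Up (λ y → ψ (permute g y)) x ≈ Up ψ (permute g x)
  Up-permute g ψ x = begin
    ∑ (λ y → χ y x * ψ (permute g y))                           ≈⟨ ∑-cong (λ y → *-congʳ (reflexive (≡.sym (χ-permute g y x)))) ⟩
    ∑ (λ y → χ (permute g y) (permute g x) * ψ (permute g y))   ≈⟨ ∑-permute g (λ y → χ y (permute g x) * ψ y) ⟩
    Up ψ (permute g x)                                          ∎

  private
    double : ((s : S) → J s → Carrier) → Carrier
    double f = sum λ s → sum (f s)

    double-cong : ∀ f g → (∀ s j → f s j ≈ g s j) → double f ≈ double g
    double-cong f g e = sum-cong-≋ {x = λ s → sum (f s)} {y = λ s → sum (g s)} λ s →
      sum-cong-≋ {x = f s} {y = g s} (e s)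

    double-+ : ∀ f g → double (λ s j → f s j + g s j) ≈ double f + double g
    double-+ f g = begin
      sum (λ s → sum λ j → f s j + g s j)
        ≈⟨ sum-cong-≋ {x = λ s → sum λ j → f s j + g s j} {y = λ s → sum (f s) + sum (g s)}
                      (λ s → ∑-distrib-+ (f s) (g s)) ⟩
      sum (λ s → sum (f s) + sum (g s))
        ≈⟨ ∑-distrib-+ (λ s → sum (f s)) (λ s → sum (g s)) ⟩
      double f + double g ∎

    double-* : ∀ c f → double (λ s j → c * f s j) ≈ c * double f
    double-* c f = sym (begin
      c * double f
        ≈⟨ *-distribˡ-sum c (λ s → sum (f s)) ⟩
      sum (λ s → c * sum (f s))
        ≈⟨ sum-cong-≋ {x = λ s → c * sum (f s)} {y = λ s → sum λ j → c * f s j} (λ s → *-distribˡ-sum c (f s)) ⟩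
      double (λ s j → c * f s j) ∎)

    summand : ((s : S) → J s → Carrier) → Vectors → Subset n → (s : S) → J s → Carrier
    summand β v x s j = β s j * raise (deg s j) (v s j) x

  synthesize-cong : ∀ {v w} β → (∀ s j x → v s j x ≈ w s j x) → ∀ x → synthesize β v x ≈ synthesize β w x
  synthesize-cong {v} {w} β e x = double-cong (summand β v x) (summand β w x) λ s j →
    *-congˡ {β s j} (*-congˡ {indicator (deg s j) (∣ x ∣)} (Up-cong (e s j) x))

  synthesize-+ : ∀ β v w x → synthesize β (λ s j y → v s j y + w s j y) x ≈ synthesize β v x + synthesize β w x
  synthesize-+ β v w x = trans
    (double-cong (summand β (λ s j y → v s j y + w s j y) x) (λ s j → summand β v x s j + summand β w x s j) λ s j → begin
      β s j * (indicator (deg s j) (∣ x ∣) * Up (λ y → v s j y + w s j y) x)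
        ≈⟨ *-congˡ {β s j} (*-congˡ {indicator (deg s j) (∣ x ∣)} (Up-+ (v s j) (w s j) x)) ⟩
      β s j * (indicator (deg s j) (∣ x ∣) * (Up (v s j) x + Up (w s j) x))
        ≈⟨ solve 4 (λ b i p q → b :* (i :* (p :+ q)) := b :* (i :* p) :+ b :* (i :* q)) refl
             (β s j) (indicator (deg s j) (∣ x ∣)) (Up (v s j) x) (Up (w s j) x) ⟩
      summand β v x s j + summand β w x s j ∎)
    (double-+ (summand β v x) (summand β w x))

  synthesize-* : ∀ β c v x → synthesize β (λ s j y → c * v s j y) x ≈ c * synthesize β v x
  synthesize-* β c v x = trans
    (double-cong (summand β (λ s j y → c * v s j y) x) (λ s j → c * summand β v x s j) λ s j → begin
      β s j * (indicator (deg s j) (∣ x ∣) * Up (λ y → c * v s j y) x)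
        ≈⟨ *-congˡ {β s j} (*-congˡ {indicator (deg s j) (∣ x ∣)} (Up-* c (v s j) x)) ⟩
      β s j * (indicator (deg s j) (∣ x ∣) * (c * Up (v s j) x))
        ≈⟨ solve 4 (λ c b i p → b :* (i :* (c :* p)) := c :* (b :* (i :* p))) refl
             c (β s j) (indicator (deg s j) (∣ x ∣)) (Up (v s j) x) ⟩
      c * summand β v x s j ∎)
    (double-* c (summand β v x))

  synthesize-0 : ∀ β x → synthesize β (λ _ _ _ → 0#) x ≈ 0#
  synthesize-0 β x = trans
    (synthesize-cong {λ _ _ _ → 0#} {λ _ _ _ → 0# * 0#} β (λ _ _ _ → sym (zeroˡ 0#)) x)
    (trans (synthesize-* β 0# (λ _ _ _ → 0#) x) (zeroˡ _))

  synthesize-neg : ∀ β v x → synthesize β (λ s j y → - v s j y) x ≈ - synthesize β v x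
  synthesize-neg β v x = trans
    (synthesize-cong {λ s j y → - v s j y} {λ s j y → - 1# * v s j y} β (λ s j y → sym (-1*x≈-x (v s j y))) x)
    (trans (synthesize-* β (- 1#) v x) (-1*x≈-x _))

  synthesize-permute : ∀ β (g : Permutation′ n) v x →
    synthesize β (λ s j y → v s j (permute g y)) x ≈ synthesize β v (permute g x)
  synthesize-permute β g v x = double-cong
    (summand β (λ s j y → v s j (permute g y)) x) (summand β v (permute g x)) λ s j →
    *-congˡ {β s j} (*-cong
      (reflexive (≡.cong (indicator (deg s j)) (≡.sym (∣permute∣ g x))))
      (Up-permute g (v s j) x))

  synthesize-single : ∀ β v (s : S) (j : J s) →
    (∀ s′ → s′ ≢ s → ∀ j′ y → v s′ j′ y ≈ 0#) → (∀ j′ → j′ ≢ j → ∀ y → v s j′ y ≈ 0#) →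
    ∀ x → synthesize β v x ≈ β s j * raise (deg s j) (v s j) x
  synthesize-single β v s j z z′ x = trans
    (sum-single (λ s → sum (summand β v x s)) s λ s′ ne → sum-zero (summand β v x s′) λ j′ → vanish s′ j′ (z s′ ne j′))
    (sum-single (summand β v x s) j λ j′ ne → vanish s j′ (z′ j′ ne))
    where
    vanish : ∀ s j → (∀ y → v s j y ≈ 0#) → summand β v x s j ≈ 0#
    vanish s j e = begin
      β s j * (indicator (deg s j) (∣ x ∣) * Up (v s j) x)
        ≈⟨ *-congˡ {β s j} (*-congˡ {indicator (deg s j) (∣ x ∣)} (∑-zero _ λ y →
             trans (*-congˡ {χ y x} (e y)) (zeroʳ (χ y x)))) ⟩
      β s j * (indicator (deg s j) (∣ x ∣) * 0#)
        ≈⟨ trans (*-congˡ {β s j} (zeroʳ _)) (zeroʳ (β s j)) ⟩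
      0# ∎

  sum-∑ : ∀ {k} (f : Fin k → Subset m → Carrier) → ∑ (λ x → sum λ i → f i x) ≈ sum λ i → ∑ (f i)
  sum-∑ {k = zero}  f = ∑-zero _ λ _ → refl
  sum-∑ {k = suc k} f = trans (∑-+ (f zero) _) (+-congˡ (sum-∑ (f ∘ suc)))

  Up-sum : ∀ {k} (κ : Fin k → Carrier) (v : Fin k → Subset n → Carrier) x →
    Up (λ y → sum λ i → κ i * v i y) x ≈ sum λ i → κ i * Up (v i) x
  Up-sum κ v x = begin
    ∑ (λ y → χ y x * sum λ i → κ i * v i y)
      ≈⟨ ∑-cong (λ y → trans (*-distribˡ-sum (χ y x) (λ i → κ i * v i y)) (sum-cong-≋ λ i →
           solve 3 (λ a b c → a :* (b :* c) := b :* (a :* c)) refl (χ y x) (κ i) (v i y))) ⟩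
    ∑ (λ y → sum λ i → κ i * (χ y x * v i y))
      ≈⟨ sum-∑ (λ i y → κ i * (χ y x * v i y)) ⟩
    sum (λ i → ∑ λ y → κ i * (χ y x * v i y))
      ≈⟨ sum-cong-≋ (λ i → ∑-*ˡ (κ i) (λ y → χ y x * v i y)) ⟩
    sum (λ i → κ i * Up (v i) x) ∎

  fourier : (Subset n → Carrier) → Subset n → Carrier
  fourier ψ x = ∑ λ w → sign ∣ x ∩ w ∣ * ψ w

  module _ (β : (s : S) → J s → Carrier) (κ : (s : S) → J s → J s → Carrier)
    (β*κ : ∀ s j k → β s k * κ s j k ≈
      β s j * ((- ι 2) ^ toℕ s * krawtchouk-sum (toℕ j) (toℕ k) (n ℕ.∸ 2 ℕ.* toℕ s ℕ.∸ toℕ k)))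
    (v : Vectors) (v-harmonic : ∀ s j → Harmonic (toℕ s) (v s j)) where

    mixture : Vectors
    mixture s k x = sum λ j → κ s j k * v s j x

    private
      spectrum : (s : S) → J s → Subset n → Carrier
      spectrum s j x = ∑ λ w → sign (∣ x ∩ w ∣) * indicator (deg s j) (∣ w ∣) * Up (v s j) w

      outside-range : ∀ s x → (∀ j → Up (v s j) x ≈ 0#) →
        sum (λ j → β s j * spectrum s j x) ≈ sum λ k → β s k * raise (deg s k) (mixture s k) x
      outside-range s x z = trans
        (sum-zero (λ j → β s j * spectrum s j x) λ j → *0-zero
          (fourier-Up-zero (v-harmonic s j) (indicator (deg s j)) x (z j)))
        (sym (sum-zero (λ k → β s k * raise (deg s k) (mixture s k) x) λ k → *0-zero (*0-zero
          (trans (Up-sum (λ j → κ s j k) (v s) x)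
                 (sum-zero (λ j → κ s j k * Up (v s j) x) λ j → *0-zero (z j))))))

      inside-range : ∀ s x (k : J s) → ∣ x ∣ ≡ deg s k →
        sum (λ j → β s j * spectrum s j x) ≈ sum λ k → β s k * raise (deg s k) (mixture s k) x
      inside-range s x k ∣x∣ = sym (begin
        sum (λ k → β s k * raise (deg s k) (mixture s k) x)
          ≈⟨ sum-single (λ k → β s k * raise (deg s k) (mixture s k) x) k (λ j ne → trans
               (*-congˡ (0*-zero ([]*-false (∣ x ∣ ℕ.≟ deg s j) λ e → ne (Fin.toℕ-injective
                 (ℕ.+-cancelˡ-≡ (toℕ s) _ _ (≡.trans (≡.sym e) ∣x∣)))))) (zeroʳ _)) ⟩
        β s k * raise (deg s k) (mixture s k) x
          ≈⟨ *-congˡ (trans (*-congʳ ([]*-true (∣ x ∣ ℕ.≟ deg s k) ∣x∣)) (*-identityˡ _)) ⟩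
        β s k * Up (mixture s k) x
          ≈⟨ *-congˡ (Up-sum (λ j → κ s j k) (v s) x) ⟩
        β s k * sum (λ j → κ s j k * Up (v s j) x)
          ≈⟨ *-distribˡ-sum (β s k) (λ j → κ s j k * Up (v s j) x) ⟩
        sum (λ j → β s k * (κ s j k * Up (v s j) x))
          ≈⟨ sum-cong-≋ mode ⟩
        sum (λ j → β s j * spectrum s j x) ∎)
        where
        N = n ℕ.∸ 2 ℕ.* toℕ s
        l = N ℕ.∸ toℕ k

        n≡ : n ≡ toℕ s ℕ.+ (toℕ s ℕ.+ toℕ k) ℕ.+ l
        n≡ = ≡.trans (≡.sym (s+s+N≡n s)) (≡.trans
          (≡.cong (toℕ s ℕ.+ toℕ s ℕ.+_) (≡.sym (ℕ.m+[n∸m]≡n (Fin.toℕ≤pred[n] k))))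
          (≡.trans (≡.sym (ℕ.+-assoc (toℕ s ℕ.+ toℕ s) (toℕ k) l))
                   (≡.cong (ℕ._+ l) (ℕ.+-assoc (toℕ s) (toℕ s) (toℕ k)))))

        mode : ∀ j → β s k * (κ s j k * Up (v s j) x) ≈ β s j * spectrum s j x
        mode j = begin
          β s k * (κ s j k * Up (v s j) x)
            ≈⟨ trans (sym (*-assoc _ _ _)) (*-congʳ (β*κ s j k)) ⟩
          β s j * ((- ι 2) ^ toℕ s * krawtchouk-sum (toℕ j) (toℕ k) l) * Up (v s j) x
            ≈⟨ trans (*-assoc _ _ _) (*-congˡ (*-congʳ (*-congˡ (sym (trans
                 (reflexive (shifts-indicator (toℕ k) l (toℕ s) (toℕ j)))
                 (shifts-krawtchouk (toℕ j) (toℕ k) l)))))) ⟩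
          β s j * ((- ι 2) ^ toℕ s * shifts (toℕ k) l (indicator (deg s j)) (toℕ s) * Up (v s j) x)
            ≈⟨ *-congˡ (sym (fourier-Up (v-harmonic s j) (indicator (deg s j)) (toℕ k) l x ∣x∣ n≡)) ⟩
          β s j * spectrum s j x ∎

      by-degree : ∀ s x →
        sum (λ j → β s j * spectrum s j x) ≈ sum λ k → β s k * raise (deg s k) (mixture s k) x
      by-degree s x with toℕ s ℕ.≤? ∣ x ∣
      ... | no s≰ = outside-range s x λ j → Up-below (v-harmonic s j) x (ℕ.≰⇒> s≰)
      ... | yes s≤ with ∣ x ∣ ℕ.∸ toℕ s ℕ.<? suc (n ℕ.∸ 2 ℕ.* toℕ s)
      ...   | yes lt = inside-range s x (fromℕ< lt)
                (≡.trans (≡.sym (ℕ.m+[n∸m]≡n s≤)) (≡.cong (toℕ s ℕ.+_) (≡.sym (Fin.toℕ-fromℕ< lt))))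
      ...   | no ≮ = outside-range s x λ j → Up-above (v-harmonic s j) x (beyond s s≤ ≮)

    -- The two sides agree for each s separately. If `x` has size s + k with k in range, mode j
    -- contributes β_j (-2)^s times a Krawtchouk number on the left and β_k κ_{jk} on the right,
    -- both multiplying the same `Up`; `β*κ` equates them. For other sizes of `x` every `Up` is
    -- zero.
    fourier-synthesize : ∀ x → fourier (synthesize β v) x ≈ synthesize β mixture x
    fourier-synthesize x = begin
      ∑ (λ w → sign (∣ x ∩ w ∣) * synthesize β v w)
        ≈⟨ ∑-cong (λ w → trans (*-distribˡ-sum (sign (∣ x ∩ w ∣)) (λ s → sum λ j → β s j * raise (deg s j) (v s j) w))
             (sum-cong-≋ λ s → trans (*-distribˡ-sum (sign (∣ x ∩ w ∣)) (λ j → β s j * raise (deg s j) (v s j) w))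
             (sum-cong-≋ λ j → solve 4 (λ g b i u → g :* (b :* (i :* u)) := b :* (g :* i :* u)) refl
               (sign (∣ x ∩ w ∣)) (β s j) (indicator (deg s j) (∣ w ∣)) (Up (v s j) w)))) ⟩
      ∑ (λ w → sum λ s → sum λ j → β s j * term s j w)
        ≈⟨ trans (sum-∑ (λ s w → sum λ j → β s j * term s j w)) (sum-cong-≋ λ s → trans
             (sum-∑ (λ j w → β s j * term s j w)) (sum-cong-≋ λ j → ∑-*ˡ (β s j) (term s j))) ⟩
      sum (λ s → sum λ j → β s j * spectrum s j x)
        ≈⟨ sum-cong-≋ (λ s → by-degree s x) ⟩
      synthesize β mixture x ∎
      where
      term : (s : S) → J s → Subset n → Carrier
      term s j w = sign (∣ x ∩ w ∣) * indicator (deg s j) (∣ w ∣) * Up (v s j) w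

  -- Orthogonality and norms of the summands

  module Sesquilinear (conj : Carrier → Carrier)
    (conj-cong : ∀ {a b} → a ≈ b → conj a ≈ conj b)
    (conj-+ : ∀ a b → conj (a + b) ≈ conj a + conj b)
    (conj-* : ∀ a b → conj (a * b) ≈ conj a * conj b)
    (conj-conj : ∀ a → conj (conj a) ≈ a)
    (conj-0 : conj 0# ≈ 0#) (conj-1 : conj 1# ≈ 1#) where

    inner : (φ ψ : Subset n → Carrier) → Carrier
    inner φ ψ = ∑ λ x → φ x * conj (ψ x)

    conj-[] : {A : Set} (d : Dec A) → conj [ d ] ≈ [ d ]
    conj-[] (yes _) = conj-1
    conj-[] (no _)  = conj-0

    opaque
      unfolding ∑

      conj-∑ : (f : Subset m → Carrier) → conj (∑ f) ≈ ∑ λ x → conj (f x)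
      conj-∑ {zero}  f = refl
      conj-∑ {suc m} f = trans (conj-+ _ _) (+-cong (conj-∑ {m} _) (conj-∑ {m} _))

    conj-sum : ∀ {k} (f : Fin k → Carrier) → conj (sum f) ≈ sum λ i → conj (f i)
    conj-sum {zero}  f = conj-0
    conj-sum {suc k} f = trans (conj-+ _ _) (+-congˡ (conj-sum (f ∘ suc)))

    inner-swap : ∀ φ ψ → inner φ ψ ≈ conj (inner ψ φ)
    inner-swap φ ψ = sym (trans (conj-∑ λ x → ψ x * conj (φ x)) (∑-cong λ x →
      trans (conj-* _ _) (trans (*-congˡ (conj-conj (φ x))) (*-comm _ _))))

    inner-cong : ∀ {φ φ′ ψ ψ′} → (∀ x → φ x ≈ φ′ x) → (∀ x → ψ x ≈ ψ′ x) → inner φ ψ ≈ inner φ′ ψ′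
    inner-cong p q = ∑-cong λ x → *-cong (p x) (conj-cong (q x))

    inner-sumˡ : ∀ {k} (f : Fin k → Subset n → Carrier) ψ →
      inner (λ x → sum λ i → f i x) ψ ≈ sum λ i → inner (f i) ψ
    inner-sumˡ f ψ = trans
      (∑-cong λ x → trans (*-comm _ _) (trans (*-distribˡ-sum (conj (ψ x)) (λ i → f i x)) (sum-cong-≋ λ i → *-comm (conj (ψ x)) (f i x))))
      (sum-∑ λ i x → f i x * conj (ψ x))

    inner-sumʳ : ∀ {k} φ (g : Fin k → Subset n → Carrier) →
      inner φ (λ x → sum λ i → g i x) ≈ sum λ i → inner φ (g i)
    inner-sumʳ φ g = trans
      (∑-cong λ x → trans (*-congˡ (conj-sum λ i → g i x)) (*-distribˡ-sum (φ x) (λ i → conj (g i x))))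
      (sum-∑ λ i x → φ x * conj (g i x))

    inner-scale : ∀ a b φ ψ → inner (λ x → a * φ x) (λ x → b * ψ x) ≈ a * conj b * inner φ ψ
    inner-scale a b φ ψ = trans
      (∑-cong λ x → trans (*-congˡ (conj-* b (ψ x)))
        (solve 4 (λ a p b q → (a :* p) :* (b :* q) := (a :* b) :* (p :* q)) refl _ _ _ _))
      (∑-*ˡ (a * conj b) (λ x → φ x * conj (ψ x)))

    private
      -- Moves the second `Up` to its adjoint. What is left at each `y` is a Gram sum for the
      -- indicator of the layer.
      inner-raise : ∀ r (ψ φ : Subset n → Carrier) → inner (raise r ψ) (raise r φ) ≈
        ∑ λ y → conj (φ y) * ∑ λ x → χ y x * indicator r (∣ x ∣) * Up ψ x
      inner-raise r ψ φ = begin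
        ∑ (λ x → indicator r (∣ x ∣) * Up ψ x * conj (indicator r (∣ x ∣) * Up φ x))
          ≈⟨ ∑-cong (λ x → trans (*-congˡ (trans (conj-* _ _)
               (*-cong (conj-[] (∣ x ∣ ℕ.≟ r)) (trans (conj-∑ (λ y → χ y x * φ y)) (∑-cong λ y →
                 trans (conj-* _ _) (*-congʳ (conj-[] (y ⊆? x))))))))
             (trans (solve 3 (λ i u c → (i :* u) :* (i :* c) := (i :* i :* u) :* c) refl _ _ _)
               (trans (*-congʳ (*-congʳ (idem (∣ x ∣ ℕ.≟ r)))) (sym (∑-*ˡ _ (λ y → χ y x * conj (φ y))))))) ⟩
        ∑ (λ x → ∑ λ y → indicator r (∣ x ∣) * Up ψ x * (χ y x * conj (φ y)))
          ≈⟨ ∑-swap (λ x y → indicator r (∣ x ∣) * Up ψ x * (χ y x * conj (φ y))) ⟩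
        ∑ (λ y → ∑ λ x → indicator r (∣ x ∣) * Up ψ x * (χ y x * conj (φ y)))
          ≈⟨ ∑-cong (λ y → trans
               (∑-cong λ x → solve 4 (λ i u c p → i :* u :* (c :* p) := p :* (c :* i :* u)) refl _ _ _ _)
               (∑-*ˡ (conj (φ y)) (λ x → χ y x * indicator r (∣ x ∣) * Up ψ x))) ⟩
        ∑ (λ y → conj (φ y) * ∑ λ x → χ y x * indicator r (∣ x ∣) * Up ψ x) ∎
        where
        idem : {A : Set} (d : Dec A) → [ d ] * [ d ] ≈ [ d ]
        idem (yes _) = *-identityˡ 1#
        idem (no _)  = zeroˡ 0#

      conj-supported : ∀ {s φ} → Harmonic {n} s φ → ∀ y → ∣ y ∣ ≢ s → conj (φ y) ≈ 0#
      conj-supported h y ne = trans (conj-cong (supported h y ne)) conj-0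

      -- The Gram sum at `y` of size s′ is a multiple of `Up ψ y`, which vanishes because `y` is too
      -- small to contain a set of size s.
      lower-orthogonal : ∀ {s s′ ψ φ} r → Harmonic {n} s ψ → Harmonic {n} s′ φ → s′ < s →
        inner (raise r ψ) (raise r φ) ≈ 0#
      lower-orthogonal {s} {s′} {ψ} {φ} r h h′ lt = trans (inner-raise r ψ φ) (∑-zero _ term)
        where
        term : ∀ y → conj (φ y) * ∑ (λ x → χ y x * indicator r (∣ x ∣) * Up ψ x) ≈ 0#
        term y with ∣ y ∣ ℕ.≟ s′
        ... | no ne = 0*-zero (conj-supported h′ y ne)
        ... | yes ≡.refl = *0-zero (gram-Up-zero h (indicator r) y (Up-below h y lt))

    -- Different r give disjoint supports. For different s, conjugate symmetry allows the function
    -- of larger degree to be placed first.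
    raise-orthogonal : ∀ {s s′ ψ φ} r r′ → Harmonic {n} s ψ → Harmonic {n} s′ φ → s ≢ s′ ⊎ r ≢ r′ →
      inner (raise r ψ) (raise r′ φ) ≈ 0#
    raise-orthogonal {ψ = ψ} {φ} r r′ h h′ ne with r ℕ.≟ r′
    ... | no r≢r′ = ∑-zero _ term
      where
      term : ∀ x → raise r ψ x * conj (raise r′ φ x) ≈ 0#
      term x with ∣ x ∣ ℕ.≟ r
      ... | no ne = 0*-zero (0*-zero ([]*-false (∣ x ∣ ℕ.≟ r) ne))
      ... | yes e = *0-zero (trans (conj-cong (0*-zero ([]*-false (∣ x ∣ ℕ.≟ r′)
                      λ e′ → r≢r′ (≡.trans (≡.sym e) e′)))) conj-0)
    raise-orthogonal {s} {s′} {ψ} {φ} r r h h′ (inj₂ ne) | yes ≡.refl = contradiction ≡.refl ne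
    raise-orthogonal {s} {s′} {ψ} {φ} r r h h′ (inj₁ ne) | yes ≡.refl with ℕ.<-cmp s s′
    ... | tri< lt _ _ = trans (inner-swap _ _) (trans (conj-cong (lower-orthogonal r h′ h lt)) conj-0)
    ... | tri≈ _ e _  = contradiction e ne
    ... | tri> _ _ gt = lower-orthogonal r h h′ gt

    raise-isometric : ∀ {s ψ φ} N j → n ≡ s ℕ.+ s ℕ.+ N → Harmonic {n} s ψ → Harmonic {n} s φ →
      inner (raise (s ℕ.+ j) ψ) (raise (s ℕ.+ j) φ) ≈ ι (N C j) * inner ψ φ
    raise-isometric {s} {ψ} {φ} N j n≡ h h′ = begin
      inner (raise (s ℕ.+ j) ψ) (raise (s ℕ.+ j) φ)
        ≈⟨ inner-raise (s ℕ.+ j) ψ φ ⟩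
      ∑ (λ y → conj (φ y) * ∑ λ x → χ y x * indicator (s ℕ.+ j) (∣ x ∣) * Up ψ x)
        ≈⟨ ∑-cong term ⟩
      ∑ (λ y → ι (N C j) * (ψ y * conj (φ y)))
        ≈⟨ ∑-*ˡ (ι (N C j)) (λ y → ψ y * conj (φ y)) ⟩
      ι (N C j) * inner ψ φ ∎
      where
      term : ∀ y → conj (φ y) * ∑ (λ x → χ y x * indicator (s ℕ.+ j) (∣ x ∣) * Up ψ x) ≈ ι (N C j) * (ψ y * conj (φ y))
      term y with ∣ y ∣ ℕ.≟ s
      ... | no ne = trans (*-congʳ (conj-supported h′ y ne)) (trans (zeroˡ _) (sym (trans
        (*-congˡ (*0-zero (conj-supported h′ y ne))) (zeroʳ _))))
      ... | yes e = trans (*-congˡ (trans (gram-Up h (indicator (s ℕ.+ j)) N y e n≡)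
          (*-congʳ (trans (reflexive (shifts-indicator 0 N s j)) (shifts-binomial N j)))))
        (solve 3 (λ c i p → c :* (i :* p) := i :* (p :* c)) refl _ _ _)

    synthesize-isometric : (β : (s : S) → J s → Carrier) →
      (∀ s j → β s j * conj (β s j) * ι ((n ℕ.∸ 2 ℕ.* toℕ s) C toℕ j) ≈ 1#) →
      (v w : Vectors) → (∀ s j → Harmonic (toℕ s) (v s j)) → (∀ s j → Harmonic (toℕ s) (w s j)) →
      inner (synthesize β v) (synthesize β w) ≈ sum λ s → sum λ j → inner (v s j) (w s j)
    synthesize-isometric β unit v w hv hw = begin
      inner (synthesize β v) (synthesize β w)
        ≈⟨ trans (inner-sumˡ (λ s x → sum λ j → a v s j x) (synthesize β w)) (sum-cong-≋ λ s →
             inner-sumˡ (λ j x → a v s j x) (synthesize β w)) ⟩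
      sum (λ s → sum λ j → inner (a v s j) (synthesize β w))
        ≈⟨ sum-cong-≋ (λ s → sum-cong-≋ λ j → trans
             (inner-sumʳ (a v s j) (λ s′ x → sum λ j′ → a w s′ j′ x)) (trans
             (sum-cong-≋ λ s′ → inner-sumʳ (a v s j) (λ j′ x → a w s′ j′ x)) (single s j))) ⟩
      sum (λ s → sum λ j → inner (v s j) (w s j)) ∎
      where
      a : Vectors → Vectors
      a v s j x = β s j * raise (deg s j) (v s j) x

      orthogonal : ∀ s j s′ j′ → toℕ s ≢ toℕ s′ ⊎ deg s j ≢ deg s′ j′ → inner (a v s j) (a w s′ j′) ≈ 0#
      orthogonal s j s′ j′ ne = trans (inner-scale (β s j) (β s′ j′) (raise (deg s j) (v s j)) (raise (deg s′ j′) (w s′ j′)))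
        (*0-zero (raise-orthogonal (deg s j) (deg s′ j′) (hv s j) (hw s′ j′) ne))

      single : ∀ s j → (sum λ s′ → sum λ j′ → inner (a v s j) (a w s′ j′)) ≈ inner (v s j) (w s j)
      single s j = begin
        sum (λ s′ → sum λ j′ → inner (a v s j) (a w s′ j′))
          ≈⟨ sum-single (λ s′ → sum λ j′ → inner (a v s j) (a w s′ j′)) s (λ s′ ne → sum-zero _ λ j′ →
               orthogonal s j s′ j′ (inj₁ λ e → ne (Fin.toℕ-injective (≡.sym e)))) ⟩
        sum (λ j′ → inner (a v s j) (a w s j′))
          ≈⟨ sum-single (λ j′ → inner (a v s j) (a w s j′)) j (λ j′ ne →
               orthogonal s j s j′ (inj₂ λ e → ne (Fin.toℕ-injective (≡.sym (ℕ.+-cancelˡ-≡ (toℕ s) _ _ e))))) ⟩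
        inner (a v s j) (a w s j)
          ≈⟨ inner-scale (β s j) (β s j) (raise (deg s j) (v s j)) (raise (deg s j) (w s j)) ⟩
        β s j * conj (β s j) * inner (raise (deg s j) (v s j)) (raise (deg s j) (w s j))
          ≈⟨ *-congˡ (raise-isometric (n ℕ.∸ 2 ℕ.* toℕ s) (toℕ j) (≡.sym (s+s+N≡n s)) (hv s j) (hw s j)) ⟩
        β s j * conj (β s j) * (ι ((n ℕ.∸ 2 ℕ.* toℕ s) C toℕ j) * inner (v s j) (w s j))
          ≈⟨ trans (sym (*-assoc _ _ _)) (trans (*-congʳ (unit s j)) (*-identityˡ _)) ⟩
        inner (v s j) (w s j) ∎

-- Falling factorials and the count behind α

module FallingFactorials where
  open import Data.Nat using (_+_; _*_; _∸_)
  open ≡.≡-Reasoning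

  P*! : ∀ {n k} → k ≤ n → (n P k) * (n ∸ k) ! ≡ n !
  P*! {n} {k} k≤n = ≡.trans (≡.cong (_* (n ∸ k) !) (nPk≡n!/[n∸k]! k≤n))
    (m/n*n≡m {{(n ∸ k) ℕ.!≢0}} (∣-trans (m∣m*n (k !)) ([n∸k]!k!∣n! k≤n)))

  C*! : ∀ {n k} → k ≤ n → (n C k) * k ! ≡ n P k
  C*! {n} {k} k≤n = ℕ.*-cancelʳ-≡ _ _ ((n ∸ k) !) {{(n ∸ k) ℕ.!≢0}} (begin
    (n C k) * k ! * (n ∸ k) !      ≡⟨ ℕ.*-assoc (n C k) (k !) _ ⟩
    (n C k) * (k ! * (n ∸ k) !)    ≡⟨ ≡.trans (≡.cong (_* (k ! * (n ∸ k) !)) (nCk≡n!/k![n-k]! k≤n))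
                                        (m/n*n≡m {{k ℕ.!* (n ∸ k) !≢0}}
                                          (≡.subst (_∣ n !) (ℕ.*-comm ((n ∸ k) !) (k !)) ([n∸k]!k!∣n! k≤n))) ⟩
    n !                            ≡⟨ P*! k≤n ⟨
    (n P k) * (n ∸ k) !            ∎)

  -- Both sides equal (s + i + 1)! / i!.
  suc-P : ∀ s i → suc (s + i) * ((s + i) P s) ≡ suc i * (suc (s + i) P s)
  suc-P s i = ℕ.*-cancelʳ-≡ _ _ (i !) {{i ℕ.!≢0}} (begin
    suc (s + i) * ((s + i) P s) * i !      ≡⟨ ℕ.*-assoc (suc (s + i)) ((s + i) P s) (i !) ⟩
    suc (s + i) * (((s + i) P s) * i !)    ≡⟨ ≡.cong (λ k → suc (s + i) * (((s + i) P s) * k !)) (ℕ.m+n∸m≡n s i) ⟨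
    suc (s + i) * (((s + i) P s) * (s + i ∸ s) !) ≡⟨ ≡.cong (suc (s + i) *_) (P*! (ℕ.m≤m+n s i)) ⟩
    suc (s + i) !                          ≡⟨ P*! (ℕ.m≤n⇒m≤1+n (ℕ.m≤m+n s i)) ⟨
    (suc (s + i) P s) * (suc (s + i) ∸ s) ! ≡⟨ ≡.cong (λ k → (suc (s + i) P s) * k !)
                                                 (≡.trans (≡.cong (_∸ s) (≡.sym (ℕ.+-suc s i))) (ℕ.m+n∸m≡n s (suc i))) ⟩
    (suc (s + i) P s) * (suc i * i !)      ≡⟨ rearrange (suc (s + i) P s) (suc i) (i !) ⟩
    suc i * (suc (s + i) P s) * i !        ∎)
    where
    open import Data.Nat.Tactic.RingSolver using (solve-∀)
    rearrange : ∀ a b c → a * (b * c) ≡ b * a * c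
    rearrange = solve-∀

  -- With e = n - 2s - j, the scalar of Λ is (n - s + 1) divided by (s + j choose s)(n - 2s + 1).
  -- The identity says that this cancels everything in α except the square root.
  α-count : ∀ s j e →
    ((s + j + e) P s) * ((s + j) P s) * suc (s + j + e) ≡
    s ! * ((s + j + e + 1) P s) * (((s + j) C s) * suc (j + e))
  α-count s j e = begin
    (a P s) * ((s + j) P s) * suc a
      ≡⟨ rearrange₁ (a P s) ((s + j) P s) (suc a) ⟩
    suc a * (a P s) * ((s + j) P s)
      ≡⟨ ≡.cong₂ _*_ step (≡.sym (C*! (ℕ.m≤m+n s j))) ⟩
    suc (j + e) * (suc a P s) * (((s + j) C s) * s !)
      ≡⟨ rearrange₂ (suc (j + e)) (suc a P s) ((s + j) C s) (s !) ⟩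
    s ! * (suc a P s) * (((s + j) C s) * suc (j + e))
      ≡⟨ ≡.cong (λ k → s ! * (k P s) * (((s + j) C s) * suc (j + e))) (ℕ.+-comm 1 a) ⟩
    s ! * ((a + 1) P s) * (((s + j) C s) * suc (j + e)) ∎
    where
    open import Data.Nat.Tactic.RingSolver using (solve-∀)
    a = s + j + e
    rearrange₁ : ∀ x y z → x * y * z ≡ z * x * y
    rearrange₁ = solve-∀
    rearrange₂ : ∀ x y z t → x * y * (z * t) ≡ t * y * (z * x)
    rearrange₂ = solve-∀
    step : suc a * (a P s) ≡ suc (j + e) * (suc a P s)
    step = ≡.subst (λ a → suc a * (a P s) ≡ suc (j + e) * (suc a P s)) (≡.sym (ℕ.+-assoc s j e)) (suc-P s (j + e))

  P-positive : ∀ {n k} → k ≤ n → ∃ λ i → n P k ≡ suc i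
  P-positive {n} {k} k≤n with n P k in eq
  ... | suc i = i , ≡.refl
  ... | zero  = contradiction (≡.trans (≡.sym (P*! k≤n)) (≡.cong (_* (n ∸ k) !) eq)) (ℕ.≢-nonZero⁻¹ (n !) {{n ℕ.!≢0}})

  C-positive : ∀ {n k} → k ≤ n → ∃ λ i → n C k ≡ suc i
  C-positive {n} {k} k≤n with n C k in eq | P-positive k≤n
  ... | suc i | _ = i , ≡.refl
  ... | zero  | i , p = contradiction (≡.trans (≡.sym p) (≡.trans (≡.sym (C*! k≤n)) (≡.cong (_* k !) eq))) λ ()

open FallingFactorials

-- Tableaux with prescribed columns

module Extension where
  open Permutations

  -- The image of `p zero` is corrected by a transposition. By injectivity neither of the two points
  -- it moves is one of the values already arranged.
  extend : ∀ {A : Set} {n} k (p : Fin k → A) (q : Fin k → Fin n) →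
    (∀ {i j} → p i ≡ p j → i ≡ j) → (∀ {i j} → q i ≡ q j → i ≡ j) →
    A ↔ Fin n → Σ (A ↔ Fin n) λ e → ∀ i → Inverse.to e (p i) ≡ q i
  extend zero    p q p-inj q-inj e = e , λ ()
  extend (suc k) p q p-inj q-inj e
    with e′ , h ← extend k (p ∘ suc) (q ∘ suc) (Fin.suc-injective ∘ p-inj) (Fin.suc-injective ∘ q-inj) e =
    transpose a b ↔-∘ e′ , λ where
      zero    → transposed
      (suc i) → ≡.trans (≡.cong (transpose a b ⟨$⟩ʳ_) (h i)) (transpose-other a b
        (λ q≡a → 0≢suc (p-inj (Injection.injective (↔⇒↣ e′) (≡.sym (≡.trans (h i) q≡a)))))
        (λ q≡b → 0≢suc (q-inj (≡.sym q≡b))))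
    where
    a = Inverse.to e′ (p zero)
    b = q zero
    0≢suc : ∀ {k} {i : Fin k} → zero ≢ suc i
    0≢suc ()
    transposed : transpose a b ⟨$⟩ʳ a ≡ b
    transposed rewrite dec-true (a Fin.≟ a) ≡.refl = ≡.refl

module Tableaux (ℝ : RealNumbers) (n : ℕ) where
  open PowerSet ℝ n
  open Extension

  tableau : ∀ s → s ℕ.+ s ≤ n → (l u : Fin s → Fin n) →
    (∀ {i j} → l i ≡ l j → i ≡ j) → (∀ {i j} → u i ≡ u j → i ≡ j) → (∀ i j → l i ≢ u j) →
    Σ (Tableau s) λ t → (∀ i → Tableau.lower t i ≡ l i) × (∀ i → Tableau.upper t i ≡ u i)
  tableau s 2s≤n l u l-inj u-inj l≢u = t , (λ i → value (inj₂ i)) , λ i → value (inj₁ i)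
    where
    s≤n : s ≤ n
    s≤n = ℕ.m+n≤o⇒m≤o s 2s≤n

    shape : s ≤ n ℕ.∸ s
    shape = ℕ.m+n≤o⇒m≤o∸n s 2s≤n

    position : Fin s ⊎ Fin s → Fin (n ℕ.∸ s) ⊎ Fin s
    position (inj₁ i) = inj₁ (inject≤ i shape)
    position (inj₂ i) = inj₂ i

    target : Fin s ⊎ Fin s → Fin n
    target (inj₁ i) = u i
    target (inj₂ i) = l i

    position-injective : ∀ x y → position x ≡ position y → x ≡ y
    position-injective (inj₁ i) (inj₁ j) e = ≡.cong inj₁ (Fin.inject≤-injective shape shape i j (inj₁-injective e))
    position-injective (inj₂ i) (inj₂ j) e = ≡.cong inj₂ (inj₂-injective e)

    target-injective : ∀ x y → target x ≡ target y → x ≡ y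
    target-injective (inj₁ i) (inj₁ j) e = ≡.cong inj₁ (u-inj e)
    target-injective (inj₁ i) (inj₂ j) e = contradiction (≡.sym e) (l≢u j i)
    target-injective (inj₂ i) (inj₁ j) e = contradiction e (l≢u i j)
    target-injective (inj₂ i) (inj₂ j) e = ≡.cong inj₂ (l-inj e)

    splitAt-injective : ∀ {i j} → splitAt s {s} i ≡ splitAt s j → i ≡ j
    splitAt-injective {i} {j} e =
      ≡.trans (≡.sym (Fin.join-splitAt s s i)) (≡.trans (≡.cong (join s s) e) (Fin.join-splitAt s s j))

    extension = extend (s ℕ.+ s) (position ∘ splitAt s) (target ∘ splitAt s)
      (splitAt-injective ∘ position-injective _ _) (splitAt-injective ∘ target-injective _ _)
      (Perm.cast-id (ℕ.m∸n+n≡m s≤n) ↔-∘ ↔-sym Fin.+↔⊎)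

    t : Tableau s
    t = record { shape = shape ; entry = proj₁ extension }

    value : ∀ x → Inverse.to (proj₁ extension) (position x) ≡ target x
    value x = ≡.subst (λ y → Inverse.to (proj₁ extension) (position y) ≡ target y)
      (Fin.splitAt-join s s x) (proj₂ extension (join s s x))

-- Order, inverses and square roots of real numbers

module RealFacts (ℝ : RealNumbers) where
  open RealNumbers ℝ hiding (zero) renaming (_<_ to _<ᴿ_; _≤_ to _≤ᴿ_)
  open import Relation.Binary.Reasoning.Setoid setoid
  open IntegerSolver commutativeRing
  private module O = IsStrictTotalOrder isStrictTotalOrder

  +-pos : ∀ {a b} → 0# <ᴿ a → 0# <ᴿ b → 0# <ᴿ a + b
  +-pos {a} {b} p q = O.trans q (O.<-respˡ-≈ (+-identityˡ b) (+-monoˡ-< 0# a b p))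

  ι-pos : ∀ k → 0# <ᴿ ι (suc k)
  ι-pos zero    = O.<-respʳ-≈ (sym (+-identityʳ 1#)) 0<1
  ι-pos (suc k) = +-pos 0<1 (ι-pos k)

  ι-nonneg : ∀ k → 0# ≤ᴿ ι k
  ι-nonneg zero    = inj₂ refl
  ι-nonneg (suc k) = inj₁ (ι-pos k)

  pos⇒≉0 : ∀ {a} → 0# <ᴿ a → ¬ a ≈ 0#
  pos⇒≉0 p e = O.irrefl (sym e) p

  neg⇒-pos : ∀ {a} → a <ᴿ 0# → 0# <ᴿ - a
  neg⇒-pos {a} p = O.<-respˡ-≈ (-‿inverseʳ a) (O.<-respʳ-≈ (+-identityˡ (- a)) (+-monoˡ-< a 0# (- a) p))

  square-pos : ∀ {a} → ¬ a ≈ 0# → 0# <ᴿ a * a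
  square-pos {a} ne with O.compare a 0#
  ... | tri< lt _ _ = O.<-respʳ-≈ (solve 1 (λ a → :- a :* :- a := a :* a) refl a) (*-pos _ _ (neg⇒-pos lt) (neg⇒-pos lt))
  ... | tri≈ _ e _  = contradiction e ne
  ... | tri> _ _ gt = *-pos _ _ gt gt

  square-nonneg : ∀ a → 0# ≤ᴿ a * a
  square-nonneg a with O._≟_ a 0#
  ... | yes e = inj₂ (sym (trans (*-congʳ e) (zeroˡ a)))
  ... | no ne = inj₁ (square-pos ne)

  square-zero : ∀ {a} → a * a ≈ 0# → a ≈ 0#
  square-zero {a} e with O._≟_ a 0#
  ... | yes z = z
  ... | no ne = contradiction e (pos⇒≉0 (square-pos ne))

  +-nonneg : ∀ {a b} → 0# ≤ᴿ a → 0# ≤ᴿ b → 0# ≤ᴿ a + b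
  +-nonneg (inj₁ p) (inj₁ q) = inj₁ (+-pos p q)
  +-nonneg (inj₁ p) (inj₂ q) = inj₁ (O.<-respʳ-≈ (trans (sym (+-identityʳ _)) (+-congˡ q)) p)
  +-nonneg (inj₂ p) (inj₁ q) = inj₁ (O.<-respʳ-≈ (trans (sym (+-identityˡ _)) (+-congʳ p)) q)
  +-nonneg (inj₂ p) (inj₂ q) = inj₂ (trans (sym (+-identityˡ _)) (+-cong p q))

  nonneg-sum-zeroˡ : ∀ {a b} → 0# ≤ᴿ a → 0# ≤ᴿ b → a + b ≈ 0# → a ≈ 0#
  nonneg-sum-zeroˡ (inj₂ p) _ _ = sym p
  nonneg-sum-zeroˡ (inj₁ p) (inj₁ q) e = contradiction e (pos⇒≉0 (+-pos p q))
  nonneg-sum-zeroˡ (inj₁ p) (inj₂ q) e = trans (sym (+-identityʳ _)) (trans (+-congˡ q) e)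

  nonneg-sum-zeroʳ : ∀ {a b} → 0# ≤ᴿ a → 0# ≤ᴿ b → a + b ≈ 0# → b ≈ 0#
  nonneg-sum-zeroʳ p q e = nonneg-sum-zeroˡ q p (trans (+-comm _ _) e)

  *-cancel : ∀ {a b c} → ¬ c ≈ 0# → a * c ≈ b * c → a ≈ b
  *-cancel {a} {b} {c} ne e = begin
    a                ≈⟨ trans (*-congˡ (⁻¹-inverseʳ c ne)) (*-identityʳ a) ⟨
    a * (c * c ⁻¹)   ≈⟨ *-assoc a c _ ⟨
    a * c * c ⁻¹     ≈⟨ *-congʳ e ⟩
    b * c * c ⁻¹     ≈⟨ *-assoc b c _ ⟩
    b * (c * c ⁻¹)   ≈⟨ trans (*-congˡ (⁻¹-inverseʳ c ne)) (*-identityʳ b) ⟩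
    b                ∎

  -- If a + b is nonzero it can be cancelled from a(a + b) = b(a + b); if it is zero, both numbers
  -- are.
  √-unique : ∀ {a b} → 0# ≤ᴿ a → 0# ≤ᴿ b → a * a ≈ b * b → a ≈ b
  √-unique {a} {b} p q e with O._≟_ (a + b) 0#
  ... | yes z = trans (nonneg-sum-zeroˡ p q z) (sym (nonneg-sum-zeroʳ p q z))
  ... | no ne = *-cancel ne (begin
    a * (a + b)       ≈⟨ distribˡ a a b ⟩
    a * a + a * b     ≈⟨ +-cong e (*-comm a b) ⟩
    b * b + b * a     ≈⟨ trans (+-comm _ _) (sym (distribˡ b a b)) ⟩
    b * (a + b)       ∎)

  ⁻¹-pos : ∀ {a} → 0# <ᴿ a → 0# <ᴿ a ⁻¹
  ⁻¹-pos {a} p with O.compare (a ⁻¹) 0#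
  ... | tri> _ _ gt = gt
  ... | tri≈ _ e _  = contradiction (trans (sym (⁻¹-inverseʳ a (pos⇒≉0 p))) (trans (*-congˡ e) (zeroʳ a))) (pos⇒≉0 0<1)
  ... | tri< lt _ _ = contradiction
    (trans (solve 2 (λ a i → a :* i :+ a :* :- i := con 0ℤ) refl a (a ⁻¹)) refl)
    (pos⇒≉0 (+-pos (O.<-respʳ-≈ (sym (⁻¹-inverseʳ a (pos⇒≉0 p))) 0<1) (*-pos _ _ p (neg⇒-pos lt))))

  √ι*√ι : ∀ k → √ (ι k) * √ (ι k) ≈ ι k
  √ι*√ι k = √-square (ι k) (ι-nonneg k)

  √ι-pos : ∀ k → 0# <ᴿ √ (ι (suc k))
  √ι-pos k with √-nonneg (ι (suc k)) (ι-nonneg (suc k))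
  ... | inj₁ p = p
  ... | inj₂ e = contradiction (trans (sym (√ι*√ι (suc k))) (trans (*-congʳ (sym e)) (zeroˡ _))) (pos⇒≉0 (ι-pos k))

  √-quotient : ∀ k l → √ (ι (suc k) / ι (suc l)) ≈ √ (ι (suc k)) * (√ (ι (suc l))) ⁻¹
  √-quotient k l = √-unique (√-nonneg _ quotient-nonneg)
    (inj₁ (*-pos _ _ (√ι-pos k) (⁻¹-pos (√ι-pos l))))
    (trans (√-square _ quotient-nonneg) (*-cancel (pos⇒≉0 (ι-pos l)) (begin
      ι (suc k) * ι (suc l) ⁻¹ * ι (suc l)
        ≈⟨ trans (*-assoc _ _ _) (trans (*-congˡ (trans (*-comm _ _) (⁻¹-inverseʳ _ (pos⇒≉0 (ι-pos l))))) (*-identityʳ _)) ⟩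
      ι (suc k)
        ≈⟨ √ι*√ι (suc k) ⟨
      √k * √k
        ≈⟨ solve 1 (λ a → a :* a := a :* con 1ℤ :* (a :* con 1ℤ)) refl √k ⟩
      √k * 1# * (√k * 1#)
        ≈⟨ *-cong (*-congˡ inv) (*-congˡ inv) ⟨
      √k * (√l * √l ⁻¹) * (√k * (√l * √l ⁻¹))
        ≈⟨ solve 3 (λ a b c → a :* (b :* c) :* (a :* (b :* c)) := a :* c :* (a :* c) :* (b :* b)) refl √k √l (√l ⁻¹) ⟩
      √k * √l ⁻¹ * (√k * √l ⁻¹) * (√l * √l)
        ≈⟨ *-congˡ (√ι*√ι (suc l)) ⟩
      √k * √l ⁻¹ * (√k * √l ⁻¹) * ι (suc l) ∎)))
    where
    √k = √ (ι (suc k))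
    √l = √ (ι (suc l))
    inv : √l * √l ⁻¹ ≈ 1#
    inv = ⁻¹-inverseʳ √l (pos⇒≉0 (√ι-pos l))
    quotient-nonneg : 0# ≤ᴿ ι (suc k) / ι (suc l)
    quotient-nonneg = inj₁ (*-pos _ _ (ι-pos k) (⁻¹-pos (ι-pos l)))

-- Complex numbers: embedding of the reals, conjugation, definiteness

module ComplexFacts (ℝ : RealNumbers) where
  open Complex ℝ
  open RealFacts ℝ
  private
    module R = RealNumbers ℝ
    module Rs = IntegerSolver R.commutativeRing
  open HarmonicFunctions ℂ-commutativeRing using (∑) renaming (ι to ιᶜ)
  open Rs using (solve; _:=_; con; _:+_; _:*_; :-_; _:-_)

  fromReal-cong : ∀ {a b} → a R.≈ b → fromReal a ≈ fromReal b
  fromReal-cong e = e , R.refl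

  fromReal-* : ∀ a b → fromReal (a R.* b) ≈ fromReal a * fromReal b
  fromReal-* a b = solve 2 (λ a b → a :* b := a :* b :- con 0ℤ :* con 0ℤ) R.refl a b
                 , solve 2 (λ a b → con 0ℤ := a :* con 0ℤ :+ con 0ℤ :* b) R.refl a b

  fromReal-neg : ∀ a → fromReal (R.- a) ≈ - fromReal a
  fromReal-neg a = R.refl , solve 0 (con 0ℤ := :- con 0ℤ) R.refl

  -- Natural numbers enter ℂ in two ways: as multiples of 1 in the ring, and through the real
  -- numbers as in `Complex.ι`.
  fromReal-ι : ∀ k → ιᶜ k ≈ fromReal (R.ι k)
  fromReal-ι zero    = R.refl , R.refl
  fromReal-ι (suc k) = R.+-congˡ (proj₁ (fromReal-ι k))
                     , R.trans (R.+-identityˡ _) (proj₂ (fromReal-ι k))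

  fromReal-^ : ∀ a k → fromReal (a R.^ k) ≈ fromReal a ^ k
  fromReal-^ a zero    = R.refl , R.refl
  fromReal-^ a (suc k) = trans {fromReal (a R.^ suc k)} {fromReal a * fromReal (a R.^ k)} {fromReal a ^ suc k}
    (fromReal-* a (a R.^ k)) (*-congˡ {fromReal a} {fromReal (a R.^ k)} {fromReal a ^ k} (fromReal-^ a k))

  fromReal-sum : ∀ {k} (f : Fin k → R.Carrier) → fromReal (R.sum f) ≈ sum λ i → fromReal (f i)
  fromReal-sum {zero}  f = R.refl , R.refl
  fromReal-sum {suc k} f = R.+-congˡ (proj₁ (fromReal-sum (f ∘ suc)))
                         , R.trans (proj₂ (fromReal-sum (f ∘ suc))) (R.sym (R.+-identityˡ _))

  conj-cong : ∀ {a b} → a ≈ b → conj a ≈ conj b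
  conj-cong (p , q) = p , R.-‿cong q

  conj-+ : ∀ a b → conj (a + b) ≈ conj a + conj b
  conj-+ (a +i b) (c +i d) = R.refl , solve 2 (λ b d → :- (b :+ d) := :- b :+ :- d) R.refl b d

  conj-* : ∀ a b → conj (a * b) ≈ conj a * conj b
  conj-* (a +i b) (c +i d) =
      solve 4 (λ a b c d → a :* c :- b :* d := a :* c :- (:- b :* :- d)) R.refl a b c d
    , solve 4 (λ a b c d → :- (a :* d :+ b :* c) := a :* :- d :+ :- b :* c) R.refl a b c d

  conj-conj : ∀ a → conj (conj a) ≈ a
  conj-conj (a +i b) = R.refl , solve 1 (λ b → :- (:- b) := b) R.refl b

  conj-fromReal : ∀ a → conj (fromReal a) ≈ fromReal a
  conj-fromReal a = R.refl , solve 0 (:- con 0ℤ := con 0ℤ) R.refl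

  ι-inverse : ∀ k → ∃ λ y → y * ιᶜ (suc k) ≈ 1#
  ι-inverse k = fromReal (R.ι (suc k) R.⁻¹) ,
    trans {fromReal (R.ι (suc k) R.⁻¹) * ιᶜ (suc k)} {fromReal (R.ι (suc k) R.⁻¹ R.* R.ι (suc k))} {1#}
      (trans {fromReal (R.ι (suc k) R.⁻¹) * ιᶜ (suc k)} {fromReal (R.ι (suc k) R.⁻¹) * fromReal (R.ι (suc k))}
             {fromReal (R.ι (suc k) R.⁻¹ R.* R.ι (suc k))}
        (*-congˡ {fromReal (R.ι (suc k) R.⁻¹)} {ιᶜ (suc k)} {fromReal (R.ι (suc k))} (fromReal-ι (suc k)))
        (sym {fromReal (R.ι (suc k) R.⁻¹ R.* R.ι (suc k))} (fromReal-* _ _)))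
      (fromReal-cong (R.trans (R.*-comm _ _) (R.⁻¹-inverseʳ _ (pos⇒≉0 (ι-pos k)))))

  private
    real-2-torsion-free : ∀ {a} → a R.≈ R.- a → a R.≈ R.0#
    real-2-torsion-free {a} e = *-cancel (pos⇒≉0 (ι-pos 1)) (R.trans
      (solve 1 (λ a → a :* (con 1ℤ :+ (con 1ℤ :+ con 0ℤ)) := a :+ a) R.refl a)
      (R.trans (R.+-congˡ e) (R.trans (R.-‿inverseʳ a) (R.sym (R.zeroˡ _)))))

    modulus² : ℂ → R.Carrier
    modulus² z = re z R.* re z R.+ im z R.* im z

    modulus²-zero : ∀ z → modulus² z R.≈ R.0# → z ≈ 0#
    modulus²-zero (a +i b) e =
        square-zero (nonneg-sum-zeroˡ (square-nonneg a) (square-nonneg b) e)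
      , square-zero (nonneg-sum-zeroʳ (square-nonneg a) (square-nonneg b) e)

  2-torsion-free : ∀ {a} → a ≈ - a → a ≈ 0#
  2-torsion-free (p , q) = real-2-torsion-free p , real-2-torsion-free q

  reciprocal : ∀ z → ¬ z ≈ 0# → ∃ λ w → w * z ≈ 1#
  reciprocal z@(a +i b) ne = (a R.* d +i R.- (b R.* d)) ,
    ( R.trans (solve 3 (λ a b d → a :* d :* a :- (:- (b :* d) :* b) := (a :* a :+ b :* b) :* d) R.refl a b d)
              (R.⁻¹-inverseʳ _ (ne ∘ modulus²-zero z))
    , solve 3 (λ a b d → a :* d :* b :+ :- (b :* d) :* a := con 0ℤ) R.refl a b d )
    where d = modulus² z R.⁻¹

  re-*-conj : ∀ z → re (z * conj z) R.≈ modulus² z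
  re-*-conj (a +i b) = solve 2 (λ a b → a :* a :- (b :* :- b) := a :* a :+ b :* b) R.refl a b

  re-*-conj-nonneg : ∀ z → R.0# R.≤ re (z * conj z)
  re-*-conj-nonneg z with +-nonneg (square-nonneg (re z)) (square-nonneg (im z))
  ... | inj₁ p = inj₁ (IsStrictTotalOrder.<-respʳ-≈ R.isStrictTotalOrder (R.sym (re-*-conj z)) p)
  ... | inj₂ e = inj₂ (R.trans e (R.sym (re-*-conj z)))

  re-*-conj-zero : ∀ z → re (z * conj z) R.≈ R.0# → z ≈ 0#
  re-*-conj-zero z e = modulus²-zero z (R.trans (R.sym (re-*-conj z)) e)

  opaque
    unfolding ∑

    ∑-re-nonneg : ∀ {m} (f : Subset m → ℂ) → (∀ x → R.0# R.≤ re (f x)) → R.0# R.≤ re (∑ f)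
    ∑-re-nonneg {zero}  f p = p []
    ∑-re-nonneg {suc m} f p = +-nonneg (∑-re-nonneg {m} _ λ x → p (outside ∷ x)) (∑-re-nonneg {m} _ λ x → p (inside ∷ x))

    ∑-re-zero : ∀ {m} (f : Subset m → ℂ) → (∀ x → R.0# R.≤ re (f x)) → re (∑ f) R.≈ R.0# → ∀ x → re (f x) R.≈ R.0#
    ∑-re-zero {zero} f p e [] = e
    ∑-re-zero {suc m} f p e (outside ∷ x) = ∑-re-zero {m} (λ x → f (outside ∷ x)) (λ x → p (outside ∷ x))
      (nonneg-sum-zeroˡ (∑-re-nonneg {m} _ λ x → p (outside ∷ x)) (∑-re-nonneg {m} _ λ x → p (inside ∷ x)) e) x
    ∑-re-zero {suc m} f p e (inside ∷ x) = ∑-re-zero {m} (λ x → f (inside ∷ x)) (λ x → p (inside ∷ x))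
      (nonneg-sum-zeroʳ (∑-re-nonneg {m} _ λ x → p (outside ∷ x)) (∑-re-nonneg {m} _ λ x → p (inside ∷ x)) e) x

  sum-re-nonneg : ∀ {k} (f : Fin k → ℂ) → (∀ x → R.0# R.≤ re (f x)) → R.0# R.≤ re (sum f)
  sum-re-nonneg {zero}  f p = inj₂ R.refl
  sum-re-nonneg {suc k} f p = +-nonneg (p zero) (sum-re-nonneg (f ∘ suc) (p ∘ suc))

  sum-re-zero : ∀ {k} (f : Fin k → ℂ) → (∀ x → R.0# R.≤ re (f x)) → re (sum f) R.≈ R.0# → ∀ x → re (f x) R.≈ R.0#
  sum-re-zero {suc k} f p e zero    = nonneg-sum-zeroˡ (p zero) (sum-re-nonneg (f ∘ suc) (p ∘ suc)) e
  sum-re-zero {suc k} f p e (suc i) = sum-re-zero (f ∘ suc) (p ∘ suc)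
    (nonneg-sum-zeroʳ (p zero) (sum-re-nonneg (f ∘ suc) (p ∘ suc)) e) i

-- Agreement of the two sums over subsets

module SubsetSums (ℝ : RealNumbers) (n : ℕ) where
  open Complex ℝ
  open PowerSet ℝ n
  open HarmonicFunctions ℂ-commutativeRing using (∑)

  opaque
    unfolding ∑

    ∑-subsets≡∑ : ∀ {m} (f : Subset m → ℂ) → ∑-subsets f ≡ ∑ f
    ∑-subsets≡∑ {zero}  f = ≡.refl
    ∑-subsets≡∑ {suc m} f = ≡.cong₂ _+_ (∑-subsets≡∑ {m} _) (∑-subsets≡∑ {m} _)

-- The elements of L²(X_s)_s

module Component (ℝ : RealNumbers) (n s : ℕ) (W : PowerSet.Subrep ℝ n)
  (isComponent : PowerSet.IsComponent ℝ n s s W) where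
  open Complex ℝ
  open PowerSet ℝ n
  open ComplexFacts ℝ
  open SubsetSums ℝ n
  open HarmonicFunctions ℂ-commutativeRing using (Harmonic; ∑-cong; ∑-zero; ∑-+; ∑-*ˡ; χ; ∑)
  open Antisymmetry ℂ-commutativeRing using (column-antisymmetrizer; module Columns)
  open import Algebra.Properties.CommutativeSemigroup *-commutativeSemigroup using (x∙yz≈y∙xz)
  open import Relation.Binary.Reasoning.Setoid setoid
  open Harmonic
  open IsComponent isComponent renaming (supported to component-supported)
  private
    f = proj₁ isomorphic
    module L = IsLeftModuleIsomorphism (IsRepIso.linearIso (proj₂ isomorphic))
    module 𝓛 = Representation 𝓛
    module 𝓦 = Representation (Subrep.rep W)

  module _ (t : Tableau s) where
    open Tableau t

    private
      entry-injective : ∀ {x y} → Inverse.to entry x ≡ Inverse.to entry y → x ≡ y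
      entry-injective = Injection.injective (↔⇒↣ entry)

    open Columns lower upper
      (λ e → inj₂-injective (entry-injective e))
      (λ e → Fin.inject≤-injective shape shape _ _ (inj₁-injective (entry-injective e)))
      (λ i j e → contradiction (entry-injective e) λ ())
      public

    polytabloid≈ : ∀ x → polytabloid x ≈ column-antisymmetrizer lower upper x
    polytabloid≈ x = reflexive (∑-subsets≡∑ _)

    -- The element of `W` that the given isomorphism sends to the polytabloid. Being antisymmetric
    -- and supported on X_s, it is a multiple of the polytabloid.
    preimage : 𝓦.Carrierᴹ
    preimage = proj₁ (L.surjective (polytabloid , gen t))

    f-preimage : ∀ x → proj₁ (f preimage) x ≈ column-antisymmetrizer lower upper x
    f-preimage x = trans (proj₂ (L.surjective (polytabloid , gen t)) {preimage} (𝓦.≈ᴹ-refl {preimage}) x) (polytabloid≈ x)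

    preimage-supported : ∀ x → ∣ x ∣ ≢ s → proj₁ preimage x ≈ 0#
    preimage-supported = component-supported _ (proj₂ preimage)

    preimage-antisymmetric : Antisymmetric (proj₁ preimage)
    preimage-antisymmetric i = L.injective {𝓦.act g preimage} {𝓦.-ᴹ preimage} λ x → begin
      proj₁ (f (𝓦.act g preimage)) x
        ≈⟨ IsRepIso.equivariant (proj₂ isomorphic) g preimage x ⟩
      proj₁ (f preimage) (permute (swap i) x)
        ≈⟨ f-preimage _ ⟩
      column-antisymmetrizer lower upper (permute (swap i) x)
        ≈⟨ antisymmetrizer-antisymmetric i x ⟩
      - column-antisymmetrizer lower upper x
        ≈⟨ -‿cong (f-preimage x) ⟨
      - proj₁ (f preimage) x
        ≈⟨ L.-ᴹ-homo preimage x ⟨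
      proj₁ (f (𝓦.-ᴹ preimage)) x ∎
      -- `act g` evaluates at the inverse of `g`, so the flip makes the swap itself appear in the
      -- argument.
      where g = Perm.flip (swap i)

    preimage-harmonic : Harmonic s (proj₁ preimage)
    preimage-harmonic = antisymmetric-harmonic 2-torsion-free preimage-antisymmetric preimage-supported

    -- The preimage is c times the antisymmetrizer. If c were 0 the preimage would be 0, and so
    -- would its image, which takes the value 1 at `range lower`. Dividing by c stays inside `W`.
    antisymmetrizer-∈ : column-antisymmetrizer lower upper ∈ W
    antisymmetrizer-∈ = Subrep.resp W (λ x → begin
      w * proj₁ preimage x
        ≈⟨ *-congˡ (unique x) ⟩
      w * (c * column-antisymmetrizer lower upper x)
        ≈⟨ *-assoc w c _ ⟨
      w * c * column-antisymmetrizer lower upper x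
        ≈⟨ *-congʳ (proj₂ (reciprocal c c≉0)) ⟩
      1# * column-antisymmetrizer lower upper x
        ≈⟨ *-identityˡ _ ⟩
      column-antisymmetrizer lower upper x ∎)
      (Subrep.*-closed W w (proj₂ preimage))
      where
      c = proj₁ preimage (range lower)
      unique : ∀ x → proj₁ preimage x ≈ c * column-antisymmetrizer lower upper x
      unique = antisymmetric-unique 2-torsion-free preimage-antisymmetric preimage-supported
      c≉0 : ¬ c ≈ 0#
      c≉0 e = 1≉0 (begin
        1#                                                    ≈⟨ antisymmetrizer-base ⟨
        column-antisymmetrizer lower upper (range lower)      ≈⟨ f-preimage (range lower) ⟨
        proj₁ (f preimage) (range lower)                      ≈⟨ L.⟦⟧-cong {preimage} {𝓦.0ᴹ} (λ x → begin
          proj₁ preimage x                             ≈⟨ unique x ⟩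
          c * column-antisymmetrizer lower upper x     ≈⟨ *-congʳ e ⟩
          0# * column-antisymmetrizer lower upper x    ≈⟨ zeroˡ _ ⟩
          0#                                           ∎) (range lower) ⟩
        proj₁ (f 𝓦.0ᴹ) (range lower)                          ≈⟨ L.0ᴹ-homo (range lower) ⟩
        0#                                                    ∎)
        where
        1≉0 : ¬ 1# ≈ 0#
        1≉0 (p , _) = RealFacts.pos⇒≉0 ℝ (RealNumbers.0<1 ℝ) p
      w = proj₁ (reciprocal c c≉0)

  private
    Balanced : (X → ℂ) → Set
    Balanced ψ = ∀ w → ∑ (λ y → χ w y * ψ y) ≈ ψ w

    -- Induction on how the image of `v` is generated by polytabloids: each summand is pulled back
    -- to `W`, and injectivity of `f` shows that `v` is the same combination of the pullbacks.
    -- Asking `f v` to equal φ only pointwise lets the induction hypothesis apply to these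
    -- pullbacks.
    balanced : ∀ {φ} → SpechtSpan s φ → ∀ (v : 𝓦.Carrierᴹ) → (∀ x → proj₁ (f v) x ≈ φ x) → Balanced (proj₁ v)
    balanced (gen t) v e = cong′ (λ x → sym (same x)) (down (preimage-harmonic t))
      where
      same : ∀ x → proj₁ v x ≈ proj₁ (preimage t) x
      same = L.injective {v} {preimage t} λ x → trans (e x) (trans (polytabloid≈ t x) (sym (f-preimage t x)))
      cong′ : ∀ {φ ψ : X → ℂ} → (∀ x → φ x ≈ ψ x) → Balanced φ → Balanced ψ
      cong′ h b w = trans (∑-cong λ y → *-congˡ (sym (h y))) (trans (b w) (h w))
    balanced nil v e w = trans (∑-zero _ λ y → trans (*-congˡ (z y)) (zeroʳ _)) (sym (z w))
      where
      z : ∀ x → proj₁ v x ≈ 0#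
      z = L.injective {v} {𝓦.0ᴹ} λ x → trans (e x) (sym (L.0ᴹ-homo x))
    balanced (add {φ} {ψ} p q) v e w = begin
      ∑ (λ y → χ w y * proj₁ v y)
        ≈⟨ ∑-cong (λ y → trans (*-congˡ (split y)) (distribˡ _ _ _)) ⟩
      ∑ (λ y → χ w y * proj₁ a y + χ w y * proj₁ b y)
        ≈⟨ ∑-+ (λ y → χ w y * proj₁ a y) (λ y → χ w y * proj₁ b y) ⟩
      ∑ (λ y → χ w y * proj₁ a y) + ∑ (λ y → χ w y * proj₁ b y)
        ≈⟨ +-cong (balanced p a (proj₂ (L.surjective (φ , p)) {a} (𝓦.≈ᴹ-refl {a})) w)
                  (balanced q b (proj₂ (L.surjective (ψ , q)) {b} (𝓦.≈ᴹ-refl {b})) w) ⟩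
      proj₁ a w + proj₁ b w
        ≈⟨ split w ⟨
      proj₁ v w ∎
      where
      a = proj₁ (L.surjective (φ , p))
      b = proj₁ (L.surjective (ψ , q))
      split : ∀ x → proj₁ v x ≈ proj₁ a x + proj₁ b x
      split = L.injective {v} {a 𝓦.+ᴹ b} λ x → trans (e x) (sym (trans (L.+ᴹ-homo a b x)
        (+-cong (proj₂ (L.surjective (φ , p)) {a} (𝓦.≈ᴹ-refl {a}) x) (proj₂ (L.surjective (ψ , q)) {b} (𝓦.≈ᴹ-refl {b}) x))))
    balanced (scale c {ψ} q) v e w = begin
      ∑ (λ y → χ w y * proj₁ v y)
        ≈⟨ ∑-cong (λ y → trans (*-congˡ (split y)) (x∙yz≈y∙xz _ _ _)) ⟩
      ∑ (λ y → c * (χ w y * proj₁ b y))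
        ≈⟨ ∑-*ˡ c (λ y → χ w y * proj₁ b y) ⟩
      c * ∑ (λ y → χ w y * proj₁ b y)
        ≈⟨ *-congˡ (balanced q b (proj₂ (L.surjective (ψ , q)) {b} (𝓦.≈ᴹ-refl {b})) w) ⟩
      c * proj₁ b w
        ≈⟨ split w ⟨
      proj₁ v w ∎
      where
      b = proj₁ (L.surjective (ψ , q))
      split : ∀ x → proj₁ v x ≈ c * proj₁ b x
      split = L.injective {v} {c 𝓦.*ₗ b} λ x → trans (e x) (sym (trans (L.*ₗ-homo c b x)
        (*-congˡ (proj₂ (L.surjective (ψ , q)) {b} (𝓦.≈ᴹ-refl {b}) x))))
    balanced (resp h p) v e = balanced p v λ x → trans (e x) (sym (h x))

  component-harmonic : ∀ ψ → ψ ∈ W → Harmonic s ψ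
  component-harmonic ψ m = record
    { supported = component-supported ψ m
    ; down      = balanced (proj₂ (f (ψ , m))) (ψ , m) λ x → refl
    }

-- The scalar by which Λ acts

module ScalarAction (ℝ : RealNumbers) (n : ℕ) (V : ℕ → ℕ → PowerSet.Subrep ℝ n) (s j e : ℕ)
  (n≡ : j ℕ.+ (s ℕ.+ s) ℕ.+ e ≡ n)
  (source : PowerSet.IsComponent ℝ n s s (V s s))
  (target : PowerSet.IsComponent ℝ n (s ℕ.+ j) s (V (s ℕ.+ j) s))
  (Λ : (PowerSet.X ℝ n → Complex.ℂ ℝ) → PowerSet.X ℝ n → Complex.ℂ ℝ)
  (isΛ : PowerSet.IsΛ ℝ n V s s (s ℕ.+ j) Λ) where
  open Complex ℝ
  open PowerSet ℝ n using (X; _∈_; ⟨_,_⟩; eval; module IsΛ; module IsComponent)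
  open ComplexFacts ℝ
  open SubsetSums ℝ n
  open HarmonicFunctions ℂ-commutativeRing renaming (ι to ιᶜ) hiding (_^_)
  open FiniteDifferences ℂ-commutativeRing renaming (polynomial to polynomialᶜ)
  open Synthesis ℂ-commutativeRing n using (raise)
  open import Algebra.Properties.Semiring.Exp semiring using (^-congˡ)
  open import Algebra.Properties.Semiring.Sum semiring using (sum-cong-≋)
  open import Relation.Binary.Reasoning.Setoid setoid
  open IsΛ isΛ
  open Harmonic

  private
    harmonic : ∀ ψ → ψ ∈ V s s → Harmonic s ψ
    harmonic = Component.component-harmonic ℝ n s (V s s) source

  -- For `y` and `x` of sizes s and s + j the kernel argument `∣ x ─ y ∣` is `∣ y ─ x ∣ + j`, so
  -- this is the s-fold `∂` at (0,0) of the kernel in the variables of `harmonic-kernel`.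
  scalar : ℂ
  scalar = D^ s kernel j

  private
    on-layer : ∀ ψ → ψ ∈ V s s → ∀ x → ∣ x ∣ ≡ s ℕ.+ j → Λ ψ x ≈ scalar * Up ψ x
    on-layer ψ m x ∣x∣ = begin
      Λ ψ x
        ≈⟨ kernel-spec ψ x ∣x∣ ⟩
      _
        ≈⟨ reflexive (∑-subsets≡∑ _) ⟩
      ∑ (λ y → [ ∣ y ∣ ℕ.≟ s ]* (kernel (∣ x ─ y ∣) * ψ y))
        ≈⟨ ∑-cong pointwise ⟩
      ∑ (λ y → ψ y * kernel (∣ y ─ x ∣ ℕ.+ j))
        ≈⟨ harmonic-kernel (harmonic ψ m) (λ a b → kernel (a ℕ.+ j)) x ⟩
      ∂^ s (λ a b → kernel (a ℕ.+ j)) 0 0 * Up ψ x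
        ≈⟨ *-congʳ (reflexive (D^-∂^ s kernel j 0 0)) ⟩
      scalar * Up ψ x ∎
      where
      pointwise : ∀ y → [ ∣ y ∣ ℕ.≟ s ]* (kernel (∣ x ─ y ∣) * ψ y) ≈ ψ y * kernel (∣ y ─ x ∣ ℕ.+ j)
      pointwise y = cases (∣ y ∣ ℕ.≟ s)
        where
        cases : (d : Dec (∣ y ∣ ≡ s)) → [ d ]* (kernel (∣ x ─ y ∣) * ψ y) ≈ ψ y * kernel (∣ y ─ x ∣ ℕ.+ j)
        cases (yes ∣y∣) = trans (*-comm _ _)
          (*-congˡ (reflexive (≡.cong kernel (∣q─p∣-excess y x j ∣y∣ ∣x∣))))
        cases (no ne) = sym (trans (*-congʳ (supported (harmonic ψ m) y ne)) (zeroˡ _))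

  Λ-scalar : ∀ ψ → ψ ∈ V s s → ∀ x → Λ ψ x ≈ scalar * raise (s ℕ.+ j) ψ x
  Λ-scalar ψ m x = cases (∣ x ∣ ℕ.≟ s ℕ.+ j)
    where
    cases : (d : Dec (∣ x ∣ ≡ s ℕ.+ j)) → Λ ψ x ≈ scalar * ([ d ] * Up ψ x)
    cases (yes e) = trans (on-layer ψ m x e) (*-congˡ (sym (*-identityˡ _)))
    -- `kernel-spec` speaks only of sets of size s + j; elsewhere Λ ψ vanishes because it belongs to
    -- the target component.
    cases (no ne) = trans (IsComponent.supported target (Λ ψ) (maps-into ψ m) x ne)
      (sym (trans (*-congˡ (zeroˡ _)) (zeroʳ _)))

  private
    eval-polynomial : ∀ t → eval polynomial t ≈ polynomialᶜ polynomial t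
    eval-polynomial t = sum-cong-≋ λ i →
      *-congˡ {polynomial i} {ι t ^ toℕ i} {ιᶜ t ^ toℕ i}
        (^-congˡ (toℕ i) {ι t} {ιᶜ t} (sym {ιᶜ t} {ι t} (fromReal-ι t)))

    r+s≤n : s ℕ.+ j ℕ.+ s ≤ n
    r+s≤n = ℕ.≤-trans (ℕ.≤-reflexive (≡.trans (ℕ.+-assoc s j s)
      (≡.trans (≡.cong (s ℕ.+_) (ℕ.+-comm j s)) (≡.trans (≡.sym (ℕ.+-assoc s s j)) (ℕ.+-comm (s ℕ.+ s) j)))))
      (ℕ.≤-trans (ℕ.m≤m+n _ e) (ℕ.≤-reflexive n≡))

    vanishing : (z x : X) → suc ∣ z ∣ ≡ s → ∣ x ∣ ≡ s ℕ.+ j →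
      ∑ (λ y → χ z y * ([ ∣ y ∣ ℕ.≟ suc ∣ z ∣ ]* kernel (∣ x ─ y ∣))) ≈ 0#
    vanishing z x ∣z∣ ∣x∣ = begin
      ∑ (λ y → χ z y * ([ ∣ y ∣ ℕ.≟ suc ∣ z ∣ ]* kernel (∣ x ─ y ∣)))
        ≈⟨ ∑-cong rearrange ⟩
      ∑ (λ y → [ ∣ y ∣ ℕ.≟ s ]* (kernel (∣ x ─ y ∣) * cover y))
        ≈⟨ reflexive (∑-subsets≡∑ _) ⟨
      _
        ≈⟨ kernel-spec cover x ∣x∣ ⟨
      Λ cover x
        ≈⟨ vanishes cover orthogonal x ⟩
      0# ∎
      where
      cover : X → ℂ
      cover y = [ ∣ y ∣ ℕ.≟ suc ∣ z ∣ ]* χ z y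

      rearrange : ∀ y → χ z y * ([ ∣ y ∣ ℕ.≟ suc ∣ z ∣ ]* kernel (∣ x ─ y ∣)) ≈
                        [ ∣ y ∣ ℕ.≟ s ]* (kernel (∣ x ─ y ∣) * cover y)
      rearrange y = cases (∣ y ∣ ℕ.≟ suc ∣ z ∣)
        where
        cases : (d : Dec (∣ y ∣ ≡ suc ∣ z ∣)) → χ z y * ([ d ]* kernel (∣ x ─ y ∣)) ≈
                [ ∣ y ∣ ℕ.≟ s ]* (kernel (∣ x ─ y ∣) * ([ d ]* χ z y))
        cases (yes p) = trans (*-comm _ _) (sym ([]*-true (∣ y ∣ ℕ.≟ s) (≡.trans p ∣z∣)))
        cases (no ne) = trans (zeroʳ _) (sym ([]*-false (∣ y ∣ ℕ.≟ s) λ e → ne (≡.trans e (≡.sym ∣z∣))))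

      -- The inner product is the conjugate of the sum of φ over the supersets of `z`. Harmonicity
      -- equates that sum with `φ z`, which is 0 since `z` has s - 1 points.
      orthogonal : ∀ φ → φ ∈ V s s → ⟨ cover , φ ⟩ ≈ 0#
      orthogonal φ m = begin
        ⟨ cover , φ ⟩
          ≈⟨ reflexive (∑-subsets≡∑ _) ⟩
        ∑ (λ y → cover y * conj (φ y))
          ≈⟨ ∑-cong (λ y → conjugate y (∣ y ∣ ℕ.≟ suc ∣ z ∣)) ⟩
        ∑ (λ y → conj (χ z y * φ y))
          ≈⟨ conj-∑ (λ y → χ z y * φ y) ⟨
        conj (∑ λ y → χ z y * φ y)
          ≈⟨ conj-cong (trans (down (harmonic φ m) z) (supported (harmonic φ m) z λ e →
               ℕ.1+n≢n (≡.trans ∣z∣ (≡.sym e)))) ⟩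
        conj 0#
          ≈⟨ conj-fromReal (RealNumbers.0# ℝ) ⟩
        0# ∎
        where
        open Synthesis.Sesquilinear ℂ-commutativeRing n conj conj-cong conj-+ conj-* conj-conj
          (conj-fromReal (RealNumbers.0# ℝ)) (conj-fromReal (RealNumbers.1# ℝ)) using (conj-∑; conj-[])
        conjugate : ∀ y (d : Dec (∣ y ∣ ≡ suc ∣ z ∣)) → ([ d ]* χ z y) * conj (φ y) ≈ conj (χ z y * φ y)
        conjugate y (yes _) = sym (trans (conj-* (χ z y) (φ y)) (*-congʳ (conj-[] (z ⊆? y))))
        conjugate y (no ne) = trans (zeroˡ _) (sym (trans (conj-cong (trans (*-congˡ
          (supported (harmonic φ m) y λ e → ne (≡.trans e (≡.sym ∣z∣)))) (zeroʳ _))) (conj-fromReal (RealNumbers.0# ℝ))))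

  scalar-value : ιᶜ ((s ℕ.+ j) C s) * (ιᶜ (suc (j ℕ.+ e)) * scalar) ≈ ιᶜ (suc (s ℕ.+ j ℕ.+ e))
  scalar-value = kernel-scalar n s j e n≡ kernel (eval polynomial)
    -- For r₁ = s and r₂ = s + j the domain of the kernel is j, ..., s + j, because 2s + j ≤ n makes
    -- s + j the smaller upper bound.
    (λ k j≤k k≤ → agrees k (ℕ.≤-trans (ℕ.≤-reflexive (ℕ.m+n∸m≡n s j)) j≤k)
      (ℕ.⊓-glb (ℕ.≤-trans k≤ (ℕ.m+n≤o⇒m≤o∸n (s ℕ.+ j) r+s≤n)) k≤))
    (λ t → trans (D^-cong (suc s) t λ i _ _ → eval-polynomial i) (D^-polynomial (suc s) polynomial t))
    normalised vanishing

-- The normalising constants α, β and κ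

module RealNormalisation (ℝ : RealNumbers) where
  open RealNumbers ℝ hiding (zero; _<_; _≤_)
  open RealFacts ℝ
  open IntegerSolver commutativeRing
  open import Algebra.Properties.Semiring.Mult semiring using (×1-homo-*)
  open import Relation.Binary.Reasoning.Setoid setoid

  root⁻¹ : ℕ → Carrier
  root⁻¹ k = √ (ι k) ⁻¹

  ι≉0 : ∀ {m} → m ≢ 0 → ¬ ι m ≈ 0#
  ι≉0 {zero}  ne = contradiction ≡.refl ne
  ι≉0 {suc m} ne = pos⇒≉0 (ι-pos m)

  √ι≉0 : ∀ {k i} → k ≡ suc i → ¬ √ (ι k) ≈ 0#
  √ι≉0 {i = i} ≡.refl = pos⇒≉0 (√ι-pos i)

  root*root⁻¹ : ∀ {k i} → k ≡ suc i → √ (ι k) * root⁻¹ k ≈ 1#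
  root*root⁻¹ e = ⁻¹-inverseʳ _ (√ι≉0 e)

  root⁻¹-unit : ∀ {k i} → k ≡ suc i → root⁻¹ k * root⁻¹ k * ι k ≈ 1#
  root⁻¹-unit {k} e = begin
    root⁻¹ k * root⁻¹ k * ι k
      ≈⟨ *-congˡ (√ι*√ι k) ⟨
    root⁻¹ k * root⁻¹ k * (√ (ι k) * √ (ι k))
      ≈⟨ solve 2 (λ a b → a :* a :* (b :* b) := (b :* a) :* (b :* a)) refl _ _ ⟩
    (√ (ι k) * root⁻¹ k) * (√ (ι k) * root⁻¹ k)
      ≈⟨ trans (*-cong (root*root⁻¹ e) (root*root⁻¹ e)) (*-identityˡ _) ⟩
    1# ∎

  -- In the application `x` is the numerator of α, `√ (ι k) * ι y` its denominator, and `a` over `z`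
  -- the scalar of Λ.
  α-normalises : ∀ {k i} → k ≡ suc i → ∀ x a y z → y ≢ 0 → z ≢ 0 → x ℕ.* a ≡ y ℕ.* z →
    ι x / (√ (ι k) * ι y) * (ι z ⁻¹ * ι a) ≈ root⁻¹ k
  α-normalises {k} k≡ x a y z y≢0 z≢0 count = *-cancel √k*y≉0 (*-cancel (ι≉0 z≢0) (begin
    ι x * (√k * ι y) ⁻¹ * (ι z ⁻¹ * ι a) * (√k * ι y) * ι z
      ≈⟨ solve 6 (λ x q z′ b r z → x :* q :* (z′ :* b) :* r :* z := x :* (r :* q) :* (z :* z′) :* b) refl
           (ι x) ((√k * ι y) ⁻¹) (ι z ⁻¹) (ι a) (√k * ι y) (ι z) ⟩
    ι x * ((√k * ι y) * (√k * ι y) ⁻¹) * (ι z * ι z ⁻¹) * ι a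
      ≈⟨ *-congʳ (trans (*-cong (trans (*-congˡ (⁻¹-inverseʳ _ √k*y≉0)) (*-identityʳ _))
                                (⁻¹-inverseʳ _ (ι≉0 z≢0)))
                        (*-identityʳ _)) ⟩
    ι x * ι a
      ≈⟨ ×1-homo-* x a ⟨
    ι (x ℕ.* a)
      ≡⟨ ≡.cong ι count ⟩
    ι (y ℕ.* z)
      ≈⟨ ×1-homo-* y z ⟩
    ι y * ι z
      ≈⟨ *-identityˡ _ ⟨
    1# * (ι y * ι z)
      ≈⟨ *-congʳ (root*root⁻¹ k≡) ⟨
    √k * root⁻¹ k * (ι y * ι z)
      ≈⟨ solve 4 (λ a b y z → a :* b :* (y :* z) := b :* (a :* y) :* z) refl √k (root⁻¹ k) (ι y) (ι z) ⟩
    root⁻¹ k * (√k * ι y) * ι z ∎))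
    where
    √k = √ (ι k)
    √k*y≉0 : ¬ √k * ι y ≈ 0#
    √k*y≉0 e = ι≉0 y≢0 (*-cancel (√ι≉0 k≡) (trans (*-comm _ _) (trans e (sym (zeroˡ _)))))

  -- The square root in κ is what converts the value of β at the target index into that at the
  -- source index.
  root⁻¹*√-quotient : ∀ {k l i j} → k ≡ suc i → l ≡ suc j → root⁻¹ k * √ (ι k / ι l) ≈ root⁻¹ l
  root⁻¹*√-quotient {k} {l} {i} {j} ≡.refl ≡.refl = begin
    root⁻¹ k * √ (ι k / ι l)             ≈⟨ *-congˡ (√-quotient i j) ⟩
    root⁻¹ k * (√ (ι k) * root⁻¹ l)      ≈⟨ solve 3 (λ a b c → a :* (b :* c) := (b :* a) :* c) refl _ _ _ ⟩
    √ (ι k) * root⁻¹ k * root⁻¹ l        ≈⟨ *-congʳ (root*root⁻¹ {suc i} ≡.refl) ⟩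
    1# * root⁻¹ l                        ≈⟨ *-identityˡ _ ⟩
    root⁻¹ l                             ∎

module Normalisation (ℝ : RealNumbers) where
  open Complex ℝ
  open ComplexFacts ℝ
  open RealNormalisation ℝ
  private
    module R = RealNumbers ℝ
    module Rᵏ = Krawtchouk R.commutativeRing
    module Cᵏ = Krawtchouk ℂ-commutativeRing
  open HarmonicFunctions ℂ-commutativeRing using () renaming (ι to ιᶜ)
  open import Algebra.Properties.Semiring.Mult R.semiring using (×1-homo-*)
  open import Algebra.Properties.Semiring.Exp semiring using (^-congˡ)
  open import Algebra.Properties.Semiring.Sum semiring using (sum-cong-≋)
  open import Relation.Binary.Reasoning.Setoid setoid

  fromReal-unit : ∀ {k i} → k ≡ suc i → fromReal (root⁻¹ k) * conj (fromReal (root⁻¹ k)) * ιᶜ k ≈ 1#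
  fromReal-unit {k} e = begin
    fromReal (root⁻¹ k) * conj (fromReal (root⁻¹ k)) * ιᶜ k
      ≈⟨ *-cong {fromReal (root⁻¹ k) * conj (fromReal (root⁻¹ k))} {fromReal (root⁻¹ k) * fromReal (root⁻¹ k)}
                {ιᶜ k} {fromReal (R.ι k)}
           (*-congˡ {fromReal (root⁻¹ k)} (conj-fromReal (root⁻¹ k))) (fromReal-ι k) ⟩
    fromReal (root⁻¹ k) * fromReal (root⁻¹ k) * fromReal (R.ι k)
      ≈⟨ *-congʳ {fromReal (R.ι k)} (fromReal-* (root⁻¹ k) (root⁻¹ k)) ⟨
    fromReal (root⁻¹ k R.* root⁻¹ k) * fromReal (R.ι k)
      ≈⟨ fromReal-* (root⁻¹ k R.* root⁻¹ k) (R.ι k) ⟨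
    fromReal (root⁻¹ k R.* root⁻¹ k R.* R.ι k)
      ≈⟨ fromReal-cong (root⁻¹-unit e) ⟩
    1# ∎

  α*scalar : ∀ s j e {k i} → k ≡ suc i → ∀ c →
    ιᶜ ((s ℕ.+ j) C s) * (ιᶜ (suc (j ℕ.+ e)) * c) ≈ ιᶜ (suc (s ℕ.+ j ℕ.+ e)) →
    fromReal (R.ι (((s ℕ.+ j ℕ.+ e) P s) ℕ.* ((s ℕ.+ j) P s)) R./
              (R.√ (R.ι k) R.* R.ι (s ! ℕ.* ((s ℕ.+ j ℕ.+ e ℕ.+ 1) P s)))) * c ≈ fromReal (root⁻¹ k)
  α*scalar s j e {k} k≡ c c-value = begin
    fromReal A * c
      ≈⟨ *-congˡ {fromReal A} c-real ⟩
    fromReal A * fromReal (z⁻¹ R.* R.ι (suc a))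
      ≈⟨ fromReal-* A (z⁻¹ R.* R.ι (suc a)) ⟨
    fromReal (A R.* (z⁻¹ R.* R.ι (suc a)))
      ≈⟨ fromReal-cong (α-normalises k≡ x (suc a) y z y≢0 z≢0 (α-count s j e)) ⟩
    fromReal (root⁻¹ k) ∎
    where
    a = s ℕ.+ j ℕ.+ e
    x = (a P s) ℕ.* ((s ℕ.+ j) P s)
    y = s ! ℕ.* ((a ℕ.+ 1) P s)
    z₁ = (s ℕ.+ j) C s
    z₂ = suc (j ℕ.+ e)
    z = z₁ ℕ.* z₂
    A = R.ι x R./ (R.√ (R.ι k) R.* R.ι y)
    z⁻¹ = R.ι z R.⁻¹

    y≢0 : y ≢ 0
    y≢0 eq with ℕ.m*n≡0⇒m≡0∨n≡0 (s !) eq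
    ... | inj₁ z = contradiction z (ℕ.≢-nonZero⁻¹ (s !) {{s ℕ.!≢0}})
    ... | inj₂ z with P-positive {a ℕ.+ 1} {s} (ℕ.≤-trans (ℕ.m≤m+n s j) (ℕ.≤-trans (ℕ.m≤m+n _ e) (ℕ.m≤m+n a 1)))
    ...   | i , eq′ = contradiction (≡.trans (≡.sym eq′) z) λ ()

    z≢0 : z ≢ 0
    z≢0 eq with ℕ.m*n≡0⇒m≡0∨n≡0 z₁ eq
    ... | inj₁ z with C-positive {s ℕ.+ j} {s} (ℕ.m≤m+n s j)
    ...   | i , eq′ = contradiction (≡.trans (≡.sym eq′) z) λ ()

    ι-product : ιᶜ z₁ * ιᶜ z₂ ≈ fromReal (R.ι z)
    ι-product = begin
      ιᶜ z₁ * ιᶜ z₂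
        ≈⟨ *-cong {ιᶜ z₁} {fromReal (R.ι z₁)} {ιᶜ z₂} {fromReal (R.ι z₂)} (fromReal-ι z₁) (fromReal-ι z₂) ⟩
      fromReal (R.ι z₁) * fromReal (R.ι z₂)
        ≈⟨ fromReal-* (R.ι z₁) (R.ι z₂) ⟨
      fromReal (R.ι z₁ R.* R.ι z₂)
        ≈⟨ fromReal-cong (×1-homo-* z₁ z₂) ⟨
      fromReal (R.ι z) ∎

    -- The scalar is a difference of complex kernel values. Solving its equation shows it to be
    -- real, so that the work with square roots can take place in ℝ.
    c-real : c ≈ fromReal (z⁻¹ R.* R.ι (suc a))
    c-real = begin
      c
        ≈⟨ *-identityˡ c ⟨
      1# * c
        ≈⟨ *-congʳ {c} {fromReal z⁻¹ * fromReal (R.ι z)} {1#} (begin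
             fromReal z⁻¹ * fromReal (R.ι z)      ≈⟨ fromReal-* z⁻¹ (R.ι z) ⟨
             fromReal (z⁻¹ R.* R.ι z)             ≈⟨ fromReal-cong (R.trans (R.*-comm _ _) (R.⁻¹-inverseʳ _ (ι≉0 z≢0))) ⟩
             1#                                   ∎) ⟨
      fromReal z⁻¹ * fromReal (R.ι z) * c
        ≈⟨ *-assoc (fromReal z⁻¹) (fromReal (R.ι z)) c ⟩
      fromReal z⁻¹ * (fromReal (R.ι z) * c)
        ≈⟨ *-congˡ {fromReal z⁻¹} {fromReal (R.ι z) * c} {ιᶜ (suc a)} (begin
             fromReal (R.ι z) * c                 ≈⟨ *-congʳ {c} {ιᶜ z₁ * ιᶜ z₂} {fromReal (R.ι z)} ι-product ⟨
             ιᶜ z₁ * ιᶜ z₂ * c                    ≈⟨ *-assoc (ιᶜ z₁) (ιᶜ z₂) c ⟩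
             ιᶜ z₁ * (ιᶜ z₂ * c)                  ≈⟨ c-value ⟩
             ιᶜ (suc a)                           ∎) ⟩
      fromReal z⁻¹ * ιᶜ (suc a)
        ≈⟨ *-congˡ {fromReal z⁻¹} {ιᶜ (suc a)} {fromReal (R.ι (suc a))} (fromReal-ι (suc a)) ⟩
      fromReal z⁻¹ * fromReal (R.ι (suc a))
        ≈⟨ fromReal-* z⁻¹ (R.ι (suc a)) ⟨
      fromReal (z⁻¹ R.* R.ι (suc a)) ∎

  fromReal-krawtchouk : ∀ j k l → fromReal (Rᵏ.krawtchouk-sum j k l) ≈ Cᵏ.krawtchouk-sum j k l
  fromReal-krawtchouk j k l = trans {fromReal (Rᵏ.krawtchouk-sum j k l)} {sum (λ i → fromReal (real i))} {sum complex}
    (fromReal-sum real) (sum-cong-≋ {x = λ i → fromReal (real i)} {y = complex} termwise)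
    where
    count : Fin (suc j) → ℕ
    count i = (k C toℕ i) ℕ.* (l C (j ℕ.∸ toℕ i))
    real : Fin (suc j) → R.Carrier
    real i = (R.- R.1#) R.^ toℕ i R.* R.ι (count i)
    complex : Fin (suc j) → ℂ
    complex i = Cᵏ.sign (toℕ i) * ιᶜ (count i)
    termwise : ∀ i → fromReal (real i) ≈ complex i
    termwise i = begin
      fromReal (real i)
        ≈⟨ fromReal-* ((R.- R.1#) R.^ toℕ i) (R.ι (count i)) ⟩
      fromReal ((R.- R.1#) R.^ toℕ i) * fromReal (R.ι (count i))
        ≈⟨ *-cong {fromReal ((R.- R.1#) R.^ toℕ i)} {Cᵏ.sign (toℕ i)} {fromReal (R.ι (count i))} {ιᶜ (count i)}
             (trans {fromReal ((R.- R.1#) R.^ toℕ i)} {fromReal (R.- R.1#) ^ toℕ i} {Cᵏ.sign (toℕ i)}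
               (fromReal-^ (R.- R.1#) (toℕ i)) (^-congˡ (toℕ i) {fromReal (R.- R.1#)} { - 1# } (fromReal-neg R.1#)))
             (sym {ιᶜ (count i)} {fromReal (R.ι (count i))} (fromReal-ι (count i))) ⟩
      complex i ∎

  κ-mode : ∀ s j k l {p q i i′} → p ≡ suc i → q ≡ suc i′ →
    fromReal (root⁻¹ p) * fromReal ((R.- R.ι 2) R.^ s R.* R.√ (R.ι p R./ R.ι q) R.* Rᵏ.krawtchouk-sum j k l) ≈
    fromReal (root⁻¹ q) * ((- ιᶜ 2) ^ s * Cᵏ.krawtchouk-sum j k l)
  κ-mode s j k l {p} {q} p≡ q≡ = begin
    fromReal (root⁻¹ p) * fromReal (Pw R.* Qt R.* Kr)
      ≈⟨ fromReal-* (root⁻¹ p) (Pw R.* Qt R.* Kr) ⟨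
    fromReal (root⁻¹ p R.* (Pw R.* Qt R.* Kr))
      ≈⟨ fromReal-cong real ⟩
    fromReal (root⁻¹ q R.* (Pw R.* Kr))
      ≈⟨ fromReal-* (root⁻¹ q) (Pw R.* Kr) ⟩
    fromReal (root⁻¹ q) * fromReal (Pw R.* Kr)
      ≈⟨ *-congˡ {fromReal (root⁻¹ q)} (fromReal-* Pw Kr) ⟩
    fromReal (root⁻¹ q) * (fromReal Pw * fromReal Kr)
      ≈⟨ *-congˡ {fromReal (root⁻¹ q)} {fromReal Pw * fromReal Kr} {(- ιᶜ 2) ^ s * Cᵏ.krawtchouk-sum j k l}
           (*-cong {fromReal Pw} {(- ιᶜ 2) ^ s} {fromReal Kr} {Cᵏ.krawtchouk-sum j k l} power (fromReal-krawtchouk j k l)) ⟩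
    fromReal (root⁻¹ q) * ((- ιᶜ 2) ^ s * Cᵏ.krawtchouk-sum j k l) ∎
    where
    Pw = (R.- R.ι 2) R.^ s
    Qt = R.√ (R.ι p R./ R.ι q)
    Kr = Rᵏ.krawtchouk-sum j k l
    real : root⁻¹ p R.* (Pw R.* Qt R.* Kr) R.≈ root⁻¹ q R.* (Pw R.* Kr)
    real = R.trans
      (solve 4 (λ b p q w → b :* (p :* q :* w) := (b :* q) :* (p :* w)) R.refl (root⁻¹ p) Pw Qt Kr)
      (R.*-congʳ (root⁻¹*√-quotient p≡ q≡))
      where open IntegerSolver R.commutativeRing
    power : fromReal Pw ≈ (- ιᶜ 2) ^ s
    power = trans {fromReal Pw} {fromReal (R.- R.ι 2) ^ s} {(- ιᶜ 2) ^ s} (fromReal-^ (R.- R.ι 2) s)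
      (^-congˡ s {fromReal (R.- R.ι 2)} { - ιᶜ 2 } (begin
        fromReal (R.- R.ι 2)   ≈⟨ fromReal-neg (R.ι 2) ⟩
        - fromReal (R.ι 2)     ≈⟨ -‿cong {ιᶜ 2} {fromReal (R.ι 2)} (fromReal-ι 2) ⟨
        - ιᶜ 2                 ∎))

-- T is linear, equivariant and isometric

module Main (ℝ : RealNumbers) (n : ℕ) (V : (r s : ℕ) → PowerSet.Subrep ℝ n)
  (component : ∀ r s → PowerSet.InRange ℝ n r s → PowerSet.IsComponent ℝ n r s (V r s))
  (Λ : (s r₁ r₂ : ℕ) → (PowerSet.X ℝ n → Complex.ℂ ℝ) → PowerSet.X ℝ n → Complex.ℂ ℝ)
  (isΛ : ∀ s r₁ r₂ → PowerSet.InRange ℝ n r₁ s → PowerSet.InRange ℝ n r₂ s →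
         PowerSet.IsΛ ℝ n V s r₁ r₂ (Λ s r₁ r₂)) where
  open Complex ℝ
  open PowerSet ℝ n
  open Transform V Λ
  open ComplexFacts ℝ
  open SubsetSums ℝ n
  open RealNormalisation ℝ using (root⁻¹)
  open Normalisation ℝ
  private
    module R = RealNumbers ℝ
    module 𝓛 = Representation 𝓛
    module ⨁ = Representation ⨁𝓥
    module 𝓥 (s : S) = Representation (𝓥 (toℕ s))
  open HarmonicFunctions ℂ-commutativeRing using ([_]; Up; Harmonic)
    renaming (ι to ιᶜ)
  open FiniteDifferences ℂ-commutativeRing using (Up-below; Up-above)
  open Antisymmetry ℂ-commutativeRing using (column-antisymmetrizer; column-product; Up-antisymmetrizer)
  module Asm = Synthesis ℂ-commutativeRing n
  open Asm using (raise; synthesize)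
  open Degrees n using (s+s+N≡n; beyond)
  open Asm.Sesquilinear conj conj-cong conj-+ conj-* conj-conj
    (conj-fromReal (RealNumbers.0# ℝ)) (conj-fromReal (RealNumbers.1# ℝ)) using (inner; synthesize-isometric)
  open import Algebra.Properties.Monoid.Sum +-monoid using (sum-cong-≗; sum-cong-≋)
  open import Relation.Binary.Reasoning.Setoid setoid

  width : S → ℕ
  width s = n ∸ 2 ℕ.* toℕ s

  excess : (s : S) → J s → ℕ
  excess s j = width s ∸ toℕ j

  j+e≡width : ∀ s (j : J s) → toℕ j ℕ.+ excess s j ≡ width s
  j+e≡width s j = ℕ.m+[n∸m]≡n (Fin.toℕ≤pred[n] j)

  s+s≤n : ∀ (s : S) → toℕ s ℕ.+ toℕ s ≤ n
  s+s≤n s = ℕ.≤-trans (ℕ.m≤m+n _ (width s)) (ℕ.≤-reflexive (s+s+N≡n s))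

  s+[s+j+e]≡n : ∀ s (j : J s) → toℕ s ℕ.+ (toℕ s ℕ.+ toℕ j ℕ.+ excess s j) ≡ n
  s+[s+j+e]≡n s j = ≡.trans (≡.cong (toℕ s ℕ.+_) (≡.trans (ℕ.+-assoc (toℕ s) (toℕ j) _)
    (≡.cong (toℕ s ℕ.+_) (j+e≡width s j))))
    (≡.trans (≡.sym (ℕ.+-assoc (toℕ s) (toℕ s) (width s))) (s+s+N≡n s))

  j+2s+e≡n : ∀ s (j : J s) → toℕ j ℕ.+ (toℕ s ℕ.+ toℕ s) ℕ.+ excess s j ≡ n
  j+2s+e≡n s j = ≡.trans
    (identity (toℕ s) (toℕ j) (excess s j)) (s+[s+j+e]≡n s j)
    where
    open import Data.Nat.Tactic.RingSolver using (solve-∀)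
    identity : ∀ s j e → j ℕ.+ (s ℕ.+ s) ℕ.+ e ≡ s ℕ.+ (s ℕ.+ j ℕ.+ e)
    identity = solve-∀

  source-range : ∀ s → InRange (toℕ s) (toℕ s)
  source-range s = ℕ.≤-refl , s+s≤n s

  target-range : ∀ s (j : J s) → InRange (deg s j) (toℕ s)
  target-range s j = ℕ.m≤m+n (toℕ s) (toℕ j) , ℕ.≤-trans
    (ℕ.≤-trans (ℕ.≤-reflexive (ℕ.+-comm (deg s j) (toℕ s))) (ℕ.+-monoʳ-≤ (toℕ s) (ℕ.m≤m+n (deg s j) (excess s j))))
    (ℕ.≤-reflexive (s+[s+j+e]≡n s j))

  module Scalar (s : S) (j : J s) = ScalarAction ℝ n V (toℕ s) (toℕ j) (excess s j) (j+2s+e≡n s j)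
    (component _ _ (source-range s)) (component _ _ (target-range s j))
    (Λ (toℕ s) (toℕ s) (deg s j)) (isΛ _ _ _ (source-range s) (target-range s j))

  binomial : (s : S) → J s → ℕ
  binomial s j = width s C toℕ j

  binomial-positive : ∀ s (j : J s) → ∃ λ i → binomial s j ≡ suc i
  binomial-positive s j = C-positive (Fin.toℕ≤pred[n] j)

  β : (s : S) → J s → ℂ
  β s j = fromReal (root⁻¹ (binomial s j))

  β-value : ∀ s j → fromReal (α (toℕ s) (toℕ s) (deg s j)) * Scalar.scalar s j ≈ β s j
  β-value s j = trans
    (*-congʳ {Scalar.scalar s j} (reflexive (≡.cong fromReal (≡.cong₂ (λ a b →
      R.ι ((a P toℕ s) ℕ.* (deg s j P toℕ s)) R./ (R.√ (R.ι b) R.* R.ι (toℕ s ! ℕ.* ((a ℕ.+ 1) P toℕ s))))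
      n∸s middle))))
    (α*scalar (toℕ s) (toℕ j) (excess s j) (proj₂ (binomial-positive s j)) (Scalar.scalar s j) (Scalar.scalar-value s j))
    where
    n∸s : n ∸ toℕ s ≡ toℕ s ℕ.+ toℕ j ℕ.+ excess s j
    n∸s = ≡.trans (≡.cong (_∸ toℕ s) (≡.sym (s+[s+j+e]≡n s j))) (ℕ.m+n∸m≡n (toℕ s) _)
    -- Since r₁ = s, the first binomial under the root of α is (N choose 0) = 1.
    middle : (width s C (toℕ s ∸ toℕ s)) ℕ.* (width s C (deg s j ∸ toℕ s)) ≡ binomial s j
    middle = ≡.trans
      (≡.cong₂ (λ a b → (width s C a) ℕ.* (width s C b)) (ℕ.n∸n≡0 (toℕ s)) (ℕ.m+n∸m≡n (toℕ s) (toℕ j)))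
      (ℕ.*-identityˡ (binomial s j))

  functions : Vector ⨁𝓥 → Asm.Vectors
  functions v s j = proj₁ (v s j)

  harmonic : ∀ v s j → Harmonic (toℕ s) (functions v s j)
  harmonic v s j = Component.component-harmonic ℝ n (toℕ s) (V (toℕ s) (toℕ s))
    (component _ _ (source-range s)) _ (proj₂ (v s j))

  sumᵛ-L² : ∀ {k} (f : Fin k → X → ℂ) x → sumᵛ L² f x ≡ sum λ i → f i x
  sumᵛ-L² {zero}  f x = ≡.refl
  sumᵛ-L² {suc k} f x = ≡.cong (f zero x +_) (sumᵛ-L² (f ∘ suc) x)

  T≈synthesize : ∀ v x → T v x ≈ synthesize β (functions v) x
  T≈synthesize v x = trans
    (reflexive (≡.trans (sumᵛ-L² (λ s → sumᵛ L² λ j → Λ̃v s j) x)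
                        (sum-cong-≗ λ s → sumᵛ-L² (Λ̃v s) x)))
    (sum-cong-≋ {x = λ s → sum λ j → Λ̃v s j x} {y = λ s → sum λ j → β s j * raise (deg s j) (proj₁ (v s j)) x} λ s →
      sum-cong-≋ {x = λ j → Λ̃v s j x} {y = λ j → β s j * raise (deg s j) (proj₁ (v s j)) x} λ j → term s j)
    where
    Λ̃v : (s : S) → J s → X → ℂ
    Λ̃v s j = Λ̃ (toℕ s) (toℕ s) (deg s j) (proj₁ (v s j))
    term : ∀ s j → Λ̃v s j x ≈ β s j * raise (deg s j) (proj₁ (v s j)) x
    term s j = begin
      a * Λ (toℕ s) (toℕ s) (deg s j) (proj₁ (v s j)) x
        ≈⟨ *-congˡ {a} (Scalar.Λ-scalar s j (proj₁ (v s j)) (proj₂ (v s j)) x) ⟩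
      a * (Scalar.scalar s j * u)
        ≈⟨ *-assoc a (Scalar.scalar s j) u ⟨
      a * Scalar.scalar s j * u
        ≈⟨ *-congʳ {u} (β-value s j) ⟩
      β s j * u ∎
      where
      a = fromReal (α (toℕ s) (toℕ s) (deg s j))
      u = raise (deg s j) (proj₁ (v s j)) x

  via : ∀ v {a} x → synthesize β (functions v) x ≈ a → T v x ≈ a
  via v x e = trans (T≈synthesize v x) e

  T-cong : ∀ {v w} → v ⨁.≈ᴹ w → T v 𝓛.≈ᴹ T w
  T-cong {v} {w} e x = via v x (trans (Asm.synthesize-cong {functions v} {functions w} β e x) (sym (T≈synthesize w x)))

  T-+ : ∀ v w → T (v ⨁.+ᴹ w) 𝓛.≈ᴹ (T v 𝓛.+ᴹ T w)
  T-+ v w x = via (v ⨁.+ᴹ w) x (trans (Asm.synthesize-+ β (functions v) (functions w) x)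
    (sym (+-cong (T≈synthesize v x) (T≈synthesize w x))))

  T-* : ∀ c v → T (c ⨁.*ₗ v) 𝓛.≈ᴹ (c 𝓛.*ₗ T v)
  T-* c v x = via (c ⨁.*ₗ v) x (trans (Asm.synthesize-* β c (functions v) x)
    (*-congˡ {c} (sym (T≈synthesize v x))))

  T-neg : ∀ v → T (⨁.-ᴹ v) 𝓛.≈ᴹ (𝓛.-ᴹ T v)
  T-neg v x = via (⨁.-ᴹ v) x (trans (Asm.synthesize-neg β (functions v) x) (-‿cong (sym (T≈synthesize v x))))

  T-0 : T ⨁.0ᴹ 𝓛.≈ᴹ 𝓛.0ᴹ
  T-0 x = via ⨁.0ᴹ x (Asm.synthesize-0 β x)

  T-linear : IsLinear ⨁.space L² T
  T-linear = record
    { +ᴹ-isGroupHomomorphism = record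
      { isMonoidHomomorphism = record
        { isMagmaHomomorphism = record
          { isRelHomomorphism = record { cong = λ {v} {w} → T-cong {v} {w} }
          ; homo = T-+
          }
        ; ε-homo = T-0
        }
      ; ⁻¹-homo = T-neg
      }
    ; *ₗ-homo = T-*
    }

  T-equivariant : IsEquivariant ⨁𝓥 𝓛 T
  T-equivariant g v x = via (⨁.act g v) x (trans
    (Asm.synthesize-permute β (Perm.flip g) (functions v) x)
    (sym (T≈synthesize v (permute (Perm.flip g) x))))

  T-isometry : ∀ v w → ⟨ T v , T w ⟩ ≈ ⟨ v , w ⟩⨁
  T-isometry v w = begin
    ⟨ T v , T w ⟩
      ≈⟨ reflexive (∑-subsets≡∑ _) ⟩
    inner (T v) (T w)
      ≈⟨ Asm.Sesquilinear.inner-cong conj conj-cong conj-+ conj-* conj-conj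
           (conj-fromReal R.0#) (conj-fromReal R.1#) (T≈synthesize v) (T≈synthesize w) ⟩
    inner (synthesize β (functions v)) (synthesize β (functions w))
      ≈⟨ synthesize-isometric β (λ s j → fromReal-unit (proj₂ (binomial-positive s j)))
           (functions v) (functions w) (harmonic v) (harmonic w) ⟩
    (sum λ s → sum λ j → inner (functions v s j) (functions w s j))
      ≡⟨ sum-cong-≗ {x = λ s → sum λ j → inner (functions v s j) (functions w s j)}
                    {y = λ s → sum λ j → ⟨ functions v s j , functions w s j ⟩} (λ s →
           sum-cong-≗ {x = λ j → inner (functions v s j) (functions w s j)}
                      {y = λ j → ⟨ functions v s j , functions w s j ⟩} λ j →
             ≡.sym (∑-subsets≡∑ λ x → functions v s j x * conj (functions w s j x))) ⟩
    ⟨ v , w ⟩⨁ ∎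

  -- T is bijective

  ⟨ψ,ψ⟩-nonneg : ∀ ψ → R.0# R.≤ re ⟨ ψ , ψ ⟩
  ⟨ψ,ψ⟩-nonneg ψ = ≡.subst (λ z → R.0# R.≤ re z) (≡.sym (∑-subsets≡∑ _))
    (∑-re-nonneg (λ x → ψ x * conj (ψ x)) λ x → re-*-conj-nonneg (ψ x))

  ⟨ψ,ψ⟩-zero : ∀ ψ → re ⟨ ψ , ψ ⟩ R.≈ R.0# → ∀ x → ψ x ≈ 0#
  ⟨ψ,ψ⟩-zero ψ e x = re-*-conj-zero (ψ x) (∑-re-zero (λ x → ψ x * conj (ψ x))
    (λ x → re-*-conj-nonneg (ψ x)) (≡.subst (λ z → re z R.≈ R.0#) (∑-subsets≡∑ _) e) x)

  -- By isometry the squared norms of the components add up to that of `T v`, which is 0. They are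
  -- nonnegative reals, so each is 0, and the inner product is definite.
  T-kernel : ∀ v → (∀ x → T v x ≈ 0#) → v ⨁.≈ᴹ ⨁.0ᴹ
  T-kernel v z s j = ⟨ψ,ψ⟩-zero (functions v s j)
    (sum-re-zero (λ j → norm s j) (λ j → nonneg s j)
      (sum-re-zero (λ s → sum (norm s)) (λ s → sum-re-nonneg (norm s) (nonneg s)) (proj₁ total) s) j)
    where
    norm : (s : S) → J s → ℂ
    norm s j = ⟨ functions v s j , functions v s j ⟩
    nonneg : ∀ s j → R.0# R.≤ re (norm s j)
    nonneg s j = ⟨ψ,ψ⟩-nonneg (functions v s j)
    total : ⟨ v , v ⟩⨁ ≈ 0#
    total = begin
      ⟨ v , v ⟩⨁          ≈⟨ T-isometry v v ⟨
      ⟨ T v , T v ⟩       ≈⟨ reflexive (∑-subsets≡∑ _) ⟩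
      inner (T v) (T v)   ≈⟨ HarmonicFunctions.∑-zero ℂ-commutativeRing (λ x → T v x * conj (T v x))
                               (λ x → trans (*-congʳ {conj (T v x)} (z x)) (zeroˡ (conj (T v x)))) ⟩
      0#                  ∎

  T-injective : ∀ {v w} → T v 𝓛.≈ᴹ T w → v ⨁.≈ᴹ w
  T-injective {v} {w} e s j x = x∙y⁻¹≈ε⇒x≈y (functions v s j x) (functions w s j x)
    (T-kernel (v ⨁.+ᴹ (⨁.-ᴹ w)) difference s j x)
    where
    open import Algebra.Properties.Group +-group using (x∙y⁻¹≈ε⇒x≈y)
    difference : ∀ x → T (v ⨁.+ᴹ (⨁.-ᴹ w)) x ≈ 0#
    difference x = begin
      T (v ⨁.+ᴹ (⨁.-ᴹ w)) x      ≈⟨ T-+ v (⨁.-ᴹ w) x ⟩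
      T v x + T (⨁.-ᴹ w) x       ≈⟨ +-cong (e x) (T-neg w x) ⟩
      T w x + - T w x            ≈⟨ -‿inverseʳ (T w x) ⟩
      0#                         ∎

  InImage : (X → ℂ) → Set
  InImage ψ = ∃ λ v → ∀ x → T v x ≈ ψ x

  single : (s : S) → J s → Vector (𝓥 (toℕ s)) → Vector ⨁𝓥
  single s j h s′ j′ with s′ Fin.≟ s
  ... | no _ = 𝓥.0ᴹ s′
  ... | yes ≡.refl with j′ Fin.≟ j
  ...   | no _  = 𝓥.0ᴹ s
  ...   | yes _ = h

  single-same : ∀ s j h y → functions (single s j h) s j y ≡ proj₁ h y
  single-same s j h y with s Fin.≟ s
  ... | no ne = contradiction ≡.refl ne
  ... | yes ≡.refl with j Fin.≟ j
  ...   | no ne = contradiction ≡.refl ne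
  ...   | yes _ = ≡.refl

  single-other : ∀ s j h s′ → s′ ≢ s → ∀ j′ y → functions (single s j h) s′ j′ y ≡ 0#
  single-other s j h s′ ne j′ y with s′ Fin.≟ s
  ... | no _ = ≡.refl
  ... | yes e = contradiction e ne

  single-other′ : ∀ s j h j′ → j′ ≢ j → ∀ y → functions (single s j h) s j′ y ≡ 0#
  single-other′ s j h j′ ne y with s Fin.≟ s
  ... | no ne′ = contradiction ≡.refl ne′
  ... | yes ≡.refl with j′ Fin.≟ j
  ...   | no _  = ≡.refl
  ...   | yes e = contradiction e ne

  raise-∈ : ∀ s j (h : Vector (𝓥 (toℕ s))) → InImage (λ x → β s j * raise (deg s j) (proj₁ h) x)
  raise-∈ s j h = single s j h , λ x → via (single s j h) x (begin
    synthesize β (functions (single s j h)) x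
      ≈⟨ Asm.synthesize-single β (functions (single s j h)) s j
           (λ s′ ne j′ y → reflexive (single-other s j h s′ ne j′ y))
           (λ j′ ne y → reflexive (single-other′ s j h j′ ne y)) x ⟩
    β s j * raise (deg s j) (functions (single s j h) s j) x
      ≈⟨ *-congˡ {β s j} (*-congˡ {[ ∣ x ∣ ℕ.≟ deg s j ]}
           (Asm.Up-cong (λ y → reflexive (single-same s j h y)) x)) ⟩
    β s j * raise (deg s j) (proj₁ h) x ∎)

  InImage-resp : ∀ {φ ψ} → (∀ x → φ x ≈ ψ x) → InImage φ → InImage ψ
  InImage-resp e (v , p) = v , λ x → trans (p x) (e x)

  InImage-scale : ∀ c {ψ} → InImage ψ → InImage (λ x → c * ψ x)
  InImage-scale c (v , p) = c ⨁.*ₗ v , λ x → trans (T-* c v x) (*-congˡ {c} (p x))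

  Columns-∈ : ℕ → Set
  Columns-∈ s = (l u : Fin s → Fin n) →
    (∀ {i j} → l i ≡ l j → i ≡ j) → (∀ {i j} → u i ≡ u j → i ≡ j) → (∀ i j → l i ≢ u j) →
    ∀ r → InImage λ x → [ ∣ x ∣ ℕ.≟ r ] * column-product l u x

  -- On X_r the product is the restriction of `Up E` for a polytabloid E in `V s s`. For r in s,
  -- ..., n - s it is thus a multiple of T at the vector whose only component is E; for other r it
  -- is zero.
  columns-∈ : (s : S) → Columns-∈ (toℕ s)
  columns-∈ s l u l-inj u-inj l≢u r = InImage-resp same (by-degree (toℕ s ℕ.≤? r))
    where
    tab = Tableaux.tableau ℝ n (toℕ s) (s+s≤n s) l u l-inj u-inj l≢u
    t = proj₁ tab
    E : X → ℂ
    E = column-antisymmetrizer (Tableau.lower t) (Tableau.upper t)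
    E-∈ : E ∈ V (toℕ s) (toℕ s)
    E-∈ = Component.antisymmetrizer-∈ ℝ n (toℕ s) _ (component _ _ (source-range s)) t
    E-harmonic : Harmonic (toℕ s) E
    E-harmonic = Component.component-harmonic ℝ n (toℕ s) _ (component _ _ (source-range s)) E E-∈

    column-product-cong : ∀ {k} {l l′ u u′ : Fin k → Fin n} → (∀ i → l i ≡ l′ i) → (∀ i → u i ≡ u′ i) →
      ∀ x → column-product l u x ≡ column-product l′ u′ x
    column-product-cong {zero}  p q x = ≡.refl
    column-product-cong {suc k} p q x = ≡.cong₂ _*_
      (≡.cong₂ (λ a b → Antisymmetry.bit ℂ-commutativeRing x a - Antisymmetry.bit ℂ-commutativeRing x b) (p zero) (q zero))
      (column-product-cong (p ∘ suc) (q ∘ suc) x)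

    same : ∀ x → [ ∣ x ∣ ℕ.≟ r ] * Up E x ≈ [ ∣ x ∣ ℕ.≟ r ] * column-product l u x
    same x = *-congˡ {[ ∣ x ∣ ℕ.≟ r ]} (trans (Up-antisymmetrizer (Tableau.lower t) (Tableau.upper t) x)
      (reflexive (column-product-cong (proj₁ (proj₂ tab)) (proj₂ (proj₂ tab)) x)))

    outside-range : (∀ x → ∣ x ∣ ≡ r → Up E x ≈ 0#) → InImage (raise r E)
    outside-range z = ⨁.0ᴹ , λ x → trans (T-0 x) (sym (vanish x (∣ x ∣ ℕ.≟ r)))
      where
      vanish : ∀ x (d : Dec (∣ x ∣ ≡ r)) → [ d ] * Up E x ≈ 0#
      vanish x (yes e) = trans (*-congˡ {1#} (z x e)) (zeroʳ 1#)
      vanish x (no _)  = zeroˡ (Up E x)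

    by-degree : Dec (toℕ s ≤ r) → InImage (raise r E)
    by-degree (no s≰r) = outside-range λ { x ≡.refl → Up-below E-harmonic x (ℕ.≰⇒> s≰r) }
    by-degree (yes s≤r) = by-index (r ∸ toℕ s ℕ.<? suc (width s))
      where
      by-index : Dec (r ∸ toℕ s < suc (width s)) → InImage (raise r E)
      by-index (yes lt) = ≡.subst (λ r → InImage (raise r E))
        (≡.trans (≡.cong (toℕ s ℕ.+_) (Fin.toℕ-fromℕ< lt)) (ℕ.m+[n∸m]≡n s≤r))
        (InImage-resp (λ x → begin
          c * (β s j * raise (deg s j) E x)   ≈⟨ *-assoc c (β s j) (raise (deg s j) E x) ⟨
          c * β s j * raise (deg s j) E x     ≈⟨ *-congʳ {raise (deg s j) E x} c*β ⟩
          1# * raise (deg s j) E x            ≈⟨ *-identityˡ (raise (deg s j) E x) ⟩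
          raise (deg s j) E x                 ∎)
          (InImage-scale c (raise-∈ s j (E , E-∈))))
        where
        j : J s
        j = Fin.fromℕ< lt
        -- This inverts β, by the identity β · conj β · (N choose j) = 1 that also gives the
        -- isometry.
        c = conj (β s j) * ιᶜ (binomial s j)
        c*β : c * β s j ≈ 1#
        c*β = begin
          c * β s j                                       ≈⟨ *-comm c (β s j) ⟩
          β s j * (conj (β s j) * ιᶜ (binomial s j))      ≈⟨ *-assoc (β s j) (conj (β s j)) (ιᶜ (binomial s j)) ⟨
          β s j * conj (β s j) * ιᶜ (binomial s j)        ≈⟨ fromReal-unit (proj₂ (binomial-positive s j)) ⟩
          1#                                              ∎
      by-index (no ≮) = outside-range λ { x ≡.refl → Up-above E-harmonic x (beyond s s≤r ≮) }

  T-surjective : ∀ ψ → InImage ψ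
  T-surjective = Spanning.everything ℂ-commutativeRing n InImage InImage-resp
    (⨁.0ᴹ , T-0)
    (λ (v , p) (w , q) → v ⨁.+ᴹ w , λ x → trans (T-+ v w x) (+-cong (p x) (q x)))
    InImage-scale ι-inverse
    (λ s 2s≤n → ≡.subst Columns-∈ (Fin.toℕ-fromℕ< (bound s 2s≤n)) (columns-∈ (Fin.fromℕ< (bound s 2s≤n))))
    where
    bound : ∀ s → s ℕ.+ s ≤ n → s < suc ⌊ n /2⌋
    bound s le = s≤s (ℕ.≤-trans (ℕ.≤-reflexive (ℕ.n≡⌊n+n/2⌋ s)) (ℕ.⌊n/2⌋-mono le))

  T-unitary : IsUnitaryIso T
  T-unitary = record
    { repIso = record
      { linearIso = record
        { isLeftModuleMonomorphism = record
          { isLeftModuleHomomorphism = T-linear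
          ; injective = λ {v} {w} → T-injective {v} {w}
          }
        ; surjective = λ ψ → proj₁ (T-surjective ψ) ,
            λ {v} e x → trans (T-cong {v} {proj₁ (T-surjective ψ)} e x) (proj₂ (T-surjective ψ) x)
        }
      ; equivariant = T-equivariant
      }
    ; isometry = T-isometry
    }

  -- The Fourier transform in the coordinates of T

  κᶜ : (s : S) → J s → J s → ℂ
  κᶜ s j k = fromReal (κ (toℕ s) (deg s j) (deg s k))

  β*κ : ∀ s j k → β s k * κᶜ s j k ≈ β s j * ((- ιᶜ 2) ^ toℕ s *
    Krawtchouk.krawtchouk-sum ℂ-commutativeRing (toℕ j) (toℕ k) (width s ∸ toℕ k))
  β*κ s j k = trans
    (*-congˡ {β s k} (reflexive (≡.cong₂ (λ a b → fromReal ((R.- R.ι 2) R.^ toℕ s R.*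
        R.√ (R.ι (width s C b) R./ R.ι (width s C a)) R.* krawtchouk a b (width s)))
      (ℕ.m+n∸m≡n (toℕ s) (toℕ j)) (ℕ.m+n∸m≡n (toℕ s) (toℕ k)))))
    (κ-mode (toℕ s) (toℕ j) (toℕ k) (width s ∸ toℕ k)
      (proj₂ (binomial-positive s k)) (proj₂ (binomial-positive s j)))

  functions-w : ∀ v s k x → functions (w v) s k x ≡ sum λ j → κᶜ s j k * functions v s j x
  functions-w v s k x = evaluate λ j → 𝓥._*ₗ_ s (κᶜ s j k) (v s j)
    where
    evaluate : ∀ {m} (f : Fin m → Vector (𝓥 (toℕ s))) →
      proj₁ (sumᵛ (𝓥.space s) f) x ≡ sum λ j → proj₁ (f j) x
    evaluate {zero}  f = ≡.refl
    evaluate {suc m} f = ≡.cong (proj₁ (f zero) x +_) (evaluate (f ∘ suc))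

  fourier-T : ∀ v x → fourier (T v) x ≈ T (w v) x
  fourier-T v x = begin
    fourier (T v) x
      ≈⟨ reflexive (∑-subsets≡∑ _) ⟩
    Asm.fourier (T v) x
      ≈⟨ HarmonicFunctions.∑-cong ℂ-commutativeRing (λ y → *-congˡ {sign ∣ x ∩ y ∣} (T≈synthesize v y)) ⟩
    Asm.fourier (synthesize β (functions v)) x
      ≈⟨ Asm.fourier-synthesize β κᶜ β*κ (functions v) (harmonic v) x ⟩
    synthesize β (λ s k x → sum λ j → κᶜ s j k * functions v s j x) x
      ≈⟨ Asm.synthesize-cong {λ s k x → sum λ j → κᶜ s j k * functions v s j x} {functions (w v)} β
           (λ s k x → reflexive (≡.sym (functions-w v s k x))) x ⟩
    synthesize β (functions (w v)) x
      ≈⟨ T≈synthesize (w v) x ⟨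
    T (w v) x ∎

  -- `F` is defined through a chosen preimage of the Fourier transform under T. Injectivity allows
  -- the comparison with `w v` to be made after applying T.
  F≈w : ∀ v → F T-unitary v ⨁.≈ᴹ w v
  F≈w v = T-injective {F T-unitary v} {w v} λ x →
    trans (proj₂ (T-surjective (fourier (T v))) x) (fourier-T v x)

theorem5 : (ℝ : RealNumbers) (n : ℕ) → 1 ≤ n →
    let open PowerSet ℝ n in
    (V : (r s : ℕ) → Subrep) →
    (∀ r s → InRange r s → IsComponent r s (V r s)) →
    (Λ : (s r₁ r₂ : ℕ) → Vector 𝓛 → Vector 𝓛) →
    (∀ s r₁ r₂ → InRange r₁ s → InRange r₂ s → IsΛ V s r₁ r₂ (Λ s r₁ r₂)) →
    let open Transform V Λ in
    Σ[ T-iso ∈ IsUnitaryIso T ]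
    (∀ v → Representation._≈ᴹ_ ⨁𝓥 (F T-iso v) (w v))
theorem5 ℝ n _ V component Λ isΛ = T-unitary , F≈w
  where open Main ℝ n V component Λ isΛ
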